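{- Let $\mathcal{A},\mathcal{B}$ be skew diagrams with $[\mathcal{A}]=[\mathcal{B}]$. Then: (1) $\pi_{nw}(\mathcal{A})=\pi_{nw}(\mathcal{B})$; (2) for every $i$, $nw_i(\mathcal{A})$ and $nw_i(\mathcal{B})$ decompose into the same number of ribbons; (3) for every $i$, $nw_i(\mathcal{A})$ and $nw_i(\mathcal{B})$ have the same arm length and the same leg length; (4) for every $i$, if $\tilde{\mathcal{A}}$ resp. $\tilde{\mathcal{B}}$ is obtained by removing the first $i$ northwest ribbons from $\mathcal{A}$ resp. $\mathcal{B}$, then $[\tilde{\mathcal{A}}]=[\tilde{\mathcal{B}}]$.
   Context: For $\mu\subseteq\lambda$ the skew diagram $\lambda/\mu$ is the set of boxes of $\lambda$ not in $\mu$ (matrix coordinates, up to translation); its skew character is $[\lambda/\mu]=\sum_\nu c(\lambda;\mu,\nu)[\nu]$ with $c$ the Littlewood–Richardson coefficients and $[\nu]$ irreducible characters of the symmetric group. Two skew diagrams are disconnected if no box of one shares a row or column with a box of the other. A ribbon is a connected skew diagram with no $2\times2$ square; a weak ribbon is a skew diagram all of whose connected components are ribbons. The arm (resp. leg) length of a weak ribbon is its number of columns (resp. rows) minus its number of component ribbons. Northwest ribbons: $nw_1(\mathcal{A})$ is the set of boxes $(i,j)\in\mathcal{A}$ with $(i-1,j-1)\notin\mathcal{A}$ (for connected $\mathcal{A}$, the ribbon along the northwest border from the lowest box of the leftmost column to the rightmost box of the top row; in general the union of those of the components), and $nw_{k+1}(\mathcal{A})$ is $nw_1$ of $\mathcal{A}$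 with $nw_1(\mathcal{A}),\dots,nw_k(\mathcal{A})$ removed; these are weak ribbons. $\pi_{nw}(\mathcal{A})=(|nw_1(\mathcal{A})|,|nw_2(\mathcal{A})|,\dots)$. -}

module Defs where

open import Data.Bool.Base using (Bool; true; false; _∧_; _∨_; not; if_then_else_)
open import Data.Nat.Base using (ℕ; zero; suc; _≤_; _∸_; _≡ᵇ_; _<ᵇ_; _≤ᵇ_)
open import Data.Nat.Properties using (_≟_)
open import Data.Product.Base using (_×_; _,_; proj₁; proj₂)
open import Data.List.Base
  using (List; []; _∷_; length; map; filterᵇ; concatMap; concat; upTo; partitionᵇ; deduplicate; zip)
open import Data.Bool.ListAction using (all; any)
open import Relation.Binary.PropositionalEquality using (_≡_)

part : List ℕ → ℕ → ℕ
part []       _       = 0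
part (x ∷ _)  zero    = x
part (_ ∷ xs) (suc i) = part xs i

IsPartition : List ℕ → Set
IsPartition ν = ∀ i → part ν (suc i) ≤ part ν i

_⊆ₚ_ : List ℕ → List ℕ → Set
μ ⊆ₚ λ′ = ∀ i → part μ i ≤ part λ′ i

-- Boxes (row , column), matrix coordinates, 0-indexed

Box : Set
Box = ℕ × ℕ

row col : Box → ℕ
row = proj₁
col = proj₂

_==B_ : Box → Box → Bool
(a , b) ==B (c , d) = (a ≡ᵇ c) ∧ (b ≡ᵇ d)

_∈B_ : Box → List Box → Bool
b ∈B S = any (b ==B_) S

skewBoxes : List ℕ → List ℕ → List Box
skewBoxes λ′ μ = concatMap rowBoxes (upTo (length λ′))
  where
  rowBoxes : ℕ → List Box
  rowBoxes r = map (λ c → r , c) (filterᵇ (λ c → part μ r ≤ᵇ c) (upTo (part λ′ r)))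

diagPredIn : List Box → Box → Bool
diagPredIn S (suc i , suc j) = (i , j) ∈B S
diagPredIn S _               = false

nw₁ : List Box → List Box
nw₁ S = filterᵇ (λ b → not (diagPredIn S b)) S

-- nw i S is nw_i(S) for i ≥ 1 (nw 0 S = [] is junk);
-- removeNW k S is S with nw_1(S),…,nw_k(S) removed.
nw       : ℕ → List Box → List Box
removeNW : ℕ → List Box → List Box
nw zero    S = []
nw (suc k) S = nw₁ (removeNW k S)
removeNW zero    S = S
removeNW (suc k) S = filterᵇ (λ b → not (b ∈B nw (suc k) S)) (removeNW k S)

sharesLine : Box → Box → Bool
sharesLine (a , b) (c , d) = (a ≡ᵇ c) ∨ (b ≡ᵇ d)

insertComp : Box → List (List Box) → List (List Box)
insertComp b cs with partitionᵇ (λ C → any (sharesLine b) C) cs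
... | touching , rest = (b ∷ concat touching) ∷ rest

components : List Box → List (List Box)
components []      = []
components (b ∷ S) = insertComp b (components S)

numComponents : List Box → ℕ
numComponents S = length (components S)

numRows numCols : List Box → ℕ
numRows S = length (deduplicate _≟_ (map row S))
numCols S = length (deduplicate _≟_ (map col S))

armLength legLength : List Box → ℕ
armLength S = numCols S ∸ numComponents S
legLength S = numRows S ∸ numComponents S

-- Littlewood–Richardson coefficients c(λ;μ,ν) for the skew diagram S = λ/μ,
-- as the number of LR tableaux of shape S and content ν: semistandard
-- fillings (rows weakly increasing, columns strictly increasing) whose
-- reverse reading word (rows top to bottom, each read right to left) is a
-- lattice word.

words : ℕ → ℕ → List (List ℕ)
words zero    m = [] ∷ []
words (suc n) m = concatMap (λ v → map (v ∷_) (words n m)) (map suc (upTo m))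

countB : {A : Set} → (A → Bool) → List A → ℕ
countB p xs = length (filterᵇ p xs)

Filling : Set
Filling = List (Box × ℕ)

rowWeak : Filling → Bool
rowWeak F = all (λ p → all (λ q →
  if (row (proj₁ p) ≡ᵇ row (proj₁ q)) ∧ (col (proj₁ p) <ᵇ col (proj₁ q))
  then proj₂ p ≤ᵇ proj₂ q else true) F) F

colStrict : Filling → Bool
colStrict F = all (λ p → all (λ q →
  if (col (proj₁ p) ≡ᵇ col (proj₁ q)) ∧ (row (proj₁ p) <ᵇ row (proj₁ q))
  then proj₂ p <ᵇ proj₂ q else true) F) F

-- q comes no later than p in the reverse reading word
readBefore : Box → Box → Bool
readBefore q p = (row q <ᵇ row p) ∨ ((row q ≡ᵇ row p) ∧ (col p ≤ᵇ col q))

-- every prefix of the reverse reading word has at least as many k's as (k+1)'s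
lattice : ℕ → Filling → Bool
lattice m F = all (λ p → all (λ k →
  countB (λ q → readBefore (proj₁ q) (proj₁ p) ∧ (proj₂ q ≡ᵇ suc k)) F
    ≥ᵇ countB (λ q → readBefore (proj₁ q) (proj₁ p) ∧ (proj₂ q ≡ᵇ suc (suc k))) F)
  (upTo m)) F
  where
  _≥ᵇ_ : ℕ → ℕ → Bool
  a ≥ᵇ b = b ≤ᵇ a

hasContent : List ℕ → Filling → Bool
hasContent ν F = all (λ k → countB (λ q → proj₂ q ≡ᵇ suc k) F ≡ᵇ part ν k) (upTo (length ν))

isLR : List ℕ → Filling → Bool
isLR ν F = rowWeak F ∧ colStrict F ∧ lattice (length ν) F ∧ hasContent ν F

lrCoeff : List Box → List ℕ → ℕ
lrCoeff S ν = countB (λ w → isLR ν (zip S w)) (words (length S) (length ν))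

-- [S] = [T] : equal multiplicity of every irreducible character [ν]
SameSkewChar : List Box → List Box → Set
SameSkewChar S T = ∀ ν → IsPartition ν → lrCoeff S ν ≡ lrCoeff T ν

{-# OPTIONS --safe #-}
-- Let N(ν/μ, τ/σ) be the number of matrices x ≥ 0 with row sums ν - μ and
-- column sums τ - σ such that filling row r of ν/μ with x(r,k) letters k is
-- column strict and, added to σ, has partition content after each row.  It
-- equals ⟨s_{ν/μ}, s_{τ/σ}⟩, and the Littlewood–Richardson coefficients are the
-- case σ = ∅.  Moving a horizontal strip of size s from the inside of the
-- chain of row contents to the outside (jeu de taquin, one row at a time) shows
--   Σ_{ρ/σ} N(ν/μ, τ/ρ) = Σ_{τ/ρ} N(ν/μ, ρ/σ),
-- the sums running over horizontal strips of size s.  By induction on σ, skew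
-- shapes with equal characters then have equal N against every τ/σ.
--
-- Now let τ/σ be the disjoint union of a row (p), a column (1^q) and a shape
-- τ′/σ′.  The letters of the row and the column fill a weak ribbon along the
-- northwest border, so p + q ≤ |nw₁|.  In case of equality they fill exactly
-- nw₁: a box with a right neighbour in nw₁ takes the letter of the row, a box
-- with a neighbour above takes one of the column, and the one remaining box of
-- each component is free.  What is left is a filling of the shape with nw₁
-- removed.  Hence the maximal p + q is |nw₁|, then p ranges from the arm length
-- to the arm length plus the number of components, and the minimal p gives N of
-- the remaining shape.  Iterating proves the theorem.

module Submission where

open import Defs
open import Data.Bool.Base using (Bool; true; false; T; _∧_; _∨_; not; if_then_else_)
open import Data.Bool.ListAction using (all; any)
open import Data.Bool.Properties using (T-∧; T-∨; T-≡; T?; ∧-identityʳ)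
open import Data.Empty using (⊥-elim; ⊥-elim-irr)
open import Data.Fin.Base as Fin using (Fin)
open import Data.Fin.Permutation using (↔⇒≡)
open import Data.Fin.Properties using (+↔⊎)
open import Data.Irrelevant using ([_])
open import Data.List.Base using (List; []; _∷_; _++_; length; lookup; map; filter; filterᵇ; concatMap; concat; upTo; applyUpTo; replicate; take; drop; zip; cartesianProduct; cartesianProductWith; deduplicate; partitionᵇ)
open import Data.List.Membership.Propositional using (_∈_; find)
open import Data.List.Membership.Propositional.Properties using (∈-lookup; ∈-upTo⁺; ∈-upTo⁻; ∈-map⁺; ∈-map⁻; ∈-++⁺ˡ; ∈-++⁺ʳ; ∈-++⁻; ∈-filter⁺; ∈-filter⁻; ∈-deduplicate⁺; ∈-deduplicate⁻; ∈-cartesianProduct⁺; ∈-cartesianProductWith⁺; ∈-cartesianProductWith⁻)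
open import Data.List.Properties using (++-identityʳ; map-++; length-++; filter-++; filter-all; filter-none; filter-accept; filter-reject; length-filter; length-replicate; ∷-injective; take++drop≡id) renaming (≡-dec to List-≡-dec)
open import Data.List.Relation.Unary.All as All using (All; []; _∷_)
open import Data.List.Relation.Unary.All.Properties using (all⁺; all⁻; replicate⁺; take⁺; drop⁺; concat⁺) renaming (++⁺ to All-++⁺)
open import Data.List.Relation.Unary.AllPairs using (AllPairs; []; _∷_)
open import Data.List.Relation.Unary.Any as Any using (here; there; index)
open import Data.List.Relation.Unary.Any.Properties using (any⁺; any⁻; lookup-index)
open import Data.List.Relation.Unary.Unique.DecPropositional.Properties using (deduplicate-!)
open import Data.List.Relation.Unary.Unique.Propositional using (Unique)
open import Data.List.Relation.Unary.Unique.Propositional.Properties using (upTo⁺; cartesianProductWith⁺) renaming (map⁺ to Unique-map⁺; filter⁺ to Unique-filter⁺)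
open import Data.Nat.Base
open import Data.Nat.Properties
open import Data.Nat.Tactic.RingSolver using (solve-∀)
open import Data.Product.Base using (Σ; ∃; _×_; _,_; proj₁; proj₂)
open import Data.Product.Properties using () renaming (≡-dec to ×-≡-dec)
open import Data.Refinement.Base using (Refinement; value) renaming (_,_ to _,ʳ_)
open import Data.Sum.Base using (_⊎_; inj₁; inj₂)
open import Data.Sum.Function.Propositional using (_⊎-↔_)
open import Data.Unit.Base using (⊤; tt)
open import Data.Vec.Base using (Vec; []; _∷_)
open import Data.Vec.Properties using () renaming (≡-dec to Vec-≡-dec)
open import Data.Vec.Relation.Unary.All as Allᵛ using ([]; _∷_)
open import Function.Base using (_∘_)
open import Function.Bundles using (_↔_; mk↔ₛ′; Inverse; Equivalence)
open import Function.Construct.Composition using (_↔-∘_)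
open import Function.Construct.Identity using (↔-id)
open import Function.Construct.Symmetry using (↔-sym)
open import Relation.Binary.Definitions using (DecidableEquality; tri<; tri≈; tri>)
open import Relation.Binary.PropositionalEquality
open import Relation.Nullary.Decidable using (Dec; yes; no; recompute; _×-dec_; ¬?)
open import Relation.Nullary.Negation.Core using (¬_)
import Data.List.Membership.DecPropositional as DecMembership

-- Counting by bijections

-- Littlewood-Richardson coefficients test ν/μ against straight shapes only, whereas detecting the
-- ribbon takes a disjoint union with a row and a column, which is skew. This is why the counts are
-- extended to all σ. The strip identity expresses that skewing by h_s commutes with skewing by s_σ.
-- It drives an induction because its right side keeps σ fixed: apply it to σ without its last row,
-- of length s; then all terms are known except one on the left, that of σ itself, since every other
-- ρ has a shorter last row. This term is obtained by subtraction, so from there on only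
-- cardinalities are compared. Hence the finite sets below, whose membership proofs are irrelevant:
-- two elements are equal as soon as their matrices are. In the union the column stands in column K
-- and the row starts in column 2K, where K is positive and bounds the first row of τ. So the three
-- pieces share no line, and the lattice condition between letters of different pieces holds by
-- itself.

Finite : Set → Set
Finite X = Σ ℕ λ n → Fin n ↔ X

value-injective : {A : Set} {P : A → Set} {x y : Refinement A P} → value x ≡ value y → x ≡ y
value-injective refl = refl

-- The inverse laws are known only under the irrelevant evidence for P and Q; deciding equality of
-- the values recovers them from it.
refinement-↔ : {A B : Set} {P : A → Set} {Q : B → Set} → DecidableEquality A → DecidableEquality B →
  (f : A → B) (g : B → A) → (∀ a → P a → Q (f a)) → (∀ b → Q b → P (g b)) →
  (∀ a → P a → g (f a) ≡ a) → (∀ b → Q b → f (g b) ≡ b) →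
  Refinement A P ↔ Refinement B Q
refinement-↔ _≟A_ _≟B_ f g fP gQ gf fg = mk↔ₛ′
  (λ { (a ,ʳ [ p ]) → f a ,ʳ [ fP a p ] })
  (λ { (b ,ʳ [ q ]) → g b ,ʳ [ gQ b q ] })
  (λ { (b ,ʳ [ q ]) → value-injective (recompute (f (g b) ≟B b) (fg b q)) })
  (λ { (a ,ʳ [ p ]) → value-injective (recompute (g (f a) ≟A a) (gf a p)) })

refinement-⇔ : {A : Set} {P Q : A → Set} → (∀ a → P a → Q a) → (∀ a → Q a → P a) → Refinement A P ↔ Refinement A Q
refinement-⇔ f g = mk↔ₛ′
  (λ { (a ,ʳ [ p ]) → a ,ʳ [ f a p ] }) (λ { (a ,ʳ [ q ]) → a ,ʳ [ g a q ] }) (λ _ → refl) (λ _ → refl)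

lookup-injective : {A : Set} {xs : List A} → Unique xs → ∀ i j → lookup xs i ≡ lookup xs j → i ≡ j
lookup-injective (x∉ ∷ u) Fin.zero Fin.zero eq = refl
lookup-injective (x∉ ∷ u) Fin.zero (Fin.suc j) eq = ⊥-elim (All.lookup x∉ (∈-lookup j) eq)
lookup-injective (x∉ ∷ u) (Fin.suc i) Fin.zero eq = ⊥-elim (All.lookup x∉ (∈-lookup i) (sym eq))
lookup-injective (x∉ ∷ u) (Fin.suc i) (Fin.suc j) eq = cong Fin.suc (lookup-injective u i j eq)

Fin-length↔∈ : {A : Set} → DecidableEquality A → {xs : List A} → Unique xs → Fin (length xs) ↔ Refinement A (_∈ xs)
Fin-length↔∈ _≟A_ {xs} u = mk↔ₛ′
  (λ i → lookup xs i ,ʳ [ ∈-lookup i ])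
  (λ { (x ,ʳ [ x∈ ]) → index (recompute (x ∈? xs) x∈) })
  (λ { (x ,ʳ [ x∈ ]) → value-injective (sym (lookup-index (recompute (x ∈? xs) x∈))) })
  (λ i → sym (lookup-injective u i _ (lookup-index (recompute (lookup xs i ∈? xs) (∈-lookup i)))))
  where open DecMembership _≟A_ using (_∈?_)

finite-refinement : {A : Set} {P : A → Set} → DecidableEquality A → (∀ a → Dec (P a)) →
  (xs : List A) → (∀ a → P a → a ∈ xs) → Finite (Refinement A P)
finite-refinement {P = P} _≟A_ P? xs complete = length ys ,
  (refinement-⇔ {P = _∈ ys} (λ a a∈ → proj₂ (∈-filter⁻ P? {xs = xs} (∈-deduplicate⁻ _≟A_ (filter P? xs) a∈)))
                 (λ a p → ∈-deduplicate⁺ _≟A_ (∈-filter⁺ P? (complete a p) p))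
   ↔-∘ Fin-length↔∈ _≟A_ (deduplicate-! _≟A_ (filter P? xs)))
  where ys = deduplicate _≟A_ (filter P? xs)

-- Subtraction of cardinalities: the result is read off from equal sizes and is not a restriction of
-- `eq`.
⊎-cancelʳ-↔ : {X X′ Y Y′ : Set} → Finite X → Finite X′ → Finite Y → (X ⊎ Y) ↔ (X′ ⊎ Y′) → Y ↔ Y′ → X ↔ X′
⊎-cancelʳ-↔ (a , fX) (a′ , fX′) (b , fY) eq y =
  fX′ ↔-∘ (subst (λ c → Fin a ↔ Fin c) a≡a′ (↔-id _) ↔-∘ ↔-sym fX)
  where
  a≡a′ : a ≡ a′
  a≡a′ = +-cancelʳ-≡ b a a′ (↔⇒≡
    (↔-sym (+↔⊎ {a′} {b}) ↔-∘ (↔-sym (fX′ ⊎-↔ (y ↔-∘ fY)) ↔-∘ (eq ↔-∘ ((fX ⊎-↔ fY) ↔-∘ +↔⊎ {a} {b})))))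

Σ-cong-↔ : {I : Set} {F G : I → Set} → (∀ i → F i ↔ G i) → Σ I F ↔ Σ I G
Σ-cong-↔ e = mk↔ₛ′
  (λ { (i , x) → i , Inverse.to (e i) x })
  (λ { (i , y) → i , Inverse.from (e i) y })
  (λ { (i , y) → cong (i ,_) (Inverse.strictlyInverseˡ (e i) y) })
  (λ { (i , x) → cong (i ,_) (Inverse.strictlyInverseʳ (e i) x) })

refinement-Σ : {A B : Set} (C : A → Set) (Q : A → B → Set) →
  Refinement (A × B) (λ p → C (proj₁ p) × Q (proj₁ p) (proj₂ p)) ↔ Σ (Refinement A C)
      (λ r → Refinement B (Q (value r)))
refinement-Σ C Q = mk↔ₛ′
  (λ { ((a , b) ,ʳ [ p ]) → (a ,ʳ [ proj₁ p ]) , (b ,ʳ [ proj₂ p ]) })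
  (λ { ((a ,ʳ [ c ]) , (b ,ʳ [ q ])) → (a , b) ,ʳ [ c , q ] })
  (λ _ → refl) (λ _ → refl)

refinement-⊎ : {A : Set} {P : A → Set} {D : A → Set} → (∀ a → Dec (D a)) →
  Refinement A P ↔ (Refinement A (λ a → D a × P a) ⊎ Refinement A (λ a → ¬ D a × P a))
refinement-⊎ {A = A} {P} {D} D? = mk↔ₛ′ to from to∘from from∘to
  where
  split : ∀ a → .(P a) → Dec (D a) → Refinement A (λ a → D a × P a) ⊎ Refinement A (λ a → ¬ D a × P a)
  split a p (yes d) = inj₁ (a ,ʳ [ d , p ])
  split a p (no d)  = inj₂ (a ,ʳ [ d , p ])
  to : Refinement A P → Refinement A (λ a → D a × P a) ⊎ Refinement A (λ a → ¬ D a × P a)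
  to (a ,ʳ [ p ]) = split a p (D? a)
  from : Refinement A (λ a → D a × P a) ⊎ Refinement A (λ a → ¬ D a × P a) → Refinement A P
  from (inj₁ (a ,ʳ [ p ])) = a ,ʳ [ proj₂ p ]
  from (inj₂ (a ,ʳ [ p ])) = a ,ʳ [ proj₂ p ]
  to∘from : ∀ y → to (from y) ≡ y
  to∘from (inj₁ (a ,ʳ [ p ])) with D? a
  ... | yes d = refl
  ... | no ¬d = ⊥-elim-irr (¬d (proj₁ p))
  to∘from (inj₂ (a ,ʳ [ p ])) with D? a
  ... | yes d = ⊥-elim-irr (proj₁ p d)
  ... | no ¬d = refl
  from∘to : ∀ x → from (to x) ≡ x
  from∘to (a ,ʳ [ p ]) with D? a
  ... | yes d = refl
  ... | no ¬d = refl

-- Sequences and partial sums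

Seq : Set
Seq = ℕ → ℕ

infixl 6 _⊕_
_⊕_ : Seq → Seq → Seq
(f ⊕ g) i = f i + g i

psum : Seq → ℕ → ℕ
psum f zero    = 0
psum f (suc k) = psum f k + f k

Decr : Seq → Set
Decr f = ∀ i → f (suc i) ≤ f i

Supp : ℕ → Seq → Set
Supp n f = ∀ i → n ≤ i → f i ≡ 0

-- The boxes b added to σ form a horizontal strip: row i + 1 does not reach below a box added to row
-- i. Monotonicity of σ and of σ ⊕ b is contained in this.
Strip : Seq → Seq → Set
Strip σ b = ∀ i → σ (suc i) + b (suc i) ≤ σ i

psum-cong : ∀ {f g} → (∀ i → f i ≡ g i) → ∀ k → psum f k ≡ psum g k
psum-cong e zero    = refl
psum-cong e (suc k) = cong₂ _+_ (psum-cong e k) (e k)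

-- Both sides are the maximum.
m+[n∸m]≡n+[m∸n] : ∀ m n → m + (n ∸ m) ≡ n + (m ∸ n)
m+[n∸m]≡n+[m∸n] zero    zero    = refl
m+[n∸m]≡n+[m∸n] zero    (suc n) = sym (+-identityʳ (suc n))
m+[n∸m]≡n+[m∸n] (suc m) zero    = +-identityʳ (suc m)
m+[n∸m]≡n+[m∸n] (suc m) (suc n) = cong suc (m+[n∸m]≡n+[m∸n] m n)

-- In the application c i counts the boxes passing from row i to row i - 1; only the transfers at
-- the two ends survive in the sum.
psum-telescope : ∀ {f f′ c : Seq} → (∀ i → f′ i + c i ≡ f i + c (suc i)) →
  ∀ k → psum f′ k + c 0 ≡ psum f k + c k
psum-telescope h zero = refl
psum-telescope {f} {f′} {c} h (suc k) = begin
  psum f′ k + f′ k + c 0    ≡⟨ lem₁ (psum f′ k) (f′ k) (c 0) ⟩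
  psum f′ k + c 0 + f′ k    ≡⟨ cong (_+ f′ k) (psum-telescope {f} {f′} {c} h k) ⟩
  psum f k + c k + f′ k     ≡⟨ lem₂ (psum f k) (c k) (f′ k) ⟩
  psum f k + (f′ k + c k)   ≡⟨ cong (psum f k +_) (h k) ⟩
  psum f k + (f k + c (suc k)) ≡⟨ +-assoc (psum f k) (f k) _ ⟨
  psum f k + f k + c (suc k) ∎
  where
  open ≡-Reasoning
  lem₁ : ∀ x y z → x + y + z ≡ x + z + y
  lem₁ = solve-∀
  lem₂ : ∀ x y z → x + y + z ≡ x + (z + y)
  lem₂ = solve-∀

psum-mono : ∀ f {m n} → m ≤ n → psum f m ≤ psum f n
psum-mono f {m} {n} m≤n with m≤n⇒m<n∨m≡n m≤n
... | inj₂ refl = ≤-refl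
psum-mono f {m} {suc n} _ | inj₁ (s≤s m≤n) = m≤n⇒m≤n+o _ (psum-mono f m≤n)

≤psum : ∀ f {i n} → i < n → f i ≤ psum f n
≤psum f i<n = ≤-trans (m≤n+m _ _) (psum-mono f i<n)

psum-supp : ∀ {f n} → Supp n f → ∀ k → n ≤ k → psum f k ≡ psum f n
psum-supp {f} {n} s k n≤k with m≤n⇒m<n∨m≡n n≤k
... | inj₂ refl = refl
psum-supp {f} {n} s (suc k) _ | inj₁ (s≤s n≤k) =
  trans (cong₂ _+_ (psum-supp {f} s k n≤k) (s k n≤k)) (+-identityʳ _)

+≤psum : ∀ f {i j n} → i < j → j < n → f i + f j ≤ psum f n
+≤psum f {j = j} i<j j<n = ≤-trans (+-monoˡ-≤ (f j) (≤psum f i<j)) (psum-mono f j<n)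

psum-cong-< : ∀ {f g : Seq} k → (∀ i → i < k → f i ≡ g i) → psum f k ≡ psum g k
psum-cong-< zero    e = refl
psum-cong-< (suc k) e = cong₂ _+_ (psum-cong-< k (λ i i<k → e i (m≤n⇒m≤1+n i<k))) (e k ≤-refl)

psum-≤ : ∀ {f g : Seq} k → (∀ i → i < k → f i ≤ g i) → psum f k ≤ psum g k
psum-≤ zero    h = z≤n
psum-≤ (suc k) h = +-mono-≤ (psum-≤ k (λ i i<k → h i (m≤n⇒m≤1+n i<k))) (h k ≤-refl)

-- Turns the extremal values of p + q and of p into equalities in each single row.
psum-≤-tight : ∀ {f g : Seq} k → (∀ i → i < k → f i ≤ g i) → psum g k ≤ psum f k → ∀ i → i < k → f i ≡ g i
psum-≤-tight {f} {g} (suc k) h total i i<k with m≤n⇒m<n∨m≡n (≤-pred i<k)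
... | inj₁ i<k′ = psum-≤-tight k h′ (+-cancelʳ-≤ (g k) _ _ (≤-trans total (+-monoʳ-≤ (psum f k) (h k ≤-refl)))) i i<k′
  where h′ = λ j j<k → h j (m≤n⇒m≤1+n j<k)
... | inj₂ refl = ≤-antisym (h i ≤-refl) (+-cancelˡ-≤ (psum f i) _ _
  (≤-trans (+-monoˡ-≤ (g i) (psum-≤ i (λ j j<k → h j (m≤n⇒m≤1+n j<k)))) total))

psum-⊕ : ∀ (f g : Seq) k → psum (f ⊕ g) k ≡ psum f k + psum g k
psum-⊕ f g zero    = refl
psum-⊕ f g (suc k) = trans (cong (_+ (f k + g k)) (psum-⊕ f g k)) (lem (psum f k) (psum g k) (f k) (g k))
  where
  lem : ∀ x y z w → x + y + (z + w) ≡ x + z + (y + w)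
  lem = solve-∀

psum-0 : ∀ k → psum (λ _ → 0) k ≡ 0
psum-0 zero    = refl
psum-0 (suc k) = trans (+-identityʳ _) (psum-0 k)

psum-1 : ∀ k → psum (λ _ → 1) k ≡ k
psum-1 zero    = refl
psum-1 (suc k) = trans (cong (_+ 1) (psum-1 k)) (+-comm k 1)

psum-head : ∀ (f : Seq) k → psum f (suc k) ≡ f 0 + psum (f ∘ suc) k
psum-head f zero    = +-comm 0 (f 0)
psum-head f (suc k) = trans (cong (_+ f (suc k)) (psum-head f k)) (+-assoc (f 0) _ _)

psum-split : ∀ (f : Seq) a b → psum f (a + b) ≡ psum f a + psum (λ j → f (a + j)) b
psum-split f a zero    = trans (cong (psum f) (+-identityʳ a)) (sym (+-identityʳ _))
psum-split f a (suc b) = trans (cong (psum f) (+-suc a b))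
  (trans (cong (_+ f (a + b)) (psum-split f a b)) (+-assoc (psum f a) _ _))

psum-swap : ∀ (X : ℕ → ℕ → ℕ) q R → psum (λ r → psum (X r) q) R ≡ psum (λ k → psum (λ r → X r k) R) q
psum-swap X q zero    = sym (psum-0 q)
psum-swap X q (suc R) = trans (cong (_+ psum (X R) q) (psum-swap X q R)) (sym (psum-⊕ _ _ q))

unit : ℕ → ℕ → Seq
unit zero    x zero    = x
unit zero    x (suc k) = 0
unit (suc ℓ) x zero    = 0
unit (suc ℓ) x (suc k) = unit ℓ x k

unit-≢ : ∀ ℓ x k → ℓ ≢ k → unit ℓ x k ≡ 0
unit-≢ zero    x zero    h = ⊥-elim (h refl)
unit-≢ zero    x (suc k) h = refl
unit-≢ (suc ℓ) x zero    h = refl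
unit-≢ (suc ℓ) x (suc k) h = unit-≢ ℓ x k (h ∘ cong suc)

unit-≡ : ∀ ℓ x → unit ℓ x ℓ ≡ x
unit-≡ zero    x = refl
unit-≡ (suc ℓ) x = unit-≡ ℓ x

psum-unit-≤ : ∀ ℓ x k → k ≤ ℓ → psum (unit ℓ x) k ≡ 0
psum-unit-≤ ℓ x k k≤ℓ = trans (psum-cong-< k (λ i i<k → unit-≢ ℓ x i (λ { refl → <-irrefl refl (≤-trans i<k k≤ℓ) })))
    (psum-0 k)

psum-unit-> : ∀ ℓ x k → ℓ < k → psum (unit ℓ x) k ≡ x
psum-unit-> ℓ x k ℓ<k = trans (psum-supp (λ i ℓ<i → unit-≢ ℓ x i (λ { refl → <-irrefl refl ℓ<i })) k ℓ<k)
  (cong₂ _+_ (psum-unit-≤ ℓ x ℓ ≤-refl) (unit-≡ ℓ x))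

-- Switching two horizontal strips

strip⇒decr : ∀ {σ b} → Strip σ b → Decr σ
strip⇒decr s i = m+n≤o⇒m≤o _ (s i)

strip⇒decr-⊕ : ∀ {σ b} → Strip σ b → Decr (σ ⊕ b)
strip⇒decr-⊕ s i = m≤n⇒m≤n+o _ (s i)

strip-cong : ∀ {σ σ′ b b′} → (∀ i → σ i ≡ σ′ i) → (∀ i → b i ≡ b′ i) → Strip σ b → Strip σ′ b′
strip-cong e e′ s i = subst₂ _≤_ (cong₂ _+_ (e (suc i)) (e′ (suc i))) (e i) (s i)

-- Let a be a horizontal strip on σ and b one on σ ⊕ a.  The b-boxes of row
-- i + 1 lying directly below an a-box number carry (i + 1); switching the two
-- strips moves them up one row.
carry : Seq → Seq → Seq → Seq
carry σ a b zero    = 0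
carry σ a b (suc i) = (σ (suc i) + a (suc i) + b (suc i)) ∸ σ i

-- Row i of the strip b gains the boxes carried up from row i + 1 and loses those carried up to row
-- i - 1; the strip a moves the opposite way.
inner outer : Seq → Seq → Seq → Seq
inner σ a b i = (b i + carry σ a b (suc i)) ∸ carry σ a b i
outer σ a b i = (a i + carry σ a b i) ∸ carry σ a b (suc i)

module Switch {σ a b : Seq} (sa : Strip σ a) (sb : Strip (σ ⊕ a) b) where

  c b′ a′ : Seq
  c  = carry σ a b
  b′ = inner σ a b
  a′ = outer σ a b

  c≤a : ∀ i → c (suc i) ≤ a i
  c≤a i = m≤n+o⇒m∸n≤o _ (σ i) (sb i)

  c≤b : ∀ i → c i ≤ b i
  c≤b zero    = z≤n
  c≤b (suc i) = m≤n+o⇒m∸n≤o _ (σ i) (+-monoˡ-≤ (b (suc i)) (sa i))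

  b′+c : ∀ i → b′ i + c i ≡ b i + c (suc i)
  b′+c i = m∸n+n≡m (m≤n⇒m≤n+o _ (c≤b i))

  a′+c : ∀ i → a′ i + c (suc i) ≡ a i + c i
  a′+c i = m∸n+n≡m (m≤n⇒m≤n+o _ (c≤a i))

  b′+a′ : ∀ i → b′ i + a′ i ≡ a i + b i
  b′+a′ i = +-cancelʳ-≡ (c i + c (suc i)) _ _ (begin
    b′ i + a′ i + (c i + c (suc i))   ≡⟨ lem₁ (b′ i) (a′ i) (c i) (c (suc i)) ⟩
    (b′ i + c i) + (a′ i + c (suc i)) ≡⟨ cong₂ _+_ (b′+c i) (a′+c i) ⟩
    (b i + c (suc i)) + (a i + c i)   ≡⟨ lem₂ (b i) (c (suc i)) (a i) (c i) ⟩
    a i + b i + (c i + c (suc i))     ∎)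
    where
    open ≡-Reasoning
    lem₁ : ∀ x y z w → x + y + (z + w) ≡ (x + z) + (y + w)
    lem₁ = solve-∀
    lem₂ : ∀ x y z w → (x + y) + (z + w) ≡ z + x + (w + y)
    lem₂ = solve-∀

  ⊕-swap : ∀ i → (σ ⊕ b′ ⊕ a′) i ≡ (σ ⊕ a ⊕ b) i
  ⊕-swap i = trans (+-assoc (σ i) (b′ i) (a′ i)) (trans (cong (σ i +_) (b′+a′ i)) (sym (+-assoc (σ i) (a i) (b i))))

  strip-inner : Strip σ b′
  strip-inner i = +-cancelʳ-≤ (c (suc i)) _ _ (begin
    σ (suc i) + b′ (suc i) + c (suc i)           ≡⟨ +-assoc (σ (suc i)) _ _ ⟩
    σ (suc i) + (b′ (suc i) + c (suc i))         ≡⟨ cong (σ (suc i) +_) (b′+c (suc i)) ⟩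
    σ (suc i) + (b (suc i) + c (suc (suc i)))    ≤⟨ +-monoʳ-≤ (σ (suc i)) (+-monoʳ-≤ (b (suc i)) (c≤a (suc i))) ⟩
    σ (suc i) + (b (suc i) + a (suc i))          ≡⟨ lem (σ (suc i)) (b (suc i)) (a (suc i)) ⟩
    σ (suc i) + a (suc i) + b (suc i)            ≤⟨ m≤n+m∸n _ (σ i) ⟩
    σ i + c (suc i)                              ∎)
    where
    open ≤-Reasoning
    lem : ∀ x y z → x + (y + z) ≡ x + z + y
    lem = solve-∀

  c≤b′ : ∀ i → c (suc i) ≤ b′ i
  c≤b′ i = +-cancelʳ-≤ (c i) _ _ (begin
    c (suc i) + c i   ≡⟨ +-comm (c (suc i)) (c i) ⟩
    c i + c (suc i)   ≤⟨ +-monoˡ-≤ (c (suc i)) (c≤b i) ⟩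
    b i + c (suc i)   ≡⟨ b′+c i ⟨
    b′ i + c i        ∎)
    where open ≤-Reasoning

  strip-outer : Strip (σ ⊕ b′) a′
  strip-outer i = begin
    σ (suc i) + b′ (suc i) + a′ (suc i)   ≡⟨ ⊕-swap (suc i) ⟩
    σ (suc i) + a (suc i) + b (suc i)     ≤⟨ m≤n+m∸n _ (σ i) ⟩
    σ i + c (suc i)                       ≤⟨ +-monoʳ-≤ (σ i) (c≤b′ i) ⟩
    σ i + b′ i                            ∎
    where open ≤-Reasoning

  -- The carry depends only on σ and on the total σ ⊕ a ⊕ b, and the switch changes neither. This
  -- makes the switch an involution.
  carry-switch : ∀ i → carry σ b′ a′ i ≡ c i
  carry-switch zero    = refl
  carry-switch (suc i) = cong (_∸ σ i) (⊕-swap (suc i))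

  inner-involutive : ∀ i → inner σ b′ a′ i ≡ a i
  inner-involutive i = trans
    (cong₂ (λ x y → (a′ i + x) ∸ y) (carry-switch (suc i)) (carry-switch i))
    (trans (cong (_∸ c i) (a′+c i)) (m+n∸n≡m (a i) (c i)))

  outer-involutive : ∀ i → outer σ b′ a′ i ≡ b i
  outer-involutive i = trans
    (cong₂ (λ x y → (b′ i + x) ∸ y) (carry-switch i) (carry-switch (suc i)))
    (trans (cong (_∸ c (suc i)) (b′+c i)) (m+n∸n≡m (b i) (c (suc i))))

  -- Column strictness compares partial sums over the letters below k, so their change under the
  -- switch is needed and not only that of the total.
  psum-inner : ∀ k → psum b′ k ≡ psum b k + c k
  psum-inner k = trans (sym (+-identityʳ _)) (psum-telescope {b} {b′} {c} b′+c k)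

  psum-outer : ∀ k → psum a′ k + c k ≡ psum a k
  psum-outer k = trans (sym (psum-telescope {a′} {a} {c} (λ i → sym (a′+c i)) k)) (+-identityʳ _)

  module _ {n : ℕ} (na : Supp n a) (nb : Supp n b) where

    carry-supp : Supp n c
    carry-supp zero    _   = refl
    carry-supp (suc i) n≤i = m≤n⇒m∸n≡0 (subst (_≤ σ i)
      (sym (trans (cong₂ (λ x y → σ (suc i) + x + y) (na (suc i) n≤i) (nb (suc i) n≤i))
           (trans (+-identityʳ _) (+-identityʳ _)))) (strip⇒decr {σ} {a} sa i))

    inner-supp : Supp n b′
    inner-supp i n≤i = trans (cong₂ (λ x y → (x + y) ∸ c i) (nb i n≤i) (carry-supp (suc i) (m≤n⇒m≤1+n n≤i)))
        (0∸n≡0 (c i))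

    outer-supp : Supp n a′
    outer-supp i n≤i = trans (cong₂ (λ x y → (x + y) ∸ c (suc i)) (na i n≤i) (carry-supp i n≤i)) (0∸n≡0 (c (suc i)))

    psum-inner-supp : psum b′ n ≡ psum b n
    psum-inner-supp = trans (psum-inner n) (trans (cong (psum b n +_) (carry-supp n ≤-refl)) (+-identityʳ _))

    psum-outer-supp : psum a′ n ≡ psum a n
    psum-outer-supp = trans (sym (+-identityʳ _))
        (trans (cong (psum a′ n +_) (sym (carry-supp n ≤-refl))) (psum-outer n))

-- Column strictness of two consecutive rows b, f of a tableau starting in
-- columns m₀, m₁; the rows are given by their letter multiplicities.
ColStrict : ℕ → ℕ → Seq → Seq → Set
ColStrict m₀ m₁ b f = ∀ k → m₁ + psum f (suc k) ≤ m₀ + psum b k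

-- Having passed the row content b, the strip leaves as `a′` and meets f, the content of the next
-- row. Column strictness of the two rows involves both switches at once.
module SwitchTwice {σ a b f : Seq} (sa : Strip σ a) (sb : Strip (σ ⊕ a) b)
                   (sf : Strip (σ ⊕ a ⊕ b) f) where
  module S = Switch {σ} {a} {b} sa sb
  open S using (c; b′; a′)

  sf′ : Strip (σ ⊕ b′ ⊕ a′) f
  sf′ = strip-cong {σ ⊕ a ⊕ b} {σ ⊕ b′ ⊕ a′} {f} {f} (λ i → sym (S.⊕-swap i)) (λ _ → refl) sf

  module S₂ = Switch {σ ⊕ b′} {a′} {f} S.strip-outer sf′
  f′ = S₂.b′
  g  = S₂.c

  ρ : Seq
  ρ = σ ⊕ a ⊕ b

  -- The counterpart of `c (suc k)`: both are truncated differences of `ρ (suc k)` and `σ k`, taken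
  -- in opposite order, so at most one of them is nonzero.
  d : Seq
  d k = σ k ∸ ρ (suc k)

  ρ+d : ∀ k → ρ (suc k) + d k ≡ σ k + c (suc k)
  ρ+d k = m+[n∸m]≡n+[m∸n] (ρ (suc k)) (σ k)

  c≡0⊎d≡0 : ∀ k → c (suc k) ≡ 0 ⊎ d k ≡ 0
  c≡0⊎d≡0 k with ≤-total (ρ (suc k)) (σ k)
  ... | inj₁ p = inj₁ (m≤n⇒m∸n≡0 p)
  ... | inj₂ p = inj₂ (m≤n⇒m∸n≡0 p)

  module _ {m₀ m₁ : ℕ} where

    F B : Seq
    F k = m₁ + psum f (suc k)
    B k = m₀ + psum b k

    private
      F′ B′ : Seq
      F′ k = m₁ + psum f′ (suc k)
      B′ k = m₀ + psum b′ k

      F′-eq : ∀ k → F′ k ≡ F k + g (suc k)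
      F′-eq k = trans (cong (m₁ +_) (S₂.psum-inner (suc k))) (sym (+-assoc m₁ _ _))

      B′-eq : ∀ k → B′ k ≡ B k + c k
      B′-eq k = trans (cong (m₀ +_) (S.psum-inner k)) (sym (+-assoc m₀ _ _))

      g-eq : ∀ k → g (suc k) ≡ (ρ (suc k) + f (suc k)) ∸ (σ k + b′ k)
      g-eq k = cong (λ x → (x + f (suc k)) ∸ (σ k + b′ k)) (S.⊕-swap (suc k))

      B-eq : ∀ k → B′ k + (σ k + b′ k) ≡ (B (suc k) + d k) + ρ (suc k)
      B-eq k = begin
        B′ k + (σ k + b′ k)                 ≡⟨ cong (_+ (σ k + b′ k)) (B′-eq k) ⟩
        B k + c k + (σ k + b′ k)            ≡⟨ lem₁ (B k) (c k) (σ k) (b′ k) ⟩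
        B k + (b′ k + c k) + σ k            ≡⟨ cong (λ x → B k + x + σ k) (S.b′+c k) ⟩
        B k + (b k + c (suc k)) + σ k       ≡⟨ lem₂ m₀ (psum b k) (b k) (c (suc k)) (σ k) ⟩
        B (suc k) + (σ k + c (suc k))       ≡⟨ cong (B (suc k) +_) (ρ+d k) ⟨
        B (suc k) + (ρ (suc k) + d k)       ≡⟨ lem₃ (B (suc k)) (ρ (suc k)) (d k) ⟩
        (B (suc k) + d k) + ρ (suc k)       ∎
        where
        open ≡-Reasoning
        lem₁ : ∀ x y z w → x + y + (z + w) ≡ x + (w + y) + z
        lem₁ = solve-∀
        lem₂ : ∀ x y z w v → x + y + (z + w) + v ≡ x + (y + z) + (v + w)
        lem₂ = solve-∀
        lem₃ : ∀ x y z → x + (y + z) ≡ x + z + y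
        lem₃ = solve-∀

      F-eq : ∀ k → F k + (ρ (suc k) + f (suc k)) ≡ F (suc k) + ρ (suc k)
      F-eq k = lem m₁ (psum f (suc k)) (ρ (suc k)) (f (suc k))
        where
        lem : ∀ x y z w → x + y + (z + w) ≡ x + (y + w) + z
        lem = solve-∀

    -- With F ≤ B the condition before the switch, the one after it says F k ≤ B k + c k and
    -- F (k+1) ≤ B (k+1) + d k; these are together equivalent to F ≤ B as c (k+1) or d k vanishes.
    switch⁺ : ColStrict m₀ m₁ b f → ColStrict m₀ m₁ b′ f′
    switch⁺ h k = subst (_≤ B′ k) (sym (trans (F′-eq k) (cong (F k +_) (g-eq k))))
        (bound (≤-total (ρ (suc k) + f (suc k)) (σ k + b′ k)))
      where
      open ≤-Reasoning
      x = ρ (suc k) + f (suc k)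
      y = σ k + b′ k
      bound : x ≤ y ⊎ y ≤ x → F k + (x ∸ y) ≤ B′ k
      bound (inj₁ x≤y) = begin
        F k + (x ∸ y)  ≡⟨ cong (F k +_) (m≤n⇒m∸n≡0 x≤y) ⟩
        F k + 0        ≡⟨ +-identityʳ (F k) ⟩
        F k            ≤⟨ h k ⟩
        B k            ≤⟨ m≤m+n (B k) (c k) ⟩
        B k + c k      ≡⟨ B′-eq k ⟨
        B′ k           ∎
      bound (inj₂ y≤x) = +-cancelʳ-≤ y _ _ (begin
        F k + (x ∸ y) + y            ≡⟨ +-assoc (F k) _ _ ⟩
        F k + (x ∸ y + y)            ≡⟨ cong (F k +_) (m∸n+n≡m y≤x) ⟩
        F k + x                      ≡⟨ F-eq k ⟩
        F (suc k) + ρ (suc k)        ≤⟨ +-monoˡ-≤ (ρ (suc k)) (≤-trans (h (suc k)) (m≤m+n _ (d k))) ⟩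
        B (suc k) + d k + ρ (suc k)  ≡⟨ B-eq k ⟨
        B′ k + y                     ∎)

    switch⁻ : ColStrict m₀ m₁ b′ f′ → ColStrict m₀ m₁ b f
    switch⁻ h = bound
      where
      open ≤-Reasoning
      h₁ : ∀ k → F k ≤ B k + c k
      h₁ k = begin
        F k               ≤⟨ m≤m+n (F k) _ ⟩
        F k + g (suc k)   ≡⟨ F′-eq k ⟨
        F′ k              ≤⟨ h k ⟩
        B′ k              ≡⟨ B′-eq k ⟩
        B k + c k         ∎
      h₂ : ∀ k → F (suc k) ≤ B (suc k) + d k
      h₂ k = +-cancelʳ-≤ (ρ (suc k)) _ _ (begin
        F (suc k) + ρ (suc k)                   ≡⟨ F-eq k ⟨
        F k + (ρ (suc k) + f (suc k))           ≤⟨ +-monoʳ-≤ (F k) (m≤n+m∸n _ (σ k + b′ k)) ⟩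
        F k + (σ k + b′ k + (_ ∸ (σ k + b′ k))) ≡⟨ cong (λ z → F k + (σ k + b′ k + z)) (g-eq k) ⟨
        F k + (σ k + b′ k + g (suc k))          ≡⟨ lem (F k) (σ k + b′ k) (g (suc k)) ⟩
        F k + g (suc k) + (σ k + b′ k)          ≡⟨ cong (_+ (σ k + b′ k)) (F′-eq k) ⟨
        F′ k + (σ k + b′ k)                     ≤⟨ +-monoˡ-≤ (σ k + b′ k) (h k) ⟩
        B′ k + (σ k + b′ k)                     ≡⟨ B-eq k ⟩
        B (suc k) + d k + ρ (suc k)             ∎)
        where
        lem : ∀ x y z → x + (y + z) ≡ x + z + y
        lem = solve-∀
      bound : ∀ k → F k ≤ B k
      -- Nothing is carried out of row 0, so `h₁` is already the claim.
      bound zero = subst (F 0 ≤_) (+-identityʳ (B 0)) (h₁ 0)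
      bound (suc k) with c≡0⊎d≡0 k
      ... | inj₁ c≡0 = subst (F (suc k) ≤_) (trans (cong (B (suc k) +_) c≡0) (+-identityʳ _)) (h₁ (suc k))
      ... | inj₂ d≡0 = subst (F (suc k) ≤_) (trans (cong (B (suc k) +_) d≡0) (+-identityʳ _)) (h₂ k)

-- Moving a horizontal strip through a tableau with n letters

at : ∀ {n} → Vec ℕ n → Seq
at []      _       = 0
at (x ∷ v) zero    = x
at (x ∷ v) (suc i) = at v i

mk : ∀ n → Seq → Vec ℕ n
mk zero    f = []
mk (suc n) f = f 0 ∷ mk n (f ∘ suc)

at-supp : ∀ {n} (v : Vec ℕ n) → Supp n (at v)
at-supp []      i       _         = refl
at-supp (x ∷ v) (suc i) (s≤s n≤i) = at-supp v i n≤i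

at-mk-< : ∀ n f i → i < n → at (mk n f) i ≡ f i
at-mk-< (suc n) f zero    _         = refl
at-mk-< (suc n) f (suc i) (s≤s i<n) = at-mk-< n (f ∘ suc) i i<n

at-mk : ∀ n f → Supp n f → ∀ i → at (mk n f) i ≡ f i
at-mk zero    f s i       = sym (s i z≤n)
at-mk (suc n) f s zero    = refl
at-mk (suc n) f s (suc i) = at-mk n (f ∘ suc) (λ j n≤j → s (suc j) (s≤s n≤j)) i

at-ext-< : ∀ {n} {v w : Vec ℕ n} → (∀ i → i < n → at v i ≡ at w i) → v ≡ w
at-ext-< {v = []}    {[]}    e = refl
at-ext-< {v = x ∷ v} {y ∷ w} e = cong₂ _∷_ (e 0 z<s) (at-ext-< (λ i i<n → e (suc i) (s<s i<n)))

at-ext : ∀ {n} {v w : Vec ℕ n} → (∀ i → at v i ≡ at w i) → v ≡ w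
at-ext e = at-ext-< (λ i _ → e i)

carry-cong : ∀ {σ σ′ a a′ b b′ : Seq} → (∀ i → σ i ≡ σ′ i) → (∀ i → a i ≡ a′ i) → (∀ i → b i ≡ b′ i) →
  ∀ i → carry σ a b i ≡ carry σ′ a′ b′ i
carry-cong e₁ e₂ e₃ zero    = refl
carry-cong e₁ e₂ e₃ (suc i) =
  cong₂ _∸_ (cong₂ _+_ (cong₂ _+_ (e₁ (suc i)) (e₂ (suc i))) (e₃ (suc i))) (e₁ i)

inner-cong : ∀ {σ σ′ a a′ b b′ : Seq} → (∀ i → σ i ≡ σ′ i) → (∀ i → a i ≡ a′ i) → (∀ i → b i ≡ b′ i) →
  ∀ i → inner σ a b i ≡ inner σ′ a′ b′ i
inner-cong e₁ e₂ e₃ i =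
  cong₂ _∸_ (cong₂ _+_ (e₃ i) (carry-cong e₁ e₂ e₃ (suc i))) (carry-cong e₁ e₂ e₃ i)

outer-cong : ∀ {σ σ′ a a′ b b′ : Seq} → (∀ i → σ i ≡ σ′ i) → (∀ i → a i ≡ a′ i) → (∀ i → b i ≡ b′ i) →
  ∀ i → outer σ a b i ≡ outer σ′ a′ b′ i
outer-cong e₁ e₂ e₃ i =
  cong₂ _∸_ (cong₂ _+_ (e₂ i) (carry-cong e₁ e₂ e₃ i)) (carry-cong e₁ e₂ e₃ (suc i))

strip-congˡ : ∀ {σ σ′ : Seq} b → (∀ i → σ i ≡ σ′ i) → Strip σ b → Strip σ′ b
strip-congˡ {σ} {σ′} b e = strip-cong {σ} {σ′} {b} {b} e (λ _ → refl)

colStrict-cong : ∀ m₀ m₁ {b b′ f f′} → (∀ i → b i ≡ b′ i) → (∀ i → f i ≡ f′ i) →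
  ColStrict m₀ m₁ b f → ColStrict m₀ m₁ b′ f′
colStrict-cong m₀ m₁ e e′ h k =
  subst₂ _≤_ (cong (m₁ +_) (psum-cong e′ (suc k))) (cong (m₀ +_) (psum-cong e k)) (h k)

module _ {n : ℕ} where

  innerᵛ outerᵛ : Seq → Vec ℕ n → Vec ℕ n → Vec ℕ n
  innerᵛ σ a b = mk n (inner σ (at a) (at b))
  outerᵛ σ a b = mk n (outer σ (at a) (at b))

  module Switchᵛ {σ : Seq} {a b : Vec ℕ n} (sa : Strip σ (at a)) (sb : Strip (σ ⊕ at a) (at b)) where

    private
      module S = Switch {σ} {at a} {at b} sa sb
      a′ = outerᵛ σ a b
      b′ = innerᵛ σ a b

    at-inner : ∀ i → at b′ i ≡ inner σ (at a) (at b) i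
    at-inner = at-mk n _ (S.inner-supp (at-supp a) (at-supp b))

    at-outer : ∀ i → at a′ i ≡ outer σ (at a) (at b) i
    at-outer = at-mk n _ (S.outer-supp (at-supp a) (at-supp b))

    ⊕-swap : ∀ i → (σ ⊕ at b′ ⊕ at a′) i ≡ (σ ⊕ at a ⊕ at b) i
    ⊕-swap i = trans (cong₂ (λ x y → σ i + x + y) (at-inner i) (at-outer i)) (S.⊕-swap i)

    strip-inner : Strip σ (at b′)
    strip-inner = strip-cong {σ} {σ} (λ _ → refl) (λ i → sym (at-inner i)) S.strip-inner

    strip-outer : Strip (σ ⊕ at b′) (at a′)
    strip-outer = strip-cong {σ ⊕ S.b′} {σ ⊕ at b′} (λ i → cong (σ i +_) (sym (at-inner i))) (λ i → sym (at-outer i))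
        S.strip-outer

    inner-involutive : innerᵛ σ b′ a′ ≡ a
    inner-involutive = at-ext-< (λ i i<n → trans (at-mk-< n _ i i<n)
      (trans (inner-cong {σ} (λ _ → refl) at-inner at-outer i) (S.inner-involutive i)))

    outer-involutive : outerᵛ σ b′ a′ ≡ b
    outer-involutive = at-ext-< (λ i i<n → trans (at-mk-< n _ i i<n)
      (trans (outer-cong {σ} (λ _ → refl) at-inner at-outer i) (S.outer-involutive i)))

    psum-inner : psum (at b′) n ≡ psum (at b) n
    psum-inner = trans (psum-cong at-inner n) (S.psum-inner-supp (at-supp a) (at-supp b))

    psum-outer : psum (at a′) n ≡ psum (at a) n
    psum-outer = trans (psum-cong at-outer n) (S.psum-outer-supp (at-supp a) (at-supp b))

    module _ {f : Vec ℕ n} (sf : Strip (σ ⊕ at a ⊕ at b) (at f)) where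

      private
        module T = SwitchTwice {σ} {at a} {at b} {at f} sa sb sf
        f′ = innerᵛ (σ ⊕ at b′) a′ f
        at-inner₂ : ∀ i → at f′ i ≡ T.f′ i
        at-inner₂ i = trans
          (at-mk n _ (Switch.inner-supp {σ ⊕ at b′} {at a′} {at f} strip-outer
            (strip-congˡ (at f) (λ j → sym (⊕-swap j)) sf)
            (at-supp a′) (at-supp f)) i)
          (inner-cong (λ j → cong (σ j +_) (at-inner j)) at-outer (λ _ → refl) i)

      colStrict-switch⁺ : ∀ m₀ m₁ → ColStrict m₀ m₁ (at b) (at f) → ColStrict m₀ m₁ (at b′) (at f′)
      colStrict-switch⁺ m₀ m₁ h = colStrict-cong m₀ m₁ (λ i → sym (at-inner i)) (λ i → sym (at-inner₂ i))
          (T.switch⁺ {m₀} {m₁} h)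

      colStrict-switch⁻ : ∀ m₀ m₁ → ColStrict m₀ m₁ (at b′) (at f′) → ColStrict m₀ m₁ (at b) (at f)
      colStrict-switch⁻ m₀ m₁ h = T.switch⁻ {m₀} {m₁} (colStrict-cong m₀ m₁ at-inner at-inner₂ h)

  -- The (r , k) entry is the number of letters k in row r of a tableau with weakly increasing rows.
  Matrix : ℕ → Set
  Matrix R = Vec (Vec ℕ n) R

  colsum : ∀ {R} → Matrix R → Seq
  colsum []       k = 0
  colsum (b ∷ bs) k = at b k + colsum bs k

  Adjacent : ∀ {R} → Seq → Vec ℕ n → Matrix R → Set
  Adjacent μ b []      = ⊤
  Adjacent μ b (f ∷ _) = ColStrict (μ 0) (μ 1) (at b) (at f)

  -- The tableaux of shape ν/μ whose content, added to σ, is a partition after each row.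
  Chain : ∀ {R} → (μ ν σ : Seq) → Matrix R → Set
  Chain μ ν σ []       = ⊤
  Chain μ ν σ (b ∷ bs) = (μ 0 + psum (at b) n ≡ ν 0) × Strip σ (at b) × Adjacent μ b bs
                       × Chain (μ ∘ suc) (ν ∘ suc) (σ ⊕ at b) bs

  chain-cong : ∀ {R} μ ν {σ σ′} (bs : Matrix R) → (∀ i → σ i ≡ σ′ i) → Chain μ ν σ bs → Chain μ ν σ′ bs
  chain-cong μ ν []       e _ = tt
  chain-cong μ ν (b ∷ bs) e (p , s , t , h) =
    p , strip-congˡ (at b) e s , t , chain-cong (μ ∘ suc) (ν ∘ suc) bs (λ i → cong (_+ at b i) (e i)) h

  -- The outer strip left by the switch with one row is the strip that meets the next. Each row
  -- keeps its length, only its content changes.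
  pushStrip : ∀ {R} → Seq → Vec ℕ n → Matrix R → Vec ℕ n
  pushStrip σ a []       = a
  pushStrip σ a (b ∷ bs) = pushStrip (σ ⊕ at (innerᵛ σ a b)) (outerᵛ σ a b) bs

  pushRows : ∀ {R} → Seq → Vec ℕ n → Matrix R → Matrix R
  pushRows σ a []       = []
  pushRows σ a (b ∷ bs) = innerᵛ σ a b ∷ pushRows (σ ⊕ at (innerᵛ σ a b)) (outerᵛ σ a b) bs

  -- The reverse pass works from the last row back and uses the same switch, because it is an
  -- involution. Now b is the inner part and a the outer one, so the strip becomes an `innerᵛ` and
  -- the row an `outerᵛ`.
  pullStrip : ∀ {R} → Seq → Vec ℕ n → Matrix R → Vec ℕ n
  pullStrip σ a []       = a
  pullStrip σ a (b ∷ bs) = innerᵛ σ b (pullStrip (σ ⊕ at b) a bs)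

  pullRows : ∀ {R} → Seq → Vec ℕ n → Matrix R → Matrix R
  pullRows σ a []       = []
  pullRows σ a (b ∷ bs) = outerᵛ σ b (pullStrip (σ ⊕ at b) a bs) ∷ pullRows (σ ⊕ at b) a bs

  -- The two positions of a strip of size s on the way from σ to τ: before all row contents of the
  -- tableau, or after them.
  InnerOk OuterOk : ∀ {R} → (μ ν σ τ : Seq) → ℕ → Vec ℕ n → Matrix R → Set
  InnerOk μ ν σ τ s a bs = (Strip σ (at a) × psum (at a) n ≡ s) × (Chain μ ν (σ ⊕ at a) bs
                         × (∀ i → σ i + at a i + colsum bs i ≡ τ i))
  OuterOk μ ν σ τ s a bs = Chain μ ν σ bs × (Strip (σ ⊕ colsum bs) (at a) × psum (at a) n ≡ s
                         × (∀ i → σ i + colsum bs i + at a i ≡ τ i))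

  module _ where
    push-ok : ∀ {R} (μ ν σ τ : Seq) s a (bs : Matrix R) → InnerOk μ ν σ τ s a bs →
      OuterOk μ ν σ τ s (pushStrip σ a bs) (pushRows σ a bs)
    push-ok μ ν σ τ s a [] ((sa , ps) , _ , e) =
      tt , strip-congˡ (at a) (λ i → sym (+-identityʳ (σ i))) sa , ps ,
      (λ i → trans (cong (_+ at a i) (+-identityʳ (σ i))) (trans (sym (+-identityʳ _)) (e i)))
    push-ok μ ν σ τ s a (b ∷ bs) ((sa , ps) , (p , sb , adj , ch) , e) =
      (trans (cong (μ 0 +_) S.psum-inner) p , S.strip-inner , adj′ bs adj ch , proj₁ ih) ,
      strip-congˡ (at (pushStrip σ a (b ∷ bs))) (λ i → +-assoc (σ i) _ _) (proj₁ (proj₂ ih)) ,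
      proj₁ (proj₂ (proj₂ ih)) ,
      (λ i → trans (cong (_+ at (pushStrip σ a (b ∷ bs)) i) (sym (+-assoc (σ i) _ _))) (proj₂ (proj₂ (proj₂ ih)) i))
      where
      module S = Switchᵛ {σ} {a} {b} sa sb
      ih = push-ok (μ ∘ suc) (ν ∘ suc) (σ ⊕ at (innerᵛ σ a b)) τ s (outerᵛ σ a b) bs
        ((S.strip-outer , trans S.psum-outer ps) ,
         chain-cong _ _ bs (λ i → sym (S.⊕-swap i)) ch ,
         (λ i → trans (cong (_+ colsum bs i) (S.⊕-swap i))
             (trans (+-assoc (σ i + at a i) (at b i) (colsum bs i)) (e i))))
      adj′ : ∀ {R} (bs : Matrix R) → Adjacent μ b bs → Chain (μ ∘ suc) (ν ∘ suc) (σ ⊕ at a ⊕ at b) bs →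
        Adjacent μ (innerᵛ σ a b) (pushRows (σ ⊕ at (innerᵛ σ a b)) (outerᵛ σ a b) bs)
      adj′ []      _ _ = tt
      adj′ (f ∷ _) h (_ , sf , _) = S.colStrict-switch⁺ {f} sf (μ 0) (μ 1) h

    pull-push : ∀ {R} (μ ν σ : Seq) a (bs : Matrix R) → Strip σ (at a) → Chain μ ν (σ ⊕ at a) bs →
      pullStrip σ (pushStrip σ a bs) (pushRows σ a bs) ≡ a × pullRows σ (pushStrip σ a bs) (pushRows σ a bs) ≡ bs
    pull-push μ ν σ a [] sa _ = refl , refl
    pull-push μ ν σ a (b ∷ bs) sa (_ , sb , _ , ch) =
      trans (cong (innerᵛ σ (innerᵛ σ a b)) (proj₁ ih)) S.inner-involutive ,
      cong₂ _∷_ (trans (cong (outerᵛ σ (innerᵛ σ a b)) (proj₁ ih)) S.outer-involutive) (proj₂ ih)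
      where
      module S = Switchᵛ {σ} {a} {b} sa sb
      ih = pull-push (μ ∘ suc) (ν ∘ suc) (σ ⊕ at (innerᵛ σ a b)) (outerᵛ σ a b) bs S.strip-outer
             (chain-cong _ _ bs (λ i → sym (S.⊕-swap i)) ch)

    pullStrip-strip : ∀ {R} (μ ν σ : Seq) a (bs : Matrix R) → Chain μ ν σ bs → Strip (σ ⊕ colsum bs) (at a) →
      Strip σ (at (pullStrip σ a bs))
    pullStrip-strip μ ν σ a []       _                 sa = strip-congˡ (at a) (λ i → +-identityʳ (σ i)) sa
    pullStrip-strip μ ν σ a (b ∷ bs) (_ , sb , _ , ch) sa = Switchᵛ.strip-inner {σ} {b} {pullStrip (σ ⊕ at b) a bs} sb
      (pullStrip-strip (μ ∘ suc) (ν ∘ suc) (σ ⊕ at b) a bs ch (strip-congˡ (at a) (λ i → sym (+-assoc (σ i) _ _)) sa))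

    -- The pulled rows are regarded as the state before a switch: pushing the pulled strip through
    -- them gives b and `f′` back by involutivity, so `colStrict-switch⁻` applies.
    adjacent-pull : ∀ {R} (μ ν σ : Seq) a b (bs : Matrix R) → Strip σ (at b) → Chain (μ ∘ suc) (ν ∘ suc) (σ ⊕ at b) bs
        →
      Strip (σ ⊕ at b ⊕ colsum bs) (at a) → Adjacent μ b bs →
      Adjacent μ (outerᵛ σ b (pullStrip (σ ⊕ at b) a bs)) (pullRows (σ ⊕ at b) a bs)
    adjacent-pull μ ν σ a b []        sb _ _ _ = tt
    adjacent-pull μ ν σ a b (f′ ∷ fs) sb (_ , sf′ , _ , ch) sa h =
      S₁′.colStrict-switch⁻ {f} (strip-congˡ (at f) (λ i → sym (S₁.⊕-swap i)) S₂.strip-outer) (μ 0) (μ 1)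
        (subst₂ (λ x y → ColStrict (μ 0) (μ 1) (at x) (at y)) (sym S₁.inner-involutive) (sym f′-eq) h)
      where
      sa₂ = pullStrip-strip (μ ∘ suc ∘ suc) (ν ∘ suc ∘ suc) (σ ⊕ at b ⊕ at f′) a fs ch
              (strip-congˡ (at a) (λ i → sym (+-assoc (σ i + at b i) _ _)) sa)
      module S₂ = Switchᵛ {σ ⊕ at b} {f′} {pullStrip (σ ⊕ at b ⊕ at f′) a fs} sf′ sa₂
      a₁ = pullStrip (σ ⊕ at b) a (f′ ∷ fs)
      f  = outerᵛ (σ ⊕ at b) f′ (pullStrip (σ ⊕ at b ⊕ at f′) a fs)
      module S₁ = Switchᵛ {σ} {b} {a₁} sb S₂.strip-inner
      module S₁′ = Switchᵛ {σ} {innerᵛ σ b a₁} {outerᵛ σ b a₁} S₁.strip-inner S₁.strip-outer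
      f′-eq : innerᵛ (σ ⊕ at (innerᵛ σ (innerᵛ σ b a₁) (outerᵛ σ b a₁))) (outerᵛ σ (innerᵛ σ b a₁) (outerᵛ σ b a₁)) f
          ≡ f′
      f′-eq = trans (cong₂ (λ x y → innerᵛ (σ ⊕ at x) y f) S₁.inner-involutive S₁.outer-involutive)
          S₂.inner-involutive

    pull-ok : ∀ {R} (μ ν σ τ : Seq) s a (bs : Matrix R) → OuterOk μ ν σ τ s a bs →
      InnerOk μ ν σ τ s (pullStrip σ a bs) (pullRows σ a bs)
    pull-ok μ ν σ τ s a [] (_ , sa , ps , e) =
      (strip-congˡ (at a) (λ i → +-identityʳ (σ i)) sa , ps) , tt ,
      (λ i → trans (+-identityʳ _) (trans (cong (_+ at a i) (sym (+-identityʳ (σ i)))) (e i)))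
    pull-ok μ ν σ τ s a (b ∷ bs) ((p , sb , adj , ch) , sa , ps , e) =
      (S.strip-inner , trans S.psum-inner (proj₂ (proj₁ ih))) ,
      (trans (cong (μ 0 +_) S.psum-outer) p , S.strip-outer , adj′ ,
       chain-cong _ _ (pullRows (σ ⊕ at b) a bs) (λ i → sym (S.⊕-swap i)) (proj₁ (proj₂ ih))) ,
      (λ i → trans (sym (+-assoc (σ i + at (innerᵛ σ b a₁) i) (at (outerᵛ σ b a₁) i)
          (colsum (pullRows (σ ⊕ at b) a bs) i)))
        (trans (cong (_+ colsum (pullRows (σ ⊕ at b) a bs) i) (S.⊕-swap i)) (proj₂ (proj₂ ih) i)))
      where
      a₁ = pullStrip (σ ⊕ at b) a bs
      ih = pull-ok (μ ∘ suc) (ν ∘ suc) (σ ⊕ at b) τ s a bs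
        (ch , strip-congˡ (at a) (λ i → sym (+-assoc (σ i) _ _)) sa , ps ,
         (λ i → trans (cong (_+ at a i) (+-assoc (σ i) _ _)) (e i)))
      module S = Switchᵛ {σ} {b} {a₁} sb (proj₁ (proj₁ ih))
      adj′ : Adjacent μ (outerᵛ σ b a₁) (pullRows (σ ⊕ at b) a bs)
      adj′ = adjacent-pull μ ν σ a b bs sb ch (strip-congˡ (at a) (λ i → sym (+-assoc (σ i) _ _)) sa) adj

    push-pull : ∀ {R} (μ ν σ : Seq) a (bs : Matrix R) → Chain μ ν σ bs → Strip (σ ⊕ colsum bs) (at a) →
      pushStrip σ (pullStrip σ a bs) (pullRows σ a bs) ≡ a × pushRows σ (pullStrip σ a bs) (pullRows σ a bs) ≡ bs
    push-pull μ ν σ a [] _ _ = refl , refl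
    push-pull μ ν σ a (b ∷ bs) (_ , sb , _ , ch) sa =
      trans (cong₂ (λ x y → pushStrip (σ ⊕ at x) y (pullRows (σ ⊕ at b) a bs)) S.inner-involutive S.outer-involutive)
          (proj₁ ih) ,
      cong₂ _∷_ S.inner-involutive
        (trans (cong₂ (λ x y → pushRows (σ ⊕ at x) y (pullRows (σ ⊕ at b) a bs)) S.inner-involutive
            S.outer-involutive) (proj₂ ih))
      where
      sa′ = strip-congˡ (at a) (λ i → sym (+-assoc (σ i) _ _)) sa
      ih = push-pull (μ ∘ suc) (ν ∘ suc) (σ ⊕ at b) a bs ch sa′
      module S = Switchᵛ {σ} {b} {pullStrip (σ ⊕ at b) a bs} sb
          (pullStrip-strip (μ ∘ suc) (ν ∘ suc) (σ ⊕ at b) a bs ch sa′)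

-- Pictures

∀? : {P : ℕ → Set} → (∀ k → Dec (P k)) → ∀ n → ((∀ {k} → k < n → P k) → ∀ k → n ≤ k → P k) → Dec (∀ k → P k)
∀? {P} P? n ext with allUpTo? P? n
... | no ¬p = no (λ h → ¬p (λ {k} _ → h k))
... | yes p = yes h
  where
  h : ∀ k → P k
  h k with k <? n
  ... | yes k<n = p k<n
  ... | no  k≮n = ext p k (≮⇒≥ k≮n)

vecsOf : {A : Set} → List A → ∀ n → List (Vec A n)
vecsOf xs zero    = [] ∷ []
vecsOf xs (suc n) = cartesianProductWith _∷_ xs (vecsOf xs n)

∈-vecsOf : {A : Set} {xs : List A} → ∀ {n} {v : Vec A n} → Allᵛ.All (_∈ xs) v → v ∈ vecsOf xs n
∈-vecsOf []       = here refl
∈-vecsOf (p ∷ ps) = ∈-cartesianProductWith⁺ _∷_ p (∈-vecsOf ps)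

all-at : ∀ {n} {v : Vec ℕ n} {M} → (∀ i → at v i ≤ M) → Allᵛ.All (_∈ upTo (suc M)) v
all-at {v = []}    h = []
all-at {v = x ∷ v} h = ∈-upTo⁺ (s≤s (h 0)) ∷ all-at (h ∘ suc)

strip? : ∀ {n σ} → Supp n σ → (b : Vec ℕ n) → Dec (Strip σ (at b))
strip? {n} {σ} s b = ∀? (λ i → _ ≤? _) n (λ _ i n≤i →
  subst (_≤ σ i) (sym (cong₂ _+_ (s (suc i) (m≤n⇒m≤1+n n≤i)) (at-supp b (suc i) (m≤n⇒m≤1+n n≤i)))) z≤n)

colStrict? : ∀ {n} m₀ m₁ (b f : Vec ℕ n) → Dec (ColStrict m₀ m₁ (at b) (at f))
-- From index n on both partial sums are constant, so the condition at n yields all later ones;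
-- hence the bound `suc n`.
colStrict? {n} m₀ m₁ b f = ∀? (λ k → _ ≤? _) (suc n) (λ h k n<k → subst₂ _≤_
  (cong (m₁ +_) (trans (psum-supp (at-supp f) (suc n) (n≤1+n n))
      (sym (psum-supp (at-supp f) (suc k) (m≤n⇒m≤1+n (<⇒≤ n<k))))))
  (cong (m₀ +_) (sym (psum-supp (at-supp b) k (<⇒≤ n<k))))
  (h {n} ≤-refl))

⊕-supp : ∀ {n σ} → Supp n σ → (b : Vec ℕ n) → Supp n (σ ⊕ at b)
⊕-supp s b i n≤i = cong₂ _+_ (s i n≤i) (at-supp b i n≤i)

module _ {n : ℕ} where

  _≟ᵛ_ : DecidableEquality (Vec ℕ n)
  _≟ᵛ_ = Vec-≡-dec _≟_

  _≟ᵐ_ : ∀ {R} → DecidableEquality (Matrix {n} R)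
  _≟ᵐ_ = Vec-≡-dec _≟ᵛ_

  _≟ᵖ_ : ∀ {R} → DecidableEquality (Vec ℕ n × Matrix {n} R)
  _≟ᵖ_ = ×-≡-dec _≟ᵛ_ _≟ᵐ_

  colsum-supp : ∀ {R} (bs : Matrix {n} R) → Supp n (colsum bs)
  colsum-supp []       i n≤i = refl
  colsum-supp (b ∷ bs) i n≤i = cong₂ _+_ (at-supp b i n≤i) (colsum-supp bs i n≤i)

  adjacent? : ∀ {R} μ b (bs : Matrix {n} R) → Dec (Adjacent μ b bs)
  adjacent? μ b []      = yes tt
  adjacent? μ b (f ∷ _) = colStrict? (μ 0) (μ 1) b f

  chain? : ∀ {R} (μ ν : Seq) {σ} → Supp n σ → (bs : Matrix {n} R) → Dec (Chain μ ν σ bs)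
  chain? μ ν s []       = yes tt
  chain? μ ν s (b ∷ bs) = (_ ≟ _) ×-dec strip? s b ×-dec adjacent? μ b bs
                        ×-dec chain? (μ ∘ suc) (ν ∘ suc) (⊕-supp s b) bs

  matrices : ∀ M R → List (Matrix {n} R)
  matrices M R = vecsOf (vecsOf (upTo (suc M)) n) R

  ∈-matrices : ∀ {M R} (bs : Matrix {n} R) → (∀ i → colsum bs i ≤ M) → bs ∈ matrices M R
  ∈-matrices {M} bs h = ∈-vecsOf (rows bs h)
    where
    rows : ∀ {R} (bs : Matrix {n} R) → (∀ i → colsum bs i ≤ M) → Allᵛ.All (_∈ vecsOf (upTo (suc M)) n) bs
    rows []       h = []
    rows (b ∷ bs) h = ∈-vecsOf (all-at (λ i → m+n≤o⇒m≤o _ (h i))) ∷ rows bs (λ i → m+n≤o⇒n≤o (at b i) (h i))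

  -- By Zelevinsky's picture theorem, this set of matrices has ⟨ s_{ν/μ} , s_{τ/σ} ⟩ elements.
  IsPicture : ∀ {R} → (μ ν σ τ : Seq) → Matrix {n} R → Set
  IsPicture μ ν σ τ bs = Chain μ ν σ bs × (∀ i → σ i + colsum bs i ≡ τ i)

  Pictures : ℕ → (μ ν σ τ : Seq) → Set
  Pictures R μ ν σ τ = Refinement (Matrix {n} R) (IsPicture μ ν σ τ)

  isPicture? : ∀ {R} μ ν {σ τ} → Supp n σ → Supp n τ → (bs : Matrix {n} R) → Dec (IsPicture μ ν σ τ bs)
  isPicture? μ ν sσ sτ bs = chain? μ ν sσ bs ×-dec
    ∀? (λ i → _ ≟ _) n (λ _ i n≤i → trans (cong₂ _+_ (sσ i n≤i) (colsum-supp bs i n≤i)) (sym (sτ i n≤i)))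

  ≤total : ∀ {τ} → Supp n τ → ∀ i → τ i ≤ psum τ n
  ≤total {τ} s i with i <? n
  ... | yes i<n = ≤psum τ i<n
  ... | no  i≮n = subst (_≤ psum τ n) (sym (s i (≮⇒≥ i≮n))) z≤n

  finite-pictures : ∀ {R μ ν σ τ} → Supp n σ → Supp n τ → Finite (Pictures R μ ν σ τ)
  finite-pictures {R} {μ} {ν} {σ} {τ} sσ sτ = finite-refinement _≟ᵐ_ (isPicture? μ ν sσ sτ) (matrices (psum τ n) R)
    (λ bs p → ∈-matrices bs (λ i → ≤-trans (m+n≤o⇒n≤o (σ i) (≤-reflexive (proj₂ p i))) (≤total sτ i)))

  pictures-cong : ∀ {R μ ν σ σ′ τ τ′} → (∀ i → σ i ≡ σ′ i) → (∀ i → τ i ≡ τ′ i) → Pictures R μ ν σ τ ↔ Pictures R μ ν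
      σ′ τ′
  pictures-cong {μ = μ} {ν} e e′ = refinement-⇔ (move e e′) (move (λ i → sym (e i)) (λ i → sym (e′ i)))
    where
    move : ∀ {σ σ′ τ τ′} → (∀ i → σ i ≡ σ′ i) → (∀ i → τ i ≡ τ′ i) → ∀ bs → IsPicture μ ν σ τ bs → IsPicture μ ν σ′ τ′
        bs
    move e e′ bs (ch , eq) = chain-cong μ ν bs e ch , λ i → trans (cong (_+ colsum bs i) (sym (e i)))
        (trans (eq i) (e′ i))

  IsStrip : Seq → ℕ → Vec ℕ n → Set
  IsStrip σ s a = Strip σ (at a) × psum (at a) n ≡ s

  -- s_{ν/μ} h_s s_σ, expanded from either side.
  pieri-commutes : ∀ {R μ ν σ τ s} →
    Refinement (Vec ℕ n × Matrix {n} R) (λ p → InnerOk μ ν σ τ s (proj₁ p) (proj₂ p)) ↔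
    Refinement (Vec ℕ n × Matrix {n} R) (λ p → OuterOk μ ν σ τ s (proj₁ p) (proj₂ p))
  pieri-commutes {R} {μ} {ν} {σ} {τ} {s} = refinement-↔ _≟ᵖ_ _≟ᵖ_
    (λ p → pushStrip σ (proj₁ p) (proj₂ p) , pushRows σ (proj₁ p) (proj₂ p))
    (λ p → pullStrip σ (proj₁ p) (proj₂ p) , pullRows σ (proj₁ p) (proj₂ p))
    (λ { (a , bs) ok → push-ok μ ν σ τ s a bs ok })
    (λ { (a , bs) ok → pull-ok μ ν σ τ s a bs ok })
    (λ { (a , bs) ((sa , _) , ch , _) → let e = pull-push μ ν σ a bs sa ch in cong₂ _,_ (proj₁ e) (proj₂ e) })
    (λ { (a , bs) (ch , sa , _) → let e = push-pull μ ν σ a bs ch sa in cong₂ _,_ (proj₁ e) (proj₂ e) })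

  -- A horizontal strip at the outer border of τ; its first clause makes the truncated subtraction
  -- exact.
  Remove : Seq → ℕ → Vec ℕ n → Set
  Remove τ s a = (∀ i → at a i ≤ τ i) × Strip (λ i → τ i ∸ at a i) (at a) × psum (at a) n ≡ s

  outer↔Σ : ∀ {R μ ν σ τ s} →
    Refinement (Vec ℕ n × Matrix {n} R) (λ p → OuterOk μ ν σ τ s (proj₁ p) (proj₂ p)) ↔
    Σ (Refinement (Vec ℕ n) (Remove τ s)) (λ a → Pictures R μ ν σ (λ i → τ i ∸ at (value a) i))
  outer↔Σ {R} {μ} {ν} {σ} {τ} {s} = refinement-Σ (Remove τ s) (λ a → IsPicture μ ν σ (λ i → τ i ∸ at a i)) ↔-∘
    refinement-⇔ f g
    where
    f : ∀ p → OuterOk μ ν σ τ s (proj₁ p) (proj₂ p) → Remove τ s (proj₁ p) × IsPicture μ ν σ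
        (λ i → τ i ∸ at (proj₁ p) i) (proj₂ p)
    f (a , bs) (ch , sa , ps , e) = ((λ i → m+n≤o⇒n≤o _ (≤-reflexive (e i))) , strip-congˡ (at a) e′ sa , ps) , ch ,
        e′
      where
      e′ : ∀ i → σ i + colsum bs i ≡ τ i ∸ at a i
      e′ i = trans (sym (m+n∸n≡m _ (at a i))) (cong (_∸ at a i) (e i))
    g : ∀ p → Remove τ s (proj₁ p) × IsPicture μ ν σ (λ i → τ i ∸ at (proj₁ p) i) (proj₂ p) → OuterOk μ ν σ τ s
        (proj₁ p) (proj₂ p)
    g (a , bs) ((a≤ , sa , ps) , ch , e) = ch , strip-congˡ (at a) (λ i → sym (e i)) sa , ps ,
      λ i → trans (cong (_+ at a i) (e i)) (m∸n+n≡m (a≤ i))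

  -- From straight to skew shapes τ/σ

  module Transfer {R R′ : ℕ} {μ ν μ′ ν′ : Seq} where

    Same : Seq → Set
    Same σ = ∀ τ → Decr τ → Supp n τ → Pictures R μ ν σ τ ↔ Pictures R′ μ′ ν′ σ τ

    Inner : ∀ R (μ ν σ τ : Seq) → ℕ → Set
    Inner R μ ν σ τ s = Refinement (Vec ℕ n × Matrix {n} R) (λ p → InnerOk μ ν σ τ s (proj₁ p) (proj₂ p))

    -- In the expansion with the strip outside, every term has the same σ and only τ shrinks, so the
    -- hypothesis applies term by term. Commutation carries this over to the expansion with the
    -- strip inside.
    same-inner : ∀ {σ} → Same σ → ∀ s τ → Supp n τ → Inner R μ ν σ τ s ↔ Inner R′ μ′ ν′ σ τ s
    same-inner {σ} same s τ sτ = ↔-sym pieri-commutes ↔-∘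
        (↔-sym outer↔Σ ↔-∘ (Σ-cong-↔ each ↔-∘ (outer↔Σ ↔-∘ pieri-commutes)))
      where
      each : (a : Refinement (Vec ℕ n) (Remove τ s)) → Pictures R μ ν σ (λ i → τ i ∸ at (value a) i) ↔ Pictures R′ μ′
          ν′ σ (λ i → τ i ∸ at (value a) i)
      each (a ,ʳ [ p ]) = same (λ i → τ i ∸ at a i)
        -- The strip condition is available only irrelevantly, but the inequality drawn from it is
        -- decidable.
        (λ i → recompute (_ ≤? _) (strip⇒decr {λ i → τ i ∸ at a i} {at a} (proj₁ (proj₂ p)) i))
        (λ i n≤i → trans (cong (_∸ at a i) (sτ i n≤i)) (0∸n≡0 (at a i)))

    -- σ with its last row ℓ of length s = σ ℓ is the only strip of size s on the
    -- remaining rows whose row ℓ has full length s.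
    module LastRow (ℓ : ℕ) (ℓ<n : ℓ < n) (σ : Seq) (dσ : Decr σ) (sσ : Supp (suc ℓ) σ)
      (same₀ : ∀ σ₀ → Decr σ₀ → Supp ℓ σ₀ → Same σ₀)
      (same₁ : ∀ σ₁ → Decr σ₁ → Supp (suc ℓ) σ₁ → σ₁ ℓ < σ ℓ → Same σ₁) where

      s : ℕ
      s = σ ℓ

      σ₀ : Seq
      σ₀ i with i <? ℓ
      ... | yes _ = σ i
      ... | no  _ = 0

      σ₀-supp : Supp ℓ σ₀
      σ₀-supp i ℓ≤i with i <? ℓ
      ... | yes i<ℓ = ⊥-elim (<⇒≱ i<ℓ ℓ≤i)
      ... | no  _   = refl

      σ₀-decr : Decr σ₀
      σ₀-decr i with suc i <? ℓ | i <? ℓ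
      ... | yes _   | yes _   = dσ i
      ... | yes i+1<ℓ | no i≮ℓ = ⊥-elim (i≮ℓ (<⇒≤ i+1<ℓ))
      ... | no _    | yes _   = z≤n
      ... | no _    | no _    = z≤n

      above : Supp (suc ℓ) (unit ℓ s)
      above i ℓ<i = unit-≢ ℓ s i (<⇒≢ ℓ<i)

      σ₀⊕unit : ∀ i → σ₀ i + unit ℓ s i ≡ σ i
      σ₀⊕unit i with i <? ℓ
      ... | yes i<ℓ = trans (cong (σ i +_) (unit-≢ ℓ s i (<⇒≢ i<ℓ ∘ sym))) (+-identityʳ _)
      ... | no  i≮ℓ with m≤n⇒m<n∨m≡n (≮⇒≥ i≮ℓ)
      ...   | inj₁ ℓ<i  = trans (above i ℓ<i) (sym (sσ i ℓ<i))
      ...   | inj₂ refl = unit-≡ ℓ s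

      a₀ : Vec ℕ n
      a₀ = mk n (unit ℓ s)

      at-a₀ : ∀ i → at a₀ i ≡ unit ℓ s i
      at-a₀ = at-mk n (unit ℓ s) (λ i n≤i → above i (≤-trans ℓ<n n≤i))

      σ₀⊕a₀ : ∀ i → σ₀ i + at a₀ i ≡ σ i
      σ₀⊕a₀ i = trans (cong (σ₀ i +_) (at-a₀ i)) (σ₀⊕unit i)

      strip-above : ∀ (a : Vec ℕ n) → Strip σ₀ (at a) → ∀ i → ℓ < i → at a i ≡ 0
      strip-above a sa (suc i) (s≤s ℓ≤i) = n≤0⇒n≡0
          (subst (at a (suc i) ≤_) (σ₀-supp i ℓ≤i) (m+n≤o⇒n≤o (σ₀ (suc i)) (sa i)))

      full⇒a₀ : ∀ a → IsStrip σ₀ s a → s ≤ at a ℓ → a ≡ a₀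
      full⇒a₀ a (sa , ps) s≤ = at-ext (λ i → trans (values i) (sym (at-a₀ i)))
        where
        zero-of : ∀ {x y z} → x + y ≤ z → z ≤ y → x ≡ 0
        zero-of {x} {y} h h′ = n≤0⇒n≡0 (+-cancelʳ-≤ y x 0 (≤-trans h h′))
        values : ∀ i → at a i ≡ unit ℓ s i
        values i with <-cmp i ℓ
        ... | tri< i<ℓ i≢ℓ _ = trans (zero-of (subst (at a i + at a ℓ ≤_) ps (+≤psum (at a) i<ℓ ℓ<n)) s≤)
            (sym (unit-≢ ℓ s i (i≢ℓ ∘ sym)))
        ... | tri≈ _ refl _  = trans (≤-antisym (subst (at a i ≤_) ps (≤psum (at a) ℓ<n)) s≤) (sym (unit-≡ i s))
        ... | tri> _ _ ℓ<i   = trans (strip-above a sa i ℓ<i) (sym (above i ℓ<i))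

      a₀-strip : IsStrip σ₀ s a₀
      a₀-strip = (λ i → subst (_≤ σ₀ i) (sym (σ₀⊕a₀ (suc i))) (below i)) , size
        where
        below : ∀ i → σ (suc i) ≤ σ₀ i
        below i with i <? ℓ
        ... | yes _   = dσ i
        ... | no  i≮ℓ = ≤-reflexive (sσ (suc i) (s≤s (≮⇒≥ i≮ℓ)))
        size : psum (at a₀) n ≡ s
        size = trans (psum-cong at-a₀ n) (psum-unit-> ℓ s n ℓ<n)

      module _ (τ : Seq) (dτ : Decr τ) (sτ : Supp n τ) where

        Inner₌ Inner≢ : ∀ R (μ ν : Seq) → Set
        Inner₌ R μ ν = Refinement (Vec ℕ n × Matrix {n} R)
            (λ p → proj₁ p ≡ a₀ × InnerOk μ ν σ₀ τ s (proj₁ p) (proj₂ p))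
        Inner≢ R μ ν = Refinement (Vec ℕ n × Matrix {n} R)
            (λ p → ¬ (proj₁ p ≡ a₀) × InnerOk μ ν σ₀ τ s (proj₁ p) (proj₂ p))

        inner-split : ∀ {R μ ν} → Inner R μ ν σ₀ τ s ↔ (Inner₌ R μ ν ⊎ Inner≢ R μ ν)
        inner-split = refinement-⊎ (λ p → proj₁ p ≟ᵛ a₀)

        inner₌ : ∀ {R μ ν} → Inner₌ R μ ν ↔ Pictures R μ ν σ τ
        inner₌ {R} {μ} {ν} = refinement-↔ _≟ᵖ_ _≟ᵐ_ proj₂ (a₀ ,_)
          (λ { (a , bs) (refl , _ , ch , e) → chain-cong μ ν bs σ₀⊕a₀ ch , λ i → trans
              (cong (_+ colsum bs i) (sym (σ₀⊕a₀ i))) (e i) })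
          (λ { bs (ch , e) → refl , a₀-strip , chain-cong μ ν bs (λ i → sym (σ₀⊕a₀ i)) ch , λ i → trans
              (cong (_+ colsum bs i) (σ₀⊕a₀ i)) (e i) })
          (λ { (a , bs) (refl , _) → refl }) (λ _ _ → refl)

        Proper : Vec ℕ n → Set
        Proper a = ¬ (a ≡ a₀) × IsStrip σ₀ s a

        inner≢ : ∀ {R μ ν} → Inner≢ R μ ν ↔ Σ (Refinement (Vec ℕ n) Proper)
            (λ a → Pictures R μ ν (σ₀ ⊕ at (value a)) τ)
        inner≢ {R} {μ} {ν} = refinement-Σ Proper (λ a → IsPicture μ ν (σ₀ ⊕ at a) τ) ↔-∘ refinement-⇔
          (λ { _ (x , y , z) → (x , y) , z }) (λ { _ ((x , y) , z) → x , y , z })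

        same≢ : Inner≢ R μ ν ↔ Inner≢ R′ μ′ ν′
        same≢ = ↔-sym inner≢ ↔-∘ (Σ-cong-↔ each ↔-∘ inner≢)
          where
          each : (a : Refinement (Vec ℕ n) Proper) → Pictures R μ ν (σ₀ ⊕ at (value a)) τ ↔ Pictures R′ μ′ ν′
              (σ₀ ⊕ at (value a)) τ
          each (a ,ʳ [ p ]) = same₁ (σ₀ ⊕ at a)
            (λ i → recompute (_ ≤? _) (strip⇒decr-⊕ {σ₀} {at a} (proj₁ (proj₂ p)) i))
            (λ i ℓ<i → recompute (_ ≟ _) (cong₂ _+_ (σ₀-supp i (<⇒≤ ℓ<i)) (strip-above a (proj₁ (proj₂ p)) i ℓ<i)))
            -- A strip other than `a₀` leaves row ℓ shorter than s, which is what the inner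
            -- induction asks for.
            (recompute (_ <? _) (subst (_< s) (sym (cong (_+ at a ℓ) (σ₀-supp ℓ ≤-refl)))
                (≰⇒> (proj₁ p ∘ full⇒a₀ a (proj₂ p)))))
            τ dτ sτ

        finite≢ : Finite (Inner≢ R μ ν)
        finite≢ = finite-refinement _≟ᵖ_
          (λ p → ¬? (proj₁ p ≟ᵛ a₀) ×-dec (strip? sσ₀ (proj₁ p) ×-dec (_ ≟ _)) ×-dec isPicture? μ ν
              (⊕-supp sσ₀ (proj₁ p)) sτ (proj₂ p))
          (cartesianProduct (vecsOf (upTo (suc (psum τ n))) n) (matrices (psum τ n) R))
          (λ { (a , bs) (_ , _ , _ , e) → ∈-cartesianProduct⁺
            (∈-vecsOf (all-at (λ i → ≤-trans (m+n≤o⇒n≤o (σ₀ i) (m+n≤o⇒m≤o _ (≤-reflexive (e i)))) (≤total sτ i))))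
            (∈-matrices bs (λ i → ≤-trans (m+n≤o⇒n≤o (σ₀ i + at a i) (≤-reflexive (e i))) (≤total sτ i))) })
          where
          sσ₀ : Supp n σ₀
          sσ₀ i n≤i = σ₀-supp i (≤-trans (<⇒≤ ℓ<n) n≤i)

        -- The full expansions over `σ₀` agree, and so do their parts with a strip other than `a₀`.
        -- Cancelling these finite parts leaves the term of `a₀`, which is that of σ.
        same : Pictures R μ ν σ τ ↔ Pictures R′ μ′ ν′ σ τ
        same = ⊎-cancelʳ-↔ (finite-pictures sσ′ sτ) (finite-pictures sσ′ sτ) finite≢
          ((inner₌ ⊎-↔ ↔-id _) ↔-∘ (inner-split ↔-∘ (same-inner (same₀ σ₀ σ₀-decr σ₀-supp) s τ sτ ↔-∘
             (↔-sym inner-split ↔-∘ (↔-sym inner₌ ⊎-↔ ↔-id _)))))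
          same≢
          where
          sσ′ : Supp n σ
          sσ′ i n≤i = sσ i (≤-trans ℓ<n n≤i)

    -- Induction on the number ℓ of rows of σ, and within it on the length of the last row, for
    -- which k is a strict upper bound.
    transfer-upto : Same (λ _ → 0) → ∀ ℓ → ℓ ≤ n → ∀ σ → Decr σ → Supp ℓ σ → Same σ
    transfer-upto base zero    _   σ dσ sσ τ dτ sτ =
      pictures-cong (λ i → sym (sσ i z≤n)) (λ _ → refl) ↔-∘
          (base τ dτ sτ ↔-∘ pictures-cong (λ i → sσ i z≤n) (λ _ → refl))
    transfer-upto base (suc ℓ) ℓ<n σ dσ sσ = bounded (suc (σ ℓ)) σ dσ sσ ≤-refl
      where
      bounded : ∀ k σ → Decr σ → Supp (suc ℓ) σ → σ ℓ < k → Same σ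
      bounded (suc k) σ dσ sσ (s≤s σℓ≤k) = LastRow.same ℓ ℓ<n σ dσ sσ
        (transfer-upto base ℓ (<⇒≤ ℓ<n))
        (λ σ₁ dσ₁ sσ₁ lt → bounded k σ₁ dσ₁ sσ₁ (≤-trans lt σℓ≤k))

    transfer : Same (λ _ → 0) → ∀ σ → Decr σ → Supp n σ → Same σ
    transfer base = transfer-upto base n ≤-refl

-- Tableaux given by the entries of their matrices

ent : ∀ {n R} → Matrix {n} R → ℕ → ℕ → ℕ
ent []       r       k = 0
ent (b ∷ bs) zero    k = at b k
ent (b ∷ bs) (suc r) k = ent bs r k

mkMatrix : ∀ {n} R → (ℕ → ℕ → ℕ) → Matrix {n} R
mkMatrix zero    X = []
mkMatrix {n} (suc R) X = mk n (X 0) ∷ mkMatrix R (X ∘ suc)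

ent-supp : ∀ {n R} (bs : Matrix {n} R) r → Supp n (ent bs r)
ent-supp []       r       i n≤i = refl
ent-supp (b ∷ bs) zero    i n≤i = at-supp b i n≤i
ent-supp (b ∷ bs) (suc r) i n≤i = ent-supp bs r i n≤i

ent-mkMatrix : ∀ {n} R X → ∀ r → r < R → Supp n (X r) → ∀ k → ent (mkMatrix {n} R X) r k ≡ X r k
ent-mkMatrix {n} (suc R) X zero    _         s k = at-mk n (X 0) s k
ent-mkMatrix {n} (suc R) X (suc r) (s≤s r<R) s k = ent-mkMatrix R (X ∘ suc) r r<R s k

mkMatrix-ext : ∀ {n R} (bs : Matrix {n} R) X → (∀ r → r < R → ∀ k → k < n → ent bs r k ≡ X r k) → mkMatrix R X ≡ bs
mkMatrix-ext []       X h = refl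
mkMatrix-ext {n} (b ∷ bs) X h = cong₂ _∷_
  (at-ext-< (λ i i<n → trans (at-mk-< n (X 0) i i<n) (sym (h 0 z<s i i<n))))
  (mkMatrix-ext bs (X ∘ suc) (λ r r<R → h (suc r) (s≤s r<R)))

colsum≡psum : ∀ {n R} (bs : Matrix {n} R) k → colsum bs k ≡ psum (λ r → ent bs r k) R
colsum≡psum []       k = refl
colsum≡psum {R = suc R} (b ∷ bs) k = trans (cong (at b k +_) (colsum≡psum bs k))
    (sym (psum-head (λ r → ent (b ∷ bs) r k) R))

colsum-mkMatrix : ∀ {n R} X → (∀ r → r < R → Supp n (X r)) → ∀ k → colsum (mkMatrix {n} R X) k ≡ psum (λ r → X r k) R
colsum-mkMatrix {n} {R} X s k = trans (colsum≡psum (mkMatrix R X) k)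
  (psum-cong-< R (λ r r<R → ent-mkMatrix R X r r<R (s r r<R) k))

-- `Chain` unrolled: the conditions are indexed by rows, and partial column sums replace the growing
-- σ. Tableaux are taken apart and built in this form.
record IsTableau (n R : ℕ) (μ ν σ : Seq) (X : ℕ → ℕ → ℕ) : Set where
  field
    rowsum   : ∀ r → r < R → μ r + psum (X r) n ≡ ν r
    lattice′ : ∀ r → r < R → ∀ k → σ (suc k) + psum (λ s → X s (suc k)) (suc r) ≤ σ k + psum (λ s → X s k) r
    columns  : ∀ r → suc r < R → ColStrict (μ r) (μ (suc r)) (X r) (X (suc r))

chain⇒tableau : ∀ {n R} (μ ν σ : Seq) (bs : Matrix {n} R) → Chain μ ν σ bs → IsTableau n R μ ν σ (ent bs)
chain⇒tableau μ ν σ [] _ = record { rowsum = λ _ () ; lattice′ = λ _ () ; columns = λ _ () }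
chain⇒tableau {n} {suc R} μ ν σ (b ∷ bs) (p , sb , adj , ch) = record
    { rowsum = rows ; lattice′ = lat ; columns = cols bs adj (IsTableau.columns ih) }
  where
  ih = chain⇒tableau (μ ∘ suc) (ν ∘ suc) (σ ⊕ at b) bs ch
  X = ent (b ∷ bs)
  rows : ∀ r → r < suc R → μ r + psum (X r) n ≡ ν r
  rows zero    _         = p
  rows (suc r) (s≤s r<R) = IsTableau.rowsum ih r r<R
  head : ∀ k r → σ k + psum (λ s → X s k) (suc r) ≡ σ k + at b k + psum (λ s → ent bs s k) r
  head k r = trans (cong (σ k +_) (psum-head (λ s → X s k) r)) (sym (+-assoc (σ k) _ _))
  lat : ∀ r → r < suc R → ∀ k → σ (suc k) + psum (λ s → X s (suc k)) (suc r) ≤ σ k + psum (λ s → X s k) r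
  lat zero    _         k = subst (σ (suc k) + at b (suc k) ≤_) (sym (+-identityʳ (σ k))) (sb k)
  lat (suc r) (s≤s r<R) k = subst₂ _≤_ (sym (head (suc k) (suc r))) (sym (head k r)) (IsTableau.lattice′ ih r r<R k)
  cols : ∀ {R} (bs : Matrix {n} R) → Adjacent μ b bs →
    (∀ r → suc r < R → ColStrict (μ (suc r)) (μ (suc (suc r))) (ent bs r) (ent bs (suc r))) →
    ∀ r → suc r < suc R → ColStrict (μ r) (μ (suc r)) (ent (b ∷ bs) r) (ent bs r)
  cols []       adj h r       (s≤s ())
  cols (f ∷ bs) adj h zero    _         = adj
  cols (f ∷ bs) adj h (suc r) (s≤s r<R) = h r r<R

tableau⇒chain : ∀ {n} R (μ ν σ : Seq) X → (∀ r → r < R → Supp n (X r)) → IsTableau n R μ ν σ X → Chain μ ν σ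
    (mkMatrix {n} R X)
tableau⇒chain zero μ ν σ X s t = tt
tableau⇒chain {n} (suc R) μ ν σ X s t =
  trans (cong (μ 0 +_) (psum-cong at-X₀ n)) (T.rowsum 0 z<s) ,
  (λ i → subst₂ _≤_ (cong (σ (suc i) +_) (sym (at-X₀ (suc i)))) (+-identityʳ (σ i)) (T.lattice′ 0 z<s i)) ,
  adj R s T.columns ,
  tableau⇒chain R (μ ∘ suc) (ν ∘ suc) (σ ⊕ at (mk n (X 0))) (X ∘ suc) (λ r r<R → s (suc r) (s≤s r<R)) (record
    { rowsum   = λ r r<R → T.rowsum (suc r) (s≤s r<R)
    ; lattice′ = λ r r<R k → subst₂ _≤_ (head (suc k) (suc r)) (head k r) (T.lattice′ (suc r) (s≤s r<R) k)
    ; columns  = λ r r<R → T.columns (suc r) (s≤s r<R) })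
  where
  module T = IsTableau t
  at-X₀ : ∀ i → at (mk n (X 0)) i ≡ X 0 i
  at-X₀ = at-mk n (X 0) (s 0 z<s)
  head : ∀ k r → σ k + psum (λ s → X s k) (suc r) ≡ σ k + at (mk n (X 0)) k + psum (λ s → X (suc s) k) r
  head k r = trans (cong (σ k +_)
      (trans (psum-head (λ s → X s k) r) (cong (_+ psum (λ s → X (suc s) k) r) (sym (at-X₀ k)))))
      (sym (+-assoc (σ k) _ _))
  adj : ∀ R → (∀ r → r < suc R → Supp n (X r)) → (∀ r → suc r < suc R → ColStrict (μ r) (μ (suc r)) (X r) (X (suc r)))
      → Adjacent μ (mk n (X 0)) (mkMatrix {n} R (X ∘ suc))
  adj zero    s h = tt
  adj (suc R) s h = colStrict-cong (μ 0) (μ 1) (λ i → sym (at-X₀ i)) (λ i → sym (at-mk n (X 1) (s 1 (s≤s z<s)) i))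
      (h 0 (s≤s z<s))

-- Concatenated sequences, for disjoint unions of shapes

splice : ℕ → Seq → Seq → Seq
splice zero    g f k       = f k
splice (suc q) g f zero    = g 0
splice (suc q) g f (suc k) = splice q (g ∘ suc) f k

splice-< : ∀ q {g f : Seq} k → k < q → splice q g f k ≡ g k
splice-< (suc q) zero    _         = refl
splice-< (suc q) (suc k) (s≤s k<q) = splice-< q k k<q

splice-≥ : ∀ q {g f : Seq} j → splice q g f (q + j) ≡ f j
splice-≥ zero    j = refl
splice-≥ (suc q) {g} j = splice-≥ q {g ∘ suc} j

splice-supp : ∀ q {g f : Seq} {m} → Supp m f → Supp (q + m) (splice q g f)
splice-supp zero    s i       m≤i       = s i m≤i
splice-supp (suc q) s (suc i) (s≤s m≤i) = splice-supp q s i m≤i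

-- The three hypotheses treat the indices inside the first block, at the seam, and inside the second
-- block.
splice-step : ∀ q {g₁ f₁ g₀ f₀ : Seq} → (∀ k → suc k < q → g₁ (suc k) ≤ g₀ k) → (∀ k → suc k ≡ q → f₁ 0 ≤ g₀ k) →
  (∀ j → f₁ (suc j) ≤ f₀ j) → ∀ k → splice q g₁ f₁ (suc k) ≤ splice q g₀ f₀ k
splice-step zero          hg hb hf k       = hf k
splice-step (suc zero)    hg hb hf zero    = hb 0 refl
splice-step (suc zero)    hg hb hf (suc k) = hf k
splice-step (suc (suc q)) hg hb hf zero    = hg 0 (s≤s z<s)
splice-step (suc (suc q)) {g₁} hg hb hf (suc k) = splice-step (suc q) {g₁ ∘ suc} (λ i h → hg (suc i) (s≤s h))
    (λ i e → hb (suc i) (cong suc e)) hf k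

splice-⊕ : ∀ q (g f g′ f′ : Seq) k → splice q g f k + splice q g′ f′ k ≡ splice q (g ⊕ g′) (f ⊕ f′) k
splice-⊕ zero    g f g′ f′ k       = refl
splice-⊕ (suc q) g f g′ f′ zero    = refl
splice-⊕ (suc q) g f g′ f′ (suc k) = splice-⊕ q (g ∘ suc) f (g′ ∘ suc) f′ k

splice-cong : ∀ q {g f g′ f′ : Seq} → (∀ k → k < q → g k ≡ g′ k) → (∀ j → f j ≡ f′ j) → ∀ k → splice q g f k ≡ splice
    q g′ f′ k
splice-cong zero    eg ef k       = ef k
splice-cong (suc q) eg ef zero    = eg 0 z<s
splice-cong (suc q) eg ef (suc k) = splice-cong q (λ i i<q → eg (suc i) (s≤s i<q)) ef k

psum-splice-rows : ∀ q (g f : ℕ → ℕ → ℕ) r k →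
  psum (λ s → splice q (g s) (f s) k) r ≡ splice q (λ i → psum (λ s → g s i) r) (λ j → psum (λ s → f s j) r) k
psum-splice-rows zero    g f r k       = refl
psum-splice-rows (suc q) g f r zero    = refl
psum-splice-rows (suc q) g f r (suc k) = psum-splice-rows q (λ s → g s ∘ suc) f r k

psum-splice-≤ : ∀ q (g f : Seq) j → j ≤ q → psum (splice q g f) j ≡ psum g j
psum-splice-≤ q g f j j≤q = psum-cong-< j (λ i i<j → splice-< q i (≤-trans i<j j≤q))

psum-splice : ∀ q (g f : Seq) j → psum (splice q g f) (q + j) ≡ psum g q + psum f j
psum-splice q g f j = trans (psum-split (splice q g f) q j)
  (cong₂ _+_ (psum-splice-≤ q g f q ≤-refl) (psum-cong (splice-≥ q {g}) j))

-- The indicator of k < c. After some rows of a tableau, the letters of the column used so far are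
-- its first c ones, each once.
step : ℕ → Seq
step c k = 1 ⊓ (c ∸ k)

step≤1 : ∀ c k → step c k ≤ 1
step≤1 c k = m⊓n≤m 1 (c ∸ k)

psum-step : ∀ c k → psum (step c) k ≡ k ⊓ c
psum-step c zero    = refl
psum-step zero    (suc k) = cong₂ _+_ (trans (psum-step zero k) (⊓-zeroʳ k)) (cong (1 ⊓_) (0∸n≡0 k))
psum-step (suc c) (suc k) = trans (psum-head (step (suc c)) k) (cong suc (psum-step c k))

-- A decreasing sequence of zeros and ones is a run of ones followed by zeros, so its sum determines
-- it.
step-unique : ∀ q (f : Seq) → (∀ k → f k ≤ 1) → (∀ k → suc k < q → f (suc k) ≤ f k) → ∀ k → k < q → f k ≡ step
    (psum f q) k
step-unique (suc q) f h1 hd k k<q with f 0 in eq | h1 0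
... | zero | _ = trans (zeros k k<q) (sym (trans (cong (λ x → step x k) total) (cong (1 ⊓_) (0∸n≡0 k))))
  where
  zeros : ∀ k → k < suc q → f k ≡ 0
  zeros zero    _   = eq
  zeros (suc k) k<q = n≤0⇒n≡0 (subst (f (suc k) ≤_) (zeros k (<⇒≤ k<q)) (hd k k<q))
  total : psum f (suc q) ≡ 0
  total = trans (psum-cong-< (suc q) zeros) (psum-0 (suc q))
... | suc zero | _ with k | k<q
...   | zero   | _ = trans eq (sym (cong (λ x → step x 0) total))
  where
  total : psum f (suc q) ≡ suc (psum (f ∘ suc) q)
  total = trans (psum-head f q) (cong (_+ psum (f ∘ suc) q) eq)
...   | suc k′ | s≤s k′<q = trans (step-unique q (f ∘ suc) (h1 ∘ suc) (λ i h → hd (suc i) (s≤s h)) k′ k′<q)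
    (sym (cong (λ x → step x (suc k′)) total))
  where
  total : psum f (suc q) ≡ suc (psum (f ∘ suc) q)
  total = trans (psum-head f q) (cong (_+ psum (f ∘ suc) q) eq)
step-unique (suc q) f h1 hd k k<q | suc (suc _) | s≤s ()

-- Removing the northwest ribbon

-- The northwest ribbon of ν/μ is shrink μ ν / μ.
shrink : Seq → Seq → Seq
shrink μ ν zero    = ν 0
shrink μ ν (suc r) = suc (μ r) ⊓ ν (suc r)

record IsSkew (μ ν : Seq) : Set where
  field
    decr-μ : Decr μ
    decr-ν : Decr ν
    μ≤ν    : ∀ r → μ r ≤ ν r

module _ {μ ν : Seq} (skew : IsSkew μ ν) where
  open IsSkew skew

  shrink≤ν : ∀ r → shrink μ ν r ≤ ν r
  shrink≤ν zero    = ≤-refl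
  shrink≤ν (suc r) = m⊓n≤n (suc (μ r)) (ν (suc r))

  μ≤shrink : ∀ r → μ r ≤ shrink μ ν r
  μ≤shrink zero    = μ≤ν 0
  μ≤shrink (suc r) = ⊓-glb (m≤n⇒m≤1+n (decr-μ r)) (μ≤ν (suc r))

  shrink-decr : Decr (shrink μ ν)
  shrink-decr zero    = ≤-trans (shrink≤ν 1) (decr-ν 0)
  shrink-decr (suc r) = ⊓-mono-≤ (s≤s (decr-μ r)) (decr-ν (suc r))

  shrink-skew : IsSkew (shrink μ ν) ν
  shrink-skew = record { decr-μ = shrink-decr ; decr-ν = decr-ν ; μ≤ν = shrink≤ν }

module _ (μ ν : Seq) where

  -- Row lengths of the ribbon; a box with a right neighbour must be filled
  -- with the horizontal letter, so a row has at least len - 1 of these, and at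
  -- most those boxes without a box of the ribbon above them.
  len least most : Seq
  len r   = shrink μ ν r ∸ μ r
  least r = len r ∸ 1
  most zero    = len 0
  most (suc r) = (μ r ⊓ ν (suc r)) ∸ μ (suc r)

least≤most : ∀ μ ν r → least μ ν r ≤ most μ ν r
least≤most μ ν zero    = m∸n≤m _ 1
least≤most μ ν (suc r) = begin
  (suc (μ r) ⊓ ν (suc r)) ∸ μ (suc r) ∸ 1   ≡⟨ ∸-+-assoc _ (μ (suc r)) 1 ⟩
  (suc (μ r) ⊓ ν (suc r)) ∸ (μ (suc r) + 1) ≡⟨ cong (λ x → (suc (μ r) ⊓ ν (suc r)) ∸ x) (+-comm (μ (suc r)) 1) ⟩
  (suc (μ r) ⊓ ν (suc r)) ∸ suc (μ (suc r)) ≤⟨ ∸-monoˡ-≤ (suc (μ (suc r))) (⊓-monoʳ-≤ (suc (μ r)) (n≤1+n (ν (suc r))))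
      ⟩
  (μ r ⊓ ν (suc r)) ∸ μ (suc r)             ∎
  where open ≤-Reasoning

most≤len : ∀ μ ν r → most μ ν r ≤ len μ ν r
most≤len μ ν zero    = ≤-refl
most≤len μ ν (suc r) = ∸-monoˡ-≤ (μ (suc r)) (⊓-monoˡ-≤ (ν (suc r)) (n≤1+n (μ r)))

-- The shape (p) ⊕ (1^q) ⊕ τ/σ, translated to be a skew shape.
catσ : ℕ → ℕ → Seq → Seq
catσ K q σ = splice 1 (λ _ → K + K) (splice q (λ _ → K) σ)

catτ : ℕ → ℕ → ℕ → Seq → Seq
catτ K p q τ = splice 1 (λ _ → K + K + p) (splice q (λ _ → suc K) τ)

-- In a picture against the union, letter 0 belongs to the row (p), the letters 1 to q to the
-- column, and the later ones to τ/σ. Row r contains `t r` letters of the first kind and `U r` of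
-- the second; `P r k` counts column letter k in the first r rows.
module Forward {R : ℕ} {μ ν : Seq} (skew : IsSkew μ ν) {K p q m : ℕ} {σ τ : Seq}
  (bs : Matrix {suc q + m} R) (pic : IsPicture μ ν (catσ K q σ) (catτ K p q τ) bs) where

  open IsSkew skew

  X : ℕ → ℕ → ℕ
  X = ent bs

  open IsTableau (chain⇒tableau μ ν (catσ K q σ) bs (proj₁ pic))

  t U cnt : Seq
  t r = X r 0
  U r = psum (X r ∘ suc) q
  cnt = psum U

  P : ℕ → ℕ → ℕ
  P r k = psum (λ s → X s (suc k)) r

  column : ∀ k → catσ K q σ k + psum (λ s → X s k) R ≡ catτ K p q τ k
  column k = trans (cong (catσ K q σ k +_) (sym (colsum≡psum bs k))) (proj₂ pic k)

  psum-t : psum t R ≡ p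
  psum-t = +-cancelˡ-≡ (K + K) _ _ (column 0)

  P-total : ∀ k → k < q → P R k ≡ 1
  P-total k k<q = +-cancelˡ-≡ K _ _
      (trans (trans (cong (_+ P R k) (sym (splice-< q k k<q))) (trans (column (suc k)) (splice-< q k k<q)))
      (+-comm 1 K))

  -- Within the column block σ is constantly K, so the lattice condition compares the bare counts:
  -- each column letter needs its predecessor in an earlier row.
  P-step : ∀ r → r < R → ∀ k → suc k < q → P (suc r) (suc k) ≤ P r k
  P-step r r<R k k<q = +-cancelˡ-≤ K _ _ (subst₂ (λ x y → x + P (suc r) (suc k) ≤ y + P r k)
    (splice-< q (suc k) k<q) (splice-< q k (<⇒≤ k<q)) (lattice′ r r<R (suc k)))

  P≤1 : ∀ r → r ≤ R → ∀ k → k < q → P r k ≤ 1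
  P≤1 r r≤R k k<q = subst (P r k ≤_) (P-total k k<q) (psum-mono (λ s → X s (suc k)) r≤R)

  P-decr : ∀ r → r ≤ R → ∀ k → suc k < q → P r (suc k) ≤ P r k
  P-decr zero    _   k k<q = z≤n
  P-decr (suc r) r<R k k<q = ≤-trans (P-step r r<R k k<q) (m≤m+n (P r k) _)

  cnt≡ : ∀ r → cnt r ≡ psum (P r) q
  cnt≡ r = psum-swap (λ s k → X s (suc k)) q r

  P≡step : ∀ r → r ≤ R → ∀ k → k < q → P r k ≡ step (cnt r) k
  -- `step-unique` wants the bound 1 at every index, hence the truncation by `1 ⊓`, which changes
  -- nothing below q.
  P≡step r r≤R k k<q = trans (sym (capped k k<q)) (trans
    (step-unique q (λ k → 1 ⊓ P r k) (λ k → m⊓n≤m 1 _) (λ k h → ⊓-monoʳ-≤ 1 (P-decr r r≤R k h)) k k<q)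
    (cong (λ x → step x k) (trans (psum-cong-< q capped) (sym (cnt≡ r)))))
    where
    capped : ∀ k → k < q → 1 ⊓ P r k ≡ P r k
    capped k k<q = m≥n⇒m⊓n≡n (P≤1 r r≤R k k<q)

  -- After one more row, the count of column letter k + 1 is at most the previous count of letter k,
  -- and the first column letter occurs at most once. Summing, a row adds at most one column letter.
  U≤1 : ∀ r → r < R → U r ≤ 1
  U≤1 r r<R = +-cancelˡ-≤ (cnt r) _ _
      (subst₂ _≤_ (sym (cnt≡ (suc r))) (trans (cong suc (sym (cnt≡ r))) (+-comm 1 _)) (bound q ≤-refl))
    where
    bound : ∀ q′ → q′ ≤ q → psum (P (suc r)) q′ ≤ suc (psum (P r) q′)
    bound zero     _  = z≤n
    bound (suc q′) h = begin
      psum (P (suc r)) (suc q′)                      ≡⟨ psum-head (P (suc r)) q′ ⟩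
      P (suc r) 0 + psum (P (suc r) ∘ suc) q′        ≤⟨ +-mono-≤ (P≤1 (suc r) r<R 0 (≤-trans z<s h))
          (psum-≤ q′ (λ i i<q → P-step r r<R i (≤-trans (s≤s i<q) h))) ⟩
      1 + psum (P r) q′                              ≤⟨ s≤s (m≤m+n _ (P r q′)) ⟩
      suc (psum (P r) (suc q′))                      ∎
      where open ≤-Reasoning

  psum-U : psum U R ≡ q
  psum-U = trans (cnt≡ R) (trans (psum-cong-< q P-total) (psum-1 q))

  psum-X : ∀ r j → psum (X r) (suc q + j) ≡ t r + U r + psum (λ i → X r (suc q + i)) j
  psum-X r j = trans (psum-split (X r) (suc q) j) (cong (_+ psum (λ i → X r (suc q + i)) j) (psum-head (X r) q))

  -- No letter is smaller than 0, so no box of the tableau lies above a letter 0.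
  t-bound : ∀ r → suc r < R → μ (suc r) + t (suc r) ≤ μ r
  t-bound r r<R = subst (μ (suc r) + t (suc r) ≤_) (+-identityʳ (μ r)) (columns r r<R 0)

  t+U≤ν : ∀ r → r < R → μ r + (t r + U r) ≤ ν r
  t+U≤ν r r<R = subst (μ r + (t r + U r) ≤_) (trans (cong (μ r +_) (sym (psum-X r m))) (rowsum r r<R))
      (+-monoʳ-≤ (μ r) (m≤m+n (t r + U r) _))

  -- By `t-bound` the letters 0 end at column μ r of the row above, and at most one column letter
  -- follows them.
  t+U≤shrink : ∀ r → r < R → μ r + (t r + U r) ≤ shrink μ ν r
  t+U≤shrink zero    r<R = t+U≤ν 0 r<R
  t+U≤shrink (suc r) r<R = ⊓-glb
    (≤-trans (≤-reflexive (sym (+-assoc (μ (suc r)) (t (suc r)) (U (suc r)))))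
        (subst (μ (suc r) + t (suc r) + U (suc r) ≤_) (+-comm (μ r) 1) (+-mono-≤ (t-bound r r<R) (U≤1 (suc r) r<R))))
    (t+U≤ν (suc r) r<R)

  t+U≤len : ∀ r → r < R → t r + U r ≤ len μ ν r
  t+U≤len r r<R = m+n≤o⇒n≤o∸m (μ r) (t+U≤shrink r r<R)
    where
    m+n≤o⇒n≤o∸m : ∀ m {n o} → m + n ≤ o → n ≤ o ∸ m
    m+n≤o⇒n≤o∸m m {n} h = subst (_≤ _) (m+n∸m≡n m n) (∸-monoˡ-≤ m h)

  psum-t+U : psum (λ r → t r + U r) R ≡ p + q
  psum-t+U = trans (psum-⊕ t U R) (cong₂ _+_ psum-t psum-U)

  p+q≤size : p + q ≤ psum (len μ ν) R
  p+q≤size = subst (_≤ psum (len μ ν) R) psum-t+U (psum-≤ R t+U≤len)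

  module Maximal (maximal : psum (len μ ν) R ≤ p + q) where

    t+U≡len : ∀ r → r < R → t r + U r ≡ len μ ν r
    t+U≡len = psum-≤-tight R t+U≤len (≤-trans maximal (≤-reflexive (sym psum-t+U)))

    t+U≡shrink : ∀ r → r < R → μ r + (t r + U r) ≡ shrink μ ν r
    t+U≡shrink r r<R = trans (cong (μ r +_) (t+U≡len r r<R)) (m+[n∸m]≡n (μ≤shrink skew r))

    least≤t : ∀ r → r < R → least μ ν r ≤ t r
    least≤t r r<R = subst (_≤ t r) (cong (_∸ 1) (t+U≡len r r<R))
      (subst ((t r + U r) ∸ 1 ≤_) (m+n∸n≡m (t r) 1) (∸-monoˡ-≤ 1 (+-monoʳ-≤ (t r) (U≤1 r r<R))))

    t≤most : ∀ r → r < R → t r ≤ most μ ν r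
    t≤most zero    r<R = m+n≤o⇒m≤o (t 0) (t+U≤len 0 r<R)
    t≤most (suc r) r<R = subst (_≤ most μ ν (suc r)) (m+n∸m≡n (μ (suc r)) _)
      (∸-monoˡ-≤ (μ (suc r)) (⊓-glb (t-bound r r<R)
          (≤-trans (+-monoʳ-≤ (μ (suc r)) (m≤m+n _ _)) (t+U≤ν (suc r) r<R))))

    least≤p : psum (least μ ν) R ≤ p
    least≤p = subst (psum (least μ ν) R ≤_) psum-t (psum-≤ R least≤t)

    p≤most : p ≤ psum (most μ ν) R
    p≤most = subst (_≤ psum (most μ ν) R) psum-t (psum-≤ R t≤most)

    Y : ℕ → ℕ → ℕ
    Y r j = X r (suc q + j)

    Y-supp : ∀ r → Supp m (Y r)
    Y-supp r j m≤j = ent-supp bs r (suc q + j) (+-monoʳ-≤ (suc q) m≤j)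

    -- In the extremal case the letters 0 to q fill row r exactly up to `shrink μ ν r`. The
    -- remaining letters start there, and their conditions are those of X from letter q + 1 on.
    tail-tableau : IsTableau m R (shrink μ ν) ν σ Y
    tail-tableau = record
      { rowsum   = λ r r<R → trans (split r m r<R) (rowsum r r<R)
      ; lattice′ = λ r r<R j → subst₂ _≤_
          (cong₂ _+_ (trans (cong (splice q (λ _ → K) σ) (sym (+-suc q j))) (splice-≥ q (suc j)))
              (psum-cong (λ s → cong (X s ∘ suc) (sym (+-suc q j))) (suc r)))
          (cong (_+ psum (λ s → Y s j) r) (splice-≥ q j))
          (lattice′ r r<R (suc q + j))
      ; columns  = λ r r<R j → subst₂ _≤_
          (sym (trans (split (suc r) (suc j) r<R) (cong (λ x → μ (suc r) + psum (X (suc r)) x) (+-suc (suc q) j))))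
          (sym (split r j (<⇒≤ r<R)))
          (columns r r<R (suc q + j)) }
      where
      split : ∀ r j → r < R → shrink μ ν r + psum (Y r) j ≡ μ r + psum (X r) (suc q + j)
      split r j r<R = trans (cong (_+ psum (Y r) j) (sym (t+U≡shrink r r<R)))
          (trans (+-assoc (μ r) _ _) (cong (μ r +_) (sym (psum-X r j))))

    tail : Matrix {m} R
    tail = mkMatrix R Y

    tail-picture : IsPicture (shrink μ ν) ν σ τ tail
    tail-picture = tableau⇒chain R (shrink μ ν) ν σ Y (λ r _ → Y-supp r) tail-tableau ,
      (λ j → trans (cong (σ j +_) (colsum-mkMatrix {R = R} Y (λ r _ → Y-supp r) j))
        (trans (cong (_+ psum (λ s → Y s j) R) (sym (splice-≥ q j))) (trans (column (suc q + j)) (splice-≥ q j))))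

-- Conversely, every t between the two bounds can be realised: a row of the ribbon not exhausted by
-- letters 0 has one box left, and these boxes receive the column letters from top to bottom.
module Backward {R : ℕ} {μ ν : Seq} (skew : IsSkew μ ν) (t : Seq)
  (least≤t : ∀ r → least μ ν r ≤ t r) (t≤most : ∀ r → t r ≤ most μ ν r) where

  open IsSkew skew

  U cnt : Seq
  U r = len μ ν r ∸ t r
  cnt = psum U

  p q : ℕ
  p = psum t R
  q = cnt R

  t≤len : ∀ r → t r ≤ len μ ν r
  t≤len r = ≤-trans (t≤most r) (most≤len μ ν r)

  U≤1 : ∀ r → U r ≤ 1
  U≤1 r = m≤n+o⇒m∸n≤o (len μ ν r) (t r) (≤-trans (m≤n+m∸n (len μ ν r) 1)
    (≤-trans (≤-reflexive (+-comm 1 (least μ ν r))) (+-monoˡ-≤ 1 (least≤t r))))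

  p+q≡size : p + q ≡ psum (len μ ν) R
  p+q≡size = trans (sym (psum-⊕ t U R)) (psum-cong (λ r → m+[n∸m]≡n (t≤len r)) R)

  t+U≡shrink : ∀ r → μ r + (t r + U r) ≡ shrink μ ν r
  t+U≡shrink r = trans (cong (μ r +_) (m+[n∸m]≡n (t≤len r))) (m+[n∸m]≡n (μ≤shrink skew r))

  t-bound : ∀ r → μ (suc r) + t (suc r) ≤ μ r
  t-bound r = ≤-trans (+-monoʳ-≤ (μ (suc r)) (t≤most (suc r)))
    (≤-trans (≤-reflexive (m+[n∸m]≡n (⊓-glb (decr-μ r) (μ≤ν (suc r))))) (m⊓n≤m (μ r) _))

  -- The indicator of `cnt r ≤ k` and `k < cnt (suc r)`: if row r has a column letter, it is the one
  -- numbered `cnt r`.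
  u : ℕ → ℕ → ℕ
  u r k = step (cnt (suc r)) k ∸ step (cnt r) k

  step-mono : ∀ r k → step (cnt r) k ≤ step (cnt (suc r)) k
  step-mono r k = ⊓-monoʳ-≤ 1 (∸-monoˡ-≤ k (m≤m+n (cnt r) (U r)))

  psum-u-rows : ∀ k r → psum (λ s → u s k) r ≡ step (cnt r) k
  psum-u-rows k zero    = sym (cong (1 ⊓_) (0∸n≡0 k))
  psum-u-rows k (suc r) = trans (cong (_+ u r k) (psum-u-rows k r)) (m+[n∸m]≡n (step-mono r k))

  psum-u : ∀ r j → psum (u r) j + j ⊓ cnt r ≡ j ⊓ cnt (suc r)
  psum-u r j = begin
    psum (u r) j + j ⊓ cnt r                ≡⟨ cong (psum (u r) j +_) (psum-step (cnt r) j) ⟨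
    psum (u r) j + psum (step (cnt r)) j    ≡⟨ psum-⊕ (u r) (step (cnt r)) j ⟨
    psum (u r ⊕ step (cnt r)) j             ≡⟨ psum-cong (λ k → m∸n+n≡m (step-mono r k)) j ⟩
    psum (step (cnt (suc r))) j             ≡⟨ psum-step (cnt (suc r)) j ⟩
    j ⊓ cnt (suc r)                         ∎
    where open ≡-Reasoning

  psum-u-late : ∀ r j → cnt (suc r) ≤ j → psum (u r) j ≡ U r
  psum-u-late r j h = +-cancelʳ-≡ (cnt r) _ _ (trans
    (cong (psum (u r) j +_) (sym (m≥n⇒m⊓n≡n (≤-trans (m≤m+n _ (U r)) h))))
    (trans (psum-u r j) (trans (m≥n⇒m⊓n≡n h) (+-comm (cnt r) (U r)))))

  psum-u-early : ∀ r j → j ≤ cnt r → psum (u r) j ≡ 0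
  psum-u-early r j h = +-cancelʳ-≡ j _ _ (trans (cong (psum (u r) j +_) (sym (m≤n⇒m⊓n≡m h)))
    (trans (psum-u r j) (m≤n⇒m⊓n≡m (≤-trans h (m≤m+n _ (U r))))))

  psum-u≤U : ∀ r j → psum (u r) j ≤ U r
  psum-u≤U r j = +-cancelʳ-≤ (j ⊓ cnt r) _ _ (≤-trans (≤-reflexive (psum-u r j)) (≤-trans
    (⊓-mono-≤ (m≤n+m j (U r)) (≤-reflexive (+-comm (cnt r) (U r))))
    (≤-reflexive (sym (+-distribˡ-⊓ (U r) j (cnt r))))))

  gluing : ∀ {m} → Matrix {m} R → ℕ → ℕ → ℕ
  gluing ys r = splice 1 (λ _ → t r) (splice q (u r) (ent ys r))

  module _ {K m : ℕ} {σ τ : Seq} (1≤K : 1 ≤ K) (τ₀≤K : τ 0 ≤ K)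
    (ys : Matrix {m} R) (pic : IsPicture (shrink μ ν) ν σ τ ys) where

    private
      Y = ent ys
      glue = gluing ys
      module T = IsTableau (chain⇒tableau (shrink μ ν) ν σ ys (proj₁ pic))

    glue-supp : ∀ r → Supp (suc q + m) (glue r)
    glue-supp r = splice-supp 1 {λ _ → t r} {splice q (u r) (Y r)} (splice-supp q {u r} {Y r} (ent-supp ys r))

    psum-glue-< : ∀ r j → j ≤ q → psum (glue r) (suc j) ≡ t r + psum (u r) j
    psum-glue-< r j j≤q = trans (psum-head (glue r) j) (cong (t r +_) (psum-splice-≤ q (u r) (Y r) j j≤q))

    psum-glue-≥ : ∀ r j → r < R → psum (glue r) (suc q + j) ≡ t r + U r + psum (Y r) j
    psum-glue-≥ r j r<R = trans (psum-head (glue r) (q + j)) (trans (cong (t r +_)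
      (trans (psum-splice q (u r) (Y r) j) (cong (_+ psum (Y r) j) (psum-u-late r q (psum-mono U r<R)))))
          (sym (+-assoc (t r) _ _)))

    split : ∀ r j → r < R → shrink μ ν r + psum (Y r) j ≡ μ r + psum (glue r) (suc q + j)
    split r j r<R = trans (cong (_+ psum (Y r) j) (sym (t+U≡shrink r)))
        (trans (+-assoc (μ r) _ _) (cong (μ r +_) (sym (psum-glue-≥ r j r<R))))

    rows-glue : ∀ k r → psum (λ s → glue s k) r ≡ splice 1 (λ _ → psum t r)
        (splice q (step (cnt r)) (λ j → psum (λ s → Y s j) r)) k
    rows-glue k r = trans (psum-splice-rows 1 (λ s _ → t s) (λ s → splice q (u s) (Y s)) r k)
      (splice-cong 1 (λ _ _ → refl) (λ j → trans (psum-splice-rows q u Y r j)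
          (splice-cong q (λ i _ → psum-u-rows i r) (λ _ → refl) j)) k)

    catσ-glue : ∀ k r → catσ K q σ k + psum (λ s → glue s k) r ≡
      splice 1 (λ _ → K + K + psum t r) (splice q (λ i → K + step (cnt r) i) (λ j → σ j + psum (λ s → Y s j) r)) k
    catσ-glue k r = trans (cong (catσ K q σ k +_) (rows-glue k r)) (trans
      (splice-⊕ 1 _ _ _ _ k) (splice-cong 1 (λ _ _ → refl) (splice-⊕ q _ _ _ _) k))

    column : ∀ j → σ j + psum (λ s → Y s j) R ≡ τ j
    column j = trans (cong (σ j +_) (sym (colsum≡psum ys j))) (proj₂ pic j)

    tail≤K : ∀ r → r < R → σ 0 + psum (λ s → Y s 0) (suc r) ≤ K
    tail≤K r r<R = ≤-trans (+-monoʳ-≤ (σ 0) (psum-mono (λ s → Y s 0) r<R)) (≤-trans (≤-reflexive (column 0)) τ₀≤K)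

    -- Within the column block each row advances by at most one letter. At the two seams K + K and K
    -- dominate whatever stands in the next block, by `1≤K` and `τ₀≤K`.
    lattice-glue : ∀ r → r < R → ∀ k → catσ K q σ (suc k) + psum (λ s → glue s (suc k)) (suc r) ≤ catσ K q σ k + psum
        (λ s → glue s k) r
    lattice-glue r r<R k = subst₂ _≤_ (sym (catσ-glue (suc k) (suc r))) (sym (catσ-glue k r))
      (splice-step 1 {λ _ → K + K + psum t (suc r)} {splice q g₁ f₁} (λ { _ (s≤s ()) })
          (λ { _ _ → ≤-trans (first q) (m≤m+n (K + K) _) })
        (splice-step q {g₁} {f₁} (λ i _ → +-monoʳ-≤ K (shift i))
          (λ i _ → ≤-trans (tail≤K r r<R) (m≤m+n K _))
          (T.lattice′ r r<R)) k)
      where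
      g₁ f₁ : Seq
      g₁ i = K + step (cnt (suc r)) i
      f₁ j = σ j + psum (λ s → Y s j) (suc r)
      first : ∀ q → splice q g₁ f₁ 0 ≤ K + K
      first zero    = ≤-trans (tail≤K r r<R) (m≤m+n K K)
      first (suc q) = +-monoʳ-≤ K (≤-trans (step≤1 (cnt (suc r)) 0) 1≤K)
      shift : ∀ i → step (cnt (suc r)) (suc i) ≤ step (cnt r) i
      shift i = ⊓-monoʳ-≤ 1 (∸-monoˡ-≤ (suc i)
          (subst (cnt (suc r) ≤_) (+-comm (cnt r) 1) (+-monoʳ-≤ (cnt r) (U≤1 r))))

    -- Among the column letters there are two cases. If the one in row r + 1 is not yet counted,
    -- `t-bound` suffices. Otherwise the one in row r is counted too, and `shrink` is decreasing.
    -- For later letters the claim is that of `ys`.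
    columns-glue : ∀ r → suc r < R → ColStrict (μ r) (μ (suc r)) (glue r) (glue (suc r))
    columns-glue r r<R zero = subst (μ (suc r) + t (suc r) ≤_) (sym (+-identityʳ (μ r))) (t-bound r)
    columns-glue r r<R (suc j) with j <? q
    ... | yes j<q = subst₂ _≤_ (cong (μ (suc r) +_) (sym (psum-glue-< (suc r) (suc j) j<q)))
                               (cong (μ r +_) (sym (psum-glue-< r j (<⇒≤ j<q))))
                                   (bound (≤-total (suc j) (cnt (suc r))))
      where
      open ≤-Reasoning
      bound : suc j ≤ cnt (suc r) ⊎ cnt (suc r) ≤ suc j → μ (suc r) + (t (suc r) + psum (u (suc r)) (suc j)) ≤ μ r +
          (t r + psum (u r) j)
      bound′ : cnt (suc r) ≤ j → μ (suc r) + (t (suc r) + psum (u (suc r)) (suc j)) ≤ μ r + (t r + psum (u r) j)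
      bound (inj₁ h) = begin
        μ (suc r) + (t (suc r) + psum (u (suc r)) (suc j)) ≡⟨ cong (λ x → μ (suc r) + (t (suc r) + x))
            (psum-u-early (suc r) (suc j) h) ⟩
        μ (suc r) + (t (suc r) + 0)                        ≡⟨ cong (μ (suc r) +_) (+-identityʳ _) ⟩
        μ (suc r) + t (suc r)                              ≤⟨ t-bound r ⟩
        μ r                                                ≤⟨ m≤m+n (μ r) _ ⟩
        μ r + (t r + psum (u r) j)                         ∎
      bound (inj₂ h) with m≤n⇒m<n∨m≡n h
      ... | inj₁ (s≤s h′) = bound′ h′
      ... | inj₂ e = bound (inj₁ (≤-reflexive (sym e)))
      bound′ h = begin
        μ (suc r) + (t (suc r) + psum (u (suc r)) (suc j)) ≤⟨ +-monoʳ-≤ (μ (suc r))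
            (+-monoʳ-≤ (t (suc r)) (psum-u≤U (suc r) (suc j))) ⟩
        μ (suc r) + (t (suc r) + U (suc r))                ≡⟨ t+U≡shrink (suc r) ⟩
        shrink μ ν (suc r)                                 ≤⟨ shrink-decr skew r ⟩
        shrink μ ν r                                       ≡⟨ t+U≡shrink r ⟨
        μ r + (t r + U r)                                  ≡⟨ cong (λ x → μ r + (t r + x)) (psum-u-late r j h) ⟨
        μ r + (t r + psum (u r) j)                         ∎
    ... | no  j≮q = subst (λ x → μ (suc r) + psum (glue (suc r)) (suc (suc x)) ≤ μ r + psum (glue r) (suc x))
        (m+[n∸m]≡n (≮⇒≥ j≮q))
      (subst₂ _≤_ (trans (split (suc r) (suc i) r<R)
          (cong (λ x → μ (suc r) + psum (glue (suc r)) x) (+-suc (suc q) i))) (split r i (<⇒≤ r<R))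
          (T.columns r r<R i))
      where i = j ∸ q

    glued : Matrix {suc q + m} R
    glued = mkMatrix R glue

    glued-picture : IsPicture μ ν (catσ K q σ) (catτ K p q τ) glued
    glued-picture =
      tableau⇒chain R μ ν (catσ K q σ) glue (λ r _ → glue-supp r) (record
        { rowsum   = λ r r<R → trans (sym (split r m r<R)) (T.rowsum r r<R)
        ; lattice′ = lattice-glue
        ; columns  = columns-glue }) ,
      (λ k → trans (cong (catσ K q σ k +_) (colsum-mkMatrix {R = R} glue (λ r _ → glue-supp r) k))
          (trans (catσ-glue k R)
        (splice-cong 1 (λ _ _ → refl) (splice-cong q (λ i i<q → trans (cong (K +_) (full i i<q)) (+-comm K 1)) column)
            k)))
      where
      full : ∀ i → i < q → step q i ≡ 1
      full i i<q = m≤n⇒m⊓n≡m (m<n⇒0<n∸m i<q)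

module _ {R : ℕ} {μ ν : Seq} (skew : IsSkew μ ν) where

  arm : ℕ
  arm = psum (least μ ν) R

  module Least = Backward {R} skew (least μ ν) (λ _ → ≤-refl) (least≤most μ ν)

  module _ {K m : ℕ} {σ τ : Seq} (1≤K : 1 ≤ K) (τ₀≤K : τ 0 ≤ K) where
    open Least using (q)

    -- For the minimal p no box of the ribbon is free: tightness forces t = `least`, this tells
    -- which rows have a column letter, and `P≡step` tells which letter it is.
    ribbon-removal : Pictures {suc q + m} R μ ν (catσ K q σ) (catτ K arm q τ) ↔ Pictures {m} R (shrink μ ν) ν σ τ
    ribbon-removal = refinement-↔ _≟ᵐ_ _≟ᵐ_
      (λ bs → mkMatrix R (λ r j → ent bs r (suc q + j)))
      (λ ys → mkMatrix R (Least.gluing ys))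
      (λ bs pic → M.tail-picture bs pic)
      (λ ys pic → Least.glued-picture 1≤K τ₀≤K ys pic)
      (λ bs pic → mkMatrix-ext bs _ (λ r r<R k _ → reglue bs pic r r<R k))
      (λ ys pic → mkMatrix-ext ys _ (λ r r<R j _ → sym (trans
        (ent-mkMatrix R (Least.gluing ys) r r<R (Least.glue-supp 1≤K τ₀≤K ys pic r) (suc q + j)) (splice-≥ q j))))
      where
      module F bs pic = Forward {R} skew {K} {arm} {q} {m} {σ} {τ} bs pic
      module M bs pic = F.Maximal bs pic (≤-reflexive (sym Least.p+q≡size))
      module _ (bs : Matrix {suc q + m} R) (pic : IsPicture μ ν (catσ K q σ) (catτ K arm q τ) bs) where
        open F bs pic using (t; U; cnt; X; P; P≡step; psum-t)
        open M bs pic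

        t≡least : ∀ r → r < R → t r ≡ least μ ν r
        t≡least r r<R = sym (psum-≤-tight R least≤t (≤-reflexive psum-t) r r<R)

        cnt≡cnt : ∀ r → r ≤ R → cnt r ≡ Least.cnt r
        cnt≡cnt r r≤R = psum-cong-< r (λ i i<r → let i<R = ≤-trans i<r r≤R in
          trans (sym (m+n∸m≡n (t i) (U i))) (cong₂ _∸_ (t+U≡len i i<R) (t≡least i i<R)))

        X≡u : ∀ r → r < R → ∀ k → k < q → X r (suc k) ≡ Least.u r k
        X≡u r r<R k k<q = trans (sym (m+n∸m≡n (P r k) _)) (cong₂ _∸_
          (trans (P≡step (suc r) r<R k k<q) (cong (λ c → step c k) (cnt≡cnt (suc r) r<R)))
          (trans (P≡step r (<⇒≤ r<R) k k<q) (cong (λ c → step c k) (cnt≡cnt r (<⇒≤ r<R)))))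

        reglue : ∀ r → r < R → ∀ k → X r k ≡ Least.gluing tail r k
        reglue r r<R zero = t≡least r r<R
        reglue r r<R (suc k) with k <? q
        ... | yes k<q = trans (X≡u r r<R k k<q) (sym (splice-< q k k<q))
        ... | no  k≮q = subst (λ x → X r (suc x) ≡ splice q (Least.u r) (ent tail r) x) (m+[n∸m]≡n (≮⇒≥ k≮q))
          (sym (trans (splice-≥ q (k ∸ q)) (ent-mkMatrix R Y r r<R (Y-supp r) (k ∸ q))))

-- Some picture exists: fill row r with the letter r, and let σ have large steps.
module Spread (R : ℕ) {μ ν : Seq} (skew : IsSkew μ ν) where
  open IsSkew skew

  d σ τ : Seq
  d r = ν r ∸ μ r
  -- No row is longer than ν 0, so steps of this size absorb any row content in the lattice
  -- condition.
  σ k = (R ∸ k) * ν 0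

  X : ℕ → ℕ → ℕ
  X r = unit r (d r)

  τ k = σ k + psum (λ r → X r k) R

  decr-σ : Decr σ
  decr-σ k = *-monoˡ-≤ (ν 0) (∸-monoʳ-≤ R (n≤1+n k))

  supp-σ : Supp R σ
  supp-σ k R≤k = cong (_* ν 0) (m≤n⇒m∸n≡0 R≤k)

  d≤ : ∀ r → d r ≤ ν 0
  d≤ r = ≤-trans (m∸n≤m (ν r) (μ r)) (ν≤ r)
    where
    ν≤ : ∀ r → ν r ≤ ν 0
    ν≤ zero    = ≤-refl
    ν≤ (suc r) = ≤-trans (decr-ν r) (ν≤ r)

  column-≤ : ∀ k r → r ≤ k → psum (λ s → X s k) r ≡ 0
  column-≤ k r r≤k = trans (psum-cong-< r (λ s s<r → unit-≢ s (d s) k (λ { refl → <-irrefl refl (≤-trans s<r r≤k) })))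
      (psum-0 r)

  column≤d : ∀ k r → psum (λ s → X s k) r ≤ d k
  column≤d k zero    = z≤n
  column≤d k (suc r) with r ≟ k
  ... | yes refl = ≤-reflexive (cong₂ _+_ (column-≤ r r ≤-refl) (unit-≡ r (d r)))
  ... | no  r≢k  = subst (_≤ d k)
      (sym (trans (cong (psum (λ s → X s k) r +_) (unit-≢ r (d r) k r≢k)) (+-identityʳ _))) (column≤d k r)

  σ-step : ∀ k r → r ≤ R → σ (suc k) + psum (λ s → X s (suc k)) r ≤ σ k
  σ-step k r r≤R with suc k <? R
  ... | yes k<R = begin
    σ (suc k) + psum (λ s → X s (suc k)) r ≤⟨ +-monoʳ-≤ (σ (suc k)) (≤-trans (column≤d (suc k) r) (d≤ (suc k))) ⟩
    σ (suc k) + ν 0                        ≡⟨ +-comm (σ (suc k)) (ν 0) ⟩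
    suc (R ∸ suc k) * ν 0                  ≡⟨ cong (_* ν 0) (+-∸-assoc 1 (<⇒≤ k<R)) ⟨
    σ k                                    ∎
    where open ≤-Reasoning
  ... | no  k≮R = subst (_≤ σ k) (sym
      (trans (cong (σ (suc k) +_) (column-≤ (suc k) r (≤-trans r≤R (≮⇒≥ k≮R)))) (+-identityʳ _))) (decr-σ k)

  decr-τ : Decr τ
  decr-τ k = m≤n⇒m≤n+o _ (σ-step k R ≤-refl)

  supp-τ : Supp R τ
  supp-τ k R≤k = cong₂ _+_ (supp-σ k R≤k) (column-≤ k R R≤k)

  supp-X : ∀ r → r < R → Supp R (X r)
  supp-X r r<R k R≤k = unit-≢ r (d r) k (λ { refl → <-irrefl refl (≤-trans r<R R≤k) })

  tableau : IsTableau R R μ ν σ X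
  tableau = record
    { rowsum   = λ r r<R → trans (cong (μ r +_) (psum-unit-> r (d r) R r<R)) (m+[n∸m]≡n (μ≤ν r))
    ; lattice′ = λ r r<R k → m≤n⇒m≤n+o _ (σ-step k (suc r) r<R)
    ; columns  = λ r _ k → columns r k }
    where
    columns : ∀ r k → μ (suc r) + psum (X (suc r)) (suc k) ≤ μ r + psum (X r) k
    columns r k with r <? k
    ... | yes r<k = subst₂ _≤_
      (sym (trans (cong (μ (suc r) +_) (psum-unit-> (suc r) (d (suc r)) (suc k) (s≤s r<k)))
          (m+[n∸m]≡n (μ≤ν (suc r)))))
      (sym (trans (cong (μ r +_) (psum-unit-> r (d r) k r<k)) (m+[n∸m]≡n (μ≤ν r)))) (decr-ν r)
    ... | no  r≮k = subst (_≤ μ r + psum (X r) k)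
      (sym (trans (cong (μ (suc r) +_) (psum-unit-≤ (suc r) (d (suc r)) (suc k) (s≤s (≮⇒≥ r≮k)))) (+-identityʳ _)))
      (m≤n⇒m≤n+o _ (decr-μ r))

  picture : IsPicture μ ν σ τ (mkMatrix {R} R X)
  picture = tableau⇒chain R μ ν σ X supp-X tableau , λ k → cong (σ k +_) (colsum-mkMatrix {R = R} X supp-X k)

-- Comparing the northwest ribbons of two shapes

decr-catσ : ∀ {K q σ} → Decr σ → σ 0 ≤ K → Decr (catσ K q σ)
decr-catσ {K} {q} {σ} dσ σ₀≤K = splice-step 1 {λ _ → K + K} {splice q (λ _ → K) σ} (λ { _ (s≤s ()) })
    (λ _ _ → first q)
  (splice-step q {λ _ → K} {σ} (λ _ _ → ≤-refl) (λ _ _ → σ₀≤K) dσ)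
  where
  first : ∀ q → splice q (λ _ → K) σ 0 ≤ K + K
  first zero    = m≤n⇒m≤n+o K σ₀≤K
  first (suc q) = m≤m+n K K

decr-catτ : ∀ {K p q τ} → Decr τ → 1 ≤ K → τ 0 ≤ K → Decr (catτ K p q τ)
decr-catτ {K} {p} {q} {τ} dτ 1≤K τ₀≤K = splice-step 1 {λ _ → K + K + p} {splice q (λ _ → suc K) τ} (λ { _ (s≤s ()) })
  (λ _ _ → m≤n⇒m≤n+o p (first q))
  (splice-step q {λ _ → suc K} {τ} (λ _ _ → ≤-refl) (λ _ _ → m≤n⇒m≤1+n τ₀≤K) dτ)
  where
  first : ∀ q → splice q (λ _ → suc K) τ 0 ≤ K + K
  first zero    = m≤n⇒m≤n+o K τ₀≤K
  first (suc q) = +-monoˡ-≤ K 1≤K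

SamePictures : (R : ℕ) (μ ν : Seq) (R′ : ℕ) (μ′ ν′ : Seq) → Set
SamePictures R μ ν R′ μ′ ν′ = ∀ n τ → Decr τ → Supp n τ →
  Pictures {n} R μ ν (λ _ → 0) τ ↔ Pictures {n} R′ μ′ ν′ (λ _ → 0) τ

module _ {R : ℕ} {μ ν : Seq} (skew : IsSkew μ ν) {K p q m : ℕ} {σ τ : Seq} where

  private
    Pics : Set
    Pics = Pictures {suc q + m} R μ ν (catσ K q σ) (catτ K p q τ)

  picture⇒size : Pics → p + q ≤ psum (len μ ν) R
  picture⇒size (bs ,ʳ [ pic ]) = recompute (p + q ≤? psum (len μ ν) R)
      (Forward.p+q≤size skew {K} {p} {q} {m} {σ} {τ} bs pic)

  picture⇒least : Pics → psum (len μ ν) R ≤ p + q → psum (least μ ν) R ≤ p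
  picture⇒least (bs ,ʳ [ pic ]) h = recompute (psum (least μ ν) R ≤? p)
      (Forward.Maximal.least≤p skew {K} {p} {q} {m} {σ} {τ} bs pic h)

  picture⇒most : Pics → psum (len μ ν) R ≤ p + q → p ≤ psum (most μ ν) R
  picture⇒most (bs ,ʳ [ pic ]) h = recompute (p ≤? psum (most μ ν) R)
      (Forward.Maximal.p≤most skew {K} {p} {q} {m} {σ} {τ} bs pic h)

module Compare {R R′ : ℕ} {μ ν μ′ ν′ : Seq} (skew : IsSkew μ ν) (skew′ : IsSkew μ′ ν′)
  (same : SamePictures R μ ν R′ μ′ ν′) where

  same-cat : ∀ {K p q m σ τ} → Decr σ → Supp m σ → Decr τ → Supp m τ → σ 0 ≤ K → τ 0 ≤ K → 1 ≤ K →
    Pictures {suc q + m} R μ ν (catσ K q σ) (catτ K p q τ) ↔ Pictures {suc q + m} R′ μ′ ν′ (catσ K q σ) (catτ K p q τ)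
  same-cat {K} {p} {q} {m} {σ} {τ} dσ sσ dτ sτ σ₀≤K τ₀≤K 1≤K = Transfer.transfer (same (suc q + m))
    (catσ K q σ) (decr-catσ {K} {q} dσ σ₀≤K) (splice-supp 1 {λ _ → K + K} (splice-supp q {λ _ → K} sσ))
    (catτ K p q τ) (decr-catτ {K} {p} {q} dτ 1≤K τ₀≤K)
        (splice-supp 1 {λ _ → K + K + p} (splice-supp q {λ _ → suc K} sτ))

  module _ (t : Seq) (least≤t : ∀ r → least μ ν r ≤ t r) (t≤most : ∀ r → t r ≤ most μ ν r) where

    private
      module S = Spread R (shrink-skew skew)
      module B = Backward {R} skew t least≤t t≤most
      -- Both positive and at least τ 0.
      K = suc (S.τ 0)
      -- Extending the filling of the ribbon by a `Spread` picture of the rest shows that the first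
      -- shape has a picture with these p and q; transfer then gives one for the second shape, where
      -- the bounds of `Forward` apply.
      witness : Pictures {suc B.q + R} R′ μ′ ν′ (catσ K B.q S.σ) (catτ K B.p B.q S.τ)
      witness = Inverse.to (same-cat {K} {B.p} S.decr-σ S.supp-σ S.decr-τ S.supp-τ (m≤n⇒m≤1+n (m≤m+n _ _)) (n≤1+n _)
          z<s)
        (_ ,ʳ [ B.glued-picture {K} z<s (n≤1+n _) (mkMatrix R S.X) S.picture ])

    size≤ : psum (len μ ν) R ≤ psum (len μ′ ν′) R′
    size≤ = subst (_≤ psum (len μ′ ν′) R′) B.p+q≡size (picture⇒size skew′ {K} {B.p} {B.q} {R} {S.σ} {S.τ} witness)

    private
      maximal : psum (len μ′ ν′) R′ ≤ psum (len μ ν) R → psum (len μ′ ν′) R′ ≤ B.p + B.q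
      maximal h = ≤-trans h (≤-reflexive (sym B.p+q≡size))

    least≤ : psum (len μ′ ν′) R′ ≤ psum (len μ ν) R → psum (least μ′ ν′) R′ ≤ psum t R
    least≤ h = picture⇒least skew′ {K} {B.p} {B.q} {R} {S.σ} {S.τ} witness (maximal h)

    ≤most : psum (len μ′ ν′) R′ ≤ psum (len μ ν) R → psum t R ≤ psum (most μ′ ν′) R′
    ≤most h = picture⇒most skew′ {K} {B.p} {B.q} {R} {S.σ} {S.τ} witness (maximal h)

module _ {R R′ : ℕ} {μ ν μ′ ν′ : Seq} (skew : IsSkew μ ν) (skew′ : IsSkew μ′ ν′)
  (same : SamePictures R μ ν R′ μ′ ν′) where

  private
    same′ : SamePictures R′ μ′ ν′ R μ ν
    same′ n τ dτ sτ = ↔-sym (same n τ dτ sτ)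
    module C  = Compare skew skew′ same
    module C′ = Compare skew′ skew same′

  size-≡ : psum (len μ ν) R ≡ psum (len μ′ ν′) R′
  size-≡ = ≤-antisym (C.size≤ (least μ ν) (λ _ → ≤-refl) (least≤most μ ν))
      (C′.size≤ (least μ′ ν′) (λ _ → ≤-refl) (least≤most μ′ ν′))

  least-≡ : psum (least μ ν) R ≡ psum (least μ′ ν′) R′
  least-≡ = ≤-antisym (C′.least≤ (least μ′ ν′) (λ _ → ≤-refl) (least≤most μ′ ν′) (≤-reflexive size-≡))
                      (C.least≤ (least μ ν) (λ _ → ≤-refl) (least≤most μ ν) (≤-reflexive (sym size-≡)))

  most-≡ : psum (most μ ν) R ≡ psum (most μ′ ν′) R′
  most-≡ = ≤-antisym (C.≤most (most μ ν) (least≤most μ ν) (λ _ → ≤-refl) (≤-reflexive (sym size-≡)))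
                     (C′.≤most (most μ′ ν′) (least≤most μ′ ν′) (λ _ → ≤-refl) (≤-reflexive size-≡))

  -- Equal sizes and equal minimal p give equal q, so the same union tests both shapes, and ribbon
  -- removal on either side leaves the straight shape τ.
  same-shrink : SamePictures R (shrink μ ν) ν R′ (shrink μ′ ν′) ν′
  same-shrink n τ dτ sτ =
    ribbon-removal skew′ {K} z<s (n≤1+n _) ↔-∘
    (subst₂ (λ p q → Pictures {suc L.q + n} R μ ν (catσ K L.q (λ _ → 0)) (catτ K L.p L.q τ) ↔ Pictures {suc q + n} R′
        μ′ ν′ (catσ K q (λ _ → 0)) (catτ K p q τ))
      least-≡ q≡ (C.same-cat {K} (λ _ → z≤n) (λ _ _ → refl) dτ sτ z≤n (n≤1+n _) z<s) ↔-∘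
    ↔-sym (ribbon-removal skew {K} z<s (n≤1+n _)))
    where
    K = suc (τ 0)
    module L  = Least {R} skew
    module L′ = Least {R′} skew′
    q≡ : L.q ≡ L′.q
    q≡ = +-cancelˡ-≡ L.p _ _ (trans L.p+q≡size
        (trans size-≡ (trans (sym L′.p+q≡size) (cong (_+ L′.q) (sym least-≡)))))

-- Littlewood–Richardson fillings as pictures

countB-++ : {A : Set} (p : A → Bool) (xs ys : List A) → countB p (xs ++ ys) ≡ countB p xs + countB p ys
countB-++ p xs ys = trans (cong length (filter-++ (T? ∘ p) xs ys)) (length-++ (filterᵇ p xs))

countB-all : {A : Set} (p : A → Bool) {xs : List A} → All (T ∘ p) xs → countB p xs ≡ length xs
countB-all p h = cong length (filter-all (T? ∘ p) h)

countB-none : {A : Set} (p : A → Bool) {xs : List A} → All (¬_ ∘ T ∘ p) xs → countB p xs ≡ 0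
countB-none p h = cong length (filter-none (T? ∘ p) h)

countB≤length : {A : Set} (p : A → Bool) (xs : List A) → countB p xs ≤ length xs
countB≤length p = length-filter (T? ∘ p)

seg : ℕ → ℕ → ℕ → List Box
seg r c zero    = []
seg r c (suc l) = (r , c) ∷ seg r (suc c) l

-- The recursion shifts the sequences, so r₀ keeps the true number of the first row.
boxes : (lo hi : Seq) (r₀ R : ℕ) → List Box
boxes lo hi r₀ zero    = []
boxes lo hi r₀ (suc R) = seg r₀ (lo 0) (hi 0 ∸ lo 0) ++ boxes (lo ∘ suc) (hi ∘ suc) (suc r₀) R

length-seg : ∀ r c l → length (seg r c l) ≡ l
length-seg r c zero    = refl
length-seg r c (suc l) = cong suc (length-seg r (suc c) l)

seg-++ : ∀ r c a b → seg r c (a + b) ≡ seg r c a ++ seg r (c + a) b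
seg-++ r c zero    b = cong (λ x → seg r x b) (sym (+-identityʳ c))
seg-++ r c (suc a) b = cong ((r , c) ∷_)
    (trans (seg-++ r (suc c) a b) (cong (λ x → seg r (suc c) a ++ seg r x b) (sym (+-suc c a))))

∈-seg⁺ : ∀ r c l {x} → c ≤ x → x < c + l → (r , x) ∈ seg r c l
∈-seg⁺ r c zero    c≤x x<  = ⊥-elim (<⇒≱ x< (subst (_≤ _) (sym (+-identityʳ c)) c≤x))
∈-seg⁺ r c (suc l) {x} c≤x x< with m≤n⇒m<n∨m≡n c≤x
... | inj₁ c<x  = there (∈-seg⁺ r (suc c) l c<x (subst (x <_) (+-suc c l) x<))
... | inj₂ refl = here refl

∈-seg⁻ : ∀ r c l {b} → b ∈ seg r c l → row b ≡ r × c ≤ col b × col b < c + l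
∈-seg⁻ r c (suc l) (here refl) = refl , ≤-refl , m<m+n c z<s
∈-seg⁻ r c (suc l) {b} (there h) with ∈-seg⁻ r (suc c) l h
... | e , h₁ , h₂ = e , <⇒≤ h₁ , subst (col b <_) (sym (+-suc c l)) h₂

-- Letters count from 1 in fillings and from 0 in matrices; k is the number of letters already
-- passed.
fillRow : ℕ → ℕ → Seq → List ℕ
fillRow k zero    f = []
fillRow k (suc n) f = replicate (f 0) (suc k) ++ fillRow (suc k) n (f ∘ suc)

word : ∀ {n R} → Matrix {n} R → List ℕ
word []       = []
word {n} (b ∷ bs) = fillRow 0 n (at b) ++ word bs

letters : ℕ → List ℕ → Seq
letters k v i = countB (_≡ᵇ suc (k + i)) v

unword : ∀ {n} → Seq → ∀ R → List ℕ → Matrix {n} R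
unword d zero    w = []
unword {n} d (suc R) w = mk n (letters 0 (take (d 0) w)) ∷ unword (d ∘ suc) R (drop (d 0) w)

length-fillRow : ∀ k n f → length (fillRow k n f) ≡ psum f n
length-fillRow k zero    f = refl
length-fillRow k (suc n) f = trans (length-++ (replicate (f 0) (suc k)))
  (trans (cong₂ _+_ (length-replicate (f 0)) (length-fillRow (suc k) n (f ∘ suc))) (sym (psum-head f n)))

fillRow-cong : ∀ k n {f g : Seq} → (∀ i → i < n → f i ≡ g i) → fillRow k n f ≡ fillRow k n g
fillRow-cong k zero    e = refl
fillRow-cong k (suc n) e = cong₂ (λ x y → replicate x (suc k) ++ y) (e 0 z<s)
    (fillRow-cong (suc k) n (λ i i<n → e (suc i) (s≤s i<n)))

fillRow-range : ∀ k n f → All (λ v → k < v × v ≤ k + n) (fillRow k n f)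
fillRow-range k zero    f = []
fillRow-range k (suc n) f = All-++⁺ (replicate⁺ (f 0) (≤-refl , subst (suc k ≤_) (sym (+-suc k n)) (s≤s (m≤m+n k n))))
  (All.map (λ { {x} (h₁ , h₂) → <⇒≤ h₁ , subst (x ≤_) (sym (+-suc k n)) h₂ }) (fillRow-range (suc k) n (f ∘ suc)))

letters-fillRow : ∀ k n f i → i < n → letters k (fillRow k n f) i ≡ f i
letters-fillRow k (suc n) f zero _ = trans (countB-++ _ (replicate (f 0) (suc k)) _) (trans (cong₂ _+_
  (trans (countB-all _ (replicate⁺ (f 0) (≡⇒≡ᵇ k (k + 0) (sym (+-identityʳ k))))) (length-replicate (f 0)))
  (countB-none _ (All.map (λ { {v} (h , _) e → <⇒≢ h (sym (trans (≡ᵇ⇒≡ v (suc (k + 0)) e) (cong suc (+-identityʳ k))))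
      }) (fillRow-range (suc k) n (f ∘ suc)))))
  (+-identityʳ (f 0)))
letters-fillRow k (suc n) f (suc i) (s≤s i<n) = trans (countB-++ _ (replicate (f 0) (suc k)) _) (cong₂ _+_
  (countB-none _ (replicate⁺ (f 0) (λ e → m≢1+m+n k (trans (≡ᵇ⇒≡ k (k + suc i) e) (+-suc k i)))))
  (trans (cong (λ x → countB (_≡ᵇ suc x) (fillRow (suc k) n (f ∘ suc))) (+-suc k i))
      (letters-fillRow (suc k) n (f ∘ suc) i i<n)))

fillRow-0 : ∀ k n {f : Seq} → (∀ i → i < n → f i ≡ 0) → fillRow k n f ≡ []
fillRow-0 k zero    e = refl
fillRow-0 k (suc n) e = cong₂ (λ x y → replicate x (suc k) ++ y) (e 0 z<s)
    (fillRow-0 (suc k) n (λ i i<n → e (suc i) (s≤s i<n)))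

-- The step for sorted words: as no letter below i occurs, a further copy of i comes to the front.
fillRow-insert : ∀ k n {f g : Seq} i → i < n → (∀ j → j < i → f j ≡ 0) → g i ≡ suc (f i) → (∀ j → j ≢ i → g j ≡ f j) →
  fillRow k n g ≡ suc (k + i) ∷ fillRow k n f
fillRow-insert k (suc n) {f} zero _ e₀ e₁ e₂ = cong₂ _++_
  (trans (cong (λ x → replicate x (suc k)) e₁) (cong (λ x → suc x ∷ replicate (f 0) (suc k)) (sym (+-identityʳ k))))
  (fillRow-cong (suc k) n (λ j _ → e₂ (suc j) (λ ())))
fillRow-insert k (suc n) {f} {g} (suc i) (s≤s i<n) e₀ e₁ e₂
  rewrite trans (e₂ 0 (λ ())) (e₀ 0 z<s) | e₀ 0 z<s =
  trans (fillRow-insert (suc k) n i i<n (λ j j<i → e₀ (suc j) (s≤s j<i)) e₁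
      (λ j j≢i → e₂ (suc j) (j≢i ∘ suc-injective)))
        (cong (λ x → suc x ∷ fillRow (suc k) n (f ∘ suc)) (sym (+-suc k i)))

sorted⇒fillRow : ∀ n v → All (λ x → 0 < x × x ≤ n) v → AllPairs _≤_ v → fillRow 0 n (letters 0 v) ≡ v
sorted⇒fillRow n []          _                        _        = fillRow-0 0 n (λ _ _ → refl)
sorted⇒fillRow n (suc x ∷ v) ((_ , x<n) ∷ range) (x≤v ∷ sorted) = trans
  (fillRow-insert 0 n x x<n
    (λ j j<x → countB-none _ (All.map (λ { {y} h e → <⇒≱ (s≤s j<x) (subst (suc x ≤_) (≡ᵇ⇒≡ y (suc j) e) h) }) x≤v))
    (cong length (filter-accept (T? ∘ (_≡ᵇ suc x)) {suc x} {v} (≡⇒≡ᵇ x x refl)))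
    (λ j j≢x → cong length (filter-reject (T? ∘ (_≡ᵇ suc j)) {suc x} {v} (j≢x ∘ sym ∘ ≡ᵇ⇒≡ x j))))
  (cong (suc x ∷_) (sorted⇒fillRow n v range sorted))

take-++-length : {A : Set} (xs ys : List A) {k : ℕ} → length xs ≡ k → take k (xs ++ ys) ≡ xs
take-++-length []       ys refl = refl
take-++-length (x ∷ xs) ys refl = cong (x ∷_) (take-++-length xs ys refl)

drop-++-length : {A : Set} (xs ys : List A) {k : ℕ} → length xs ≡ k → drop k (xs ++ ys) ≡ ys
drop-++-length []       ys refl = refl
drop-++-length (x ∷ xs) ys refl = drop-++-length xs ys refl

RowSums : ∀ {n R} → (d : Seq) → Matrix {n} R → Set
RowSums d []       = ⊤
RowSums {n} d (b ∷ bs) = psum (at b) n ≡ d 0 × RowSums (d ∘ suc) bs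

unword-word : ∀ {n R} d (bs : Matrix {n} R) → RowSums d bs → unword d R (word bs) ≡ bs
unword-word d [] _ = refl
unword-word {n} d (b ∷ bs) (e , es) = cong₂ _∷_
  (at-ext-< (λ i i<n → trans (at-mk-< n _ i i<n)
      (trans (cong (λ v → letters 0 v i) (take-++-length (fillRow 0 n (at b)) (word bs) len≡))
      (letters-fillRow 0 n (at b) i i<n))))
  (trans (cong (unword (d ∘ suc) _) (drop-++-length (fillRow 0 n (at b)) (word bs) len≡))
      (unword-word (d ∘ suc) bs es))
  where
  len≡ : length (fillRow 0 n (at b)) ≡ d 0
  len≡ = trans (length-fillRow 0 n (at b)) e

words≡ : ∀ L m → words (suc L) m ≡ cartesianProductWith _∷_ (map suc (upTo m)) (words L m)
words≡ L m = go (map suc (upTo m))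
  where
  go : ∀ xs → concatMap (λ v → map (v ∷_) (words L m)) xs ≡ cartesianProductWith _∷_ xs (words L m)
  go []       = refl
  go (x ∷ xs) = cong (map (x ∷_) (words L m) ++_) (go xs)

words-unique : ∀ L m → Unique (words L m)
words-unique zero    m = [] ∷ []
words-unique (suc L) m = subst Unique (sym (words≡ L m))
  (cartesianProductWith⁺ _∷_ ∷-injective (Unique-map⁺ suc-injective (upTo⁺ m)) (words-unique L m))

∈-words⁺ : ∀ {m} w → All (λ x → 0 < x × x ≤ m) w → w ∈ words (length w) m
∈-words⁺ []          []                = here refl
∈-words⁺ {m} (suc x ∷ w) ((_ , x<m) ∷ range) = subst (suc x ∷ w ∈_) (sym (words≡ (length w) m))
  (∈-cartesianProductWith⁺ _∷_ (∈-map⁺ suc (∈-upTo⁺ x<m)) (∈-words⁺ w range))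

∈-words⁻ : ∀ L m {w} → w ∈ words L m → length w ≡ L × All (λ x → 0 < x × x ≤ m) w
∈-words⁻ zero    m (here refl) = refl , []
∈-words⁻ (suc L) m {w} h with ∈-cartesianProductWith⁻ _∷_ (map suc (upTo m)) (words L m) (subst (w ∈_) (words≡ L m) h)
... | x , v , x∈ , v∈ , refl with ∈-map⁻ suc x∈ | ∈-words⁻ L m v∈
...   | y , y∈ , refl | e , range = cong suc e , (z<s , ∈-upTo⁻ y∈) ∷ range

zip-++ : {A B : Set} (xs : List A) (ys : List B) {us : List A} {vs : List B} → length xs ≡ length ys →
  zip (xs ++ us) (ys ++ vs) ≡ zip xs ys ++ zip us vs
zip-++ []       []       e = refl
zip-++ (x ∷ xs) (y ∷ ys) e = cong ((x , y) ∷_) (zip-++ xs ys (suc-injective e))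

zip-replicate : {A B : Set} (xs : List A) (y : B) {l : ℕ} → length xs ≡ l → zip xs (replicate l y) ≡ map (_, y) xs
zip-replicate []       y refl = refl
zip-replicate (x ∷ xs) y refl = cong ((x , y) ∷_) (zip-replicate xs y refl)

cellsRow : ℕ → ℕ → ℕ → ℕ → Seq → Filling
cellsRow r c k zero    f = []
cellsRow r c k (suc n) f = map (_, suc k) (seg r c (f 0)) ++ cellsRow r (c + f 0) (suc k) n (f ∘ suc)

cells : ∀ {n R} → Seq → ℕ → Matrix {n} R → Filling
cells μ r₀ []       = []
cells {n} μ r₀ (b ∷ bs) = cellsRow r₀ (μ 0) 0 n (at b) ++ cells (μ ∘ suc) (suc r₀) bs

zip-cellsRow : ∀ r c k n f → zip (seg r c (psum f n)) (fillRow k n f) ≡ cellsRow r c k n f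
zip-cellsRow r c k zero    f = refl
zip-cellsRow r c k (suc n) f = begin
  zip (seg r c (psum f (suc n))) (fillRow k (suc n) f)                          ≡⟨ cong
      (λ s → zip s (fillRow k (suc n) f)) (trans (cong (seg r c) (psum-head f n)) (seg-++ r c (f 0) _)) ⟩
  zip (seg r c (f 0) ++ seg r (c + f 0) (psum (f ∘ suc) n)) (fillRow k (suc n) f) ≡⟨ zip-++ (seg r c (f 0))
      (replicate (f 0) (suc k)) (trans (length-seg r c (f 0)) (sym (length-replicate (f 0)))) ⟩
  zip (seg r c (f 0)) (replicate (f 0) (suc k)) ++ zip (seg r (c + f 0) (psum (f ∘ suc) n))
      (fillRow (suc k) n (f ∘ suc))
    ≡⟨ cong₂ _++_ (zip-replicate (seg r c (f 0)) (suc k) (length-seg r c (f 0)))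
        (zip-cellsRow r (c + f 0) (suc k) n (f ∘ suc)) ⟩
  cellsRow r c k (suc n) f ∎
  where open ≡-Reasoning

zip-cells : ∀ {n R} (μ ν : Seq) r₀ (bs : Matrix {n} R) → RowSums (λ r → ν r ∸ μ r) bs → zip (boxes μ ν r₀ R) (word bs)
    ≡ cells μ r₀ bs
zip-cells μ ν r₀ [] _ = refl
zip-cells {n} μ ν r₀ (b ∷ bs) (e , es) = trans
  (zip-++ (seg r₀ (μ 0) (ν 0 ∸ μ 0)) (fillRow 0 n (at b))
      (trans (length-seg r₀ (μ 0) _) (trans (sym e) (sym (length-fillRow 0 n (at b))))))
  (cong₂ _++_ (trans (cong (λ l → zip (seg r₀ (μ 0) l) (fillRow 0 n (at b))) (sym e))
      (zip-cellsRow r₀ (μ 0) 0 n (at b)))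
    (zip-cells (μ ∘ suc) (ν ∘ suc) (suc r₀) bs es))

-- A letter occupies an interval of columns bounded by consecutive partial sums; this turns
-- conditions on boxes into inequalities between partial sums.
∈-cellsRow⁺ : ∀ r c k n f j {x} → j < n → c + psum f j ≤ x → x < c + psum f (suc j) → ((r , x) , suc (k + j)) ∈
    cellsRow r c k n f
∈-cellsRow⁺ r c k (suc n) f zero {x} _ h₁ h₂ = ∈-++⁺ˡ
  (subst (λ v → ((r , x) , suc v) ∈ map (_, suc k) (seg r c (f 0))) (sym (+-identityʳ k))
      (∈-map⁺ (_, suc k) (∈-seg⁺ r c (f 0) (subst (_≤ x) (+-identityʳ c) h₁) h₂)))
∈-cellsRow⁺ r c k (suc n) f (suc j) {x} (s≤s j<n) h₁ h₂ = ∈-++⁺ʳ (map (_, suc k) (seg r c (f 0)))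
  (subst (λ v → ((r , x) , suc v) ∈ cellsRow r (c + f 0) (suc k) n (f ∘ suc)) (sym (+-suc k j))
    (∈-cellsRow⁺ r (c + f 0) (suc k) n (f ∘ suc) j j<n (subst (_≤ x) (shift j) h₁) (subst (x <_) (shift (suc j)) h₂)))
  where
  shift : ∀ j → c + psum f (suc j) ≡ c + f 0 + psum (f ∘ suc) j
  shift j = trans (cong (c +_) (psum-head f j)) (sym (+-assoc c (f 0) _))

∈-cellsRow⁻ : ∀ r c k n f {p} → p ∈ cellsRow r c k n f →
  ∃ λ j → ∃ λ x → p ≡ ((r , x) , suc (k + j)) × j < n × c + psum f j ≤ x × x < c + psum f (suc j)
∈-cellsRow⁻ r c k (suc n) f {p} p∈ with ∈-++⁻ (map (_, suc k) (seg r c (f 0))) p∈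
... | inj₁ h with ∈-map⁻ (_, suc k) h
...   | (r′ , x) , b∈ , refl with ∈-seg⁻ r c (f 0) b∈
...     | refl , h₁ , h₂ = 0 , x , cong (λ v → (r , x) , suc v) (sym (+-identityʳ k)) , z<s , subst (_≤ x)
    (sym (+-identityʳ c)) h₁ , h₂
∈-cellsRow⁻ r c k (suc n) f {p} p∈ | inj₂ h with ∈-cellsRow⁻ r (c + f 0) (suc k) n (f ∘ suc) h
... | j , x , refl , j<n , h₁ , h₂ = suc j , x , cong (λ v → (r , x) , suc v) (sym (+-suc k j)) , s≤s j<n ,
  subst (_≤ x) (shift j) h₁ , subst (x <_) (shift (suc j)) h₂
  where
  shift : ∀ j → c + f 0 + psum (f ∘ suc) j ≡ c + psum f (suc j)
  shift j = trans (+-assoc c (f 0) _) (cong (c +_) (sym (psum-head f j)))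

∈-cells⁺ : ∀ {n R} (μ : Seq) r₀ (bs : Matrix {n} R) i k {x} → i < R → k < n →
  μ i + psum (ent bs i) k ≤ x → x < μ i + psum (ent bs i) (suc k) → ((r₀ + i , x) , suc k) ∈ cells μ r₀ bs
∈-cells⁺ {n} μ r₀ (b ∷ bs) zero k {x} _ k<n h₁ h₂ = ∈-++⁺ˡ
  (subst (λ r → ((r , x) , suc k) ∈ cellsRow r₀ (μ 0) 0 n (at b)) (sym (+-identityʳ r₀))
      (∈-cellsRow⁺ r₀ (μ 0) 0 n (at b) k k<n h₁ h₂))
∈-cells⁺ {n} μ r₀ (b ∷ bs) (suc i) k {x} (s≤s i<R) k<n h₁ h₂ = ∈-++⁺ʳ (cellsRow r₀ (μ 0) 0 n (at b))
  (subst (λ r → ((r , x) , suc k) ∈ cells (μ ∘ suc) (suc r₀) bs) (sym (+-suc r₀ i))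
      (∈-cells⁺ (μ ∘ suc) (suc r₀) bs i k i<R k<n h₁ h₂))

∈-cells⁻ : ∀ {n R} (μ : Seq) r₀ (bs : Matrix {n} R) {p} → p ∈ cells μ r₀ bs →
  ∃ λ i → ∃ λ k → ∃ λ x → p ≡ ((r₀ + i , x) , suc k) × i < R × k < n × μ i + psum (ent bs i) k ≤ x × x < μ i + psum
      (ent bs i) (suc k)
∈-cells⁻ {n} μ r₀ (b ∷ bs) p∈ with ∈-++⁻ (cellsRow r₀ (μ 0) 0 n (at b)) p∈
... | inj₁ h with ∈-cellsRow⁻ r₀ (μ 0) 0 n (at b) h
...   | k , x , refl , k<n , h₁ , h₂ = 0 , k , x , cong (λ r → (r , x) , suc k) (sym (+-identityʳ r₀)) , z<s , k<n ,
    h₁ , h₂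
∈-cells⁻ {n} μ r₀ (b ∷ bs) p∈ | inj₂ h with ∈-cells⁻ (μ ∘ suc) (suc r₀) bs h
... | i , k , x , refl , i<R , k<n , h₁ , h₂ = suc i , k , x , cong (λ r → (r , x) , suc k) (sym (+-suc r₀ i)) , s≤s
    i<R , k<n , h₁ , h₂

cellsRow-values : ∀ r c k n f → All (λ q → k < proj₂ q) (cellsRow r c k n f)
cellsRow-values r c k n f = All.tabulate (λ q∈ → value> (∈-cellsRow⁻ r c k n f q∈))
  where
  value> : ∀ {q} → (∃ λ j → ∃ λ x → q ≡ ((r , x) , suc (k + j)) × j < n × c + psum f j ≤ x × x < c + psum f (suc j)) →
      k < proj₂ q
  value> (j , _ , refl , _) = s≤s (m≤m+n k j)

-- The conditions on fillings in terms of multiplicities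

indicator : Bool → ℕ
indicator true  = 1
indicator false = 0

countB-∷ : {A : Set} (p : A → Bool) (x : A) (xs : List A) → countB p (x ∷ xs) ≡ indicator (p x) + countB p xs
countB-∷ p x xs with p x
... | true  = refl
... | false = refl

module _ (B : Box → Bool) where

  -- Shaped like the counts in `lattice`, where B is `readBefore`; with B constantly true it also
  -- gives the content.
  marked : ℕ → Box × ℕ → Bool
  marked k q = B (proj₁ q) ∧ (proj₂ q ≡ᵇ suc k)

  count-block : ∀ k xs → countB (marked k) (map (_, suc k) xs) ≡ countB B xs
  count-block k [] = refl
  count-block k (b ∷ xs) = trans (countB-∷ (marked k) (b , suc k) (map (_, suc k) xs)) (trans
    (cong₂ (λ x y → indicator x + y) (trans (cong (B b ∧_) (Equivalence.to T-≡ (≡⇒≡ᵇ k k refl))) (∧-identityʳ (B b)))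
        (count-block k xs))
    (sym (countB-∷ B b xs)))

  value-of-marked : ∀ k q → T (marked k q) → proj₂ q ≡ suc k
  value-of-marked k q h = ≡ᵇ⇒≡ (proj₂ q) (suc k) (proj₂ (Equivalence.to (T-∧ {B (proj₁ q)}) h))

  count-cellsRow : ∀ r c k₀ n f k → Supp n f → countB (marked (k₀ + k)) (cellsRow r c k₀ n f) ≡ countB B
      (seg r (c + psum f k) (f k))
  count-cellsRow r c k₀ zero    f k    s = cong (λ l → countB B (seg r (c + psum f k) l)) (sym (s k z≤n))
  count-cellsRow r c k₀ (suc n) f zero s = trans (countB-++ _ (map (_, suc k₀) (seg r c (f 0))) _) (trans (cong₂ _+_
    (trans (cong (λ x → countB (marked x) (map (_, suc k₀) (seg r c (f 0)))) (+-identityʳ k₀))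
        (trans (count-block k₀ (seg r c (f 0))) (cong (λ x → countB B (seg r x (f 0))) (sym (+-identityʳ c)))))
    (countB-none _ (All.map (λ {q} h m → <⇒≢ h
        (sym (trans (value-of-marked (k₀ + 0) q m) (cong suc (+-identityʳ k₀)))))
        (cellsRow-values r (c + f 0) (suc k₀) n (f ∘ suc)))))
    (+-identityʳ _))
  count-cellsRow r c k₀ (suc n) f (suc k) s = trans (countB-++ _ (map (_, suc k₀) (seg r c (f 0))) _) (cong₂ _+_
    (countB-none _ (All.tabulate (λ q∈ m → absurd q∈ m)))
    (trans (cong (λ x → countB (marked x) (cellsRow r (c + f 0) (suc k₀) n (f ∘ suc))) (+-suc k₀ k))
      (trans (count-cellsRow r (c + f 0) (suc k₀) n (f ∘ suc) k (λ i h → s (suc i) (s≤s h)))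
        (cong (λ x → countB B (seg r x (f (suc k))))
            (trans (+-assoc c (f 0) _) (cong (c +_) (sym (psum-head f k))))))))
    where
    absurd : ∀ {q} → q ∈ map (_, suc k₀) (seg r c (f 0)) → ¬ T (marked (k₀ + suc k) q)
    absurd {q} q∈ m with ∈-map⁻ (_, suc k₀) q∈
    ... | _ , _ , refl = m≢1+m+n k₀ (trans (suc-injective (value-of-marked (k₀ + suc k) q m)) (+-suc k₀ k))

  count-cells : ∀ {n R} (μ : Seq) r₀ (bs : Matrix {n} R) k →
    countB (marked k) (cells μ r₀ bs) ≡ psum (λ i → countB B (seg (r₀ + i) (μ i + psum (ent bs i) k) (ent bs i k))) R
  count-cells μ r₀ [] k = refl
  count-cells {n} {suc R} μ r₀ (b ∷ bs) k = trans (countB-++ _ (cellsRow r₀ (μ 0) 0 n (at b)) _) (trans (cong₂ _+_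
    (trans (count-cellsRow r₀ (μ 0) 0 n (at b) k (at-supp b))
        (cong (λ r → countB B (seg r (μ 0 + psum (at b) k) (at b k))) (sym (+-identityʳ r₀))))
    (trans (count-cells (μ ∘ suc) (suc r₀) bs k)
        (psum-cong (λ i → cong (λ r → countB B (seg r (μ (suc i) + psum (ent bs i) k) (ent bs i k)))
        (sym (+-suc r₀ i))) R)))
    (sym (psum-head (λ i → countB B (seg (r₀ + i) (μ i + psum (ent (b ∷ bs) i) k) (ent (b ∷ bs) i k))) R)))

if⁻ : ∀ {x y} → T (if x then y else true) → T x → T y
if⁻ {true} h _ = h

if⁺ : ∀ {x y} → (T x → T y) → T (if x then y else true)
if⁺ {true}  h = h tt
if⁺ {false} h = tt

locate : ∀ c (f : Seq) n {x} → c ≤ x → x < c + psum f n → ∃ λ k → k < n × c + psum f k ≤ x × x < c + psum f (suc k)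
locate c f zero    c≤x x< = ⊥-elim (<⇒≱ x< (subst (_≤ _) (sym (+-identityʳ c)) c≤x))
locate c f (suc n) {x} c≤x x< with x <? c + psum f n
... | yes h with locate c f n c≤x h
...   | k , k<n , h₁ , h₂ = k , m≤n⇒m≤1+n k<n , h₁ , h₂
locate c f (suc n) {x} c≤x x< | no h = n , ≤-refl , ≮⇒≥ h , x<

psum≤total : ∀ {f n} → Supp n f → ∀ k → psum f k ≤ psum f n
psum≤total {f} {n} s k with ≤-total k n
... | inj₁ k≤n = psum-mono f k≤n
... | inj₂ n≤k = ≤-reflexive (psum-supp s k n≤k)

RowWeak ColumnStrict : Filling → Set
RowWeak F      = ∀ {p q} → p ∈ F → q ∈ F → row (proj₁ p) ≡ row (proj₁ q) → col (proj₁ p) < col (proj₁ q) → proj₂ p ≤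
    proj₂ q
ColumnStrict F = ∀ {p q} → p ∈ F → q ∈ F → col (proj₁ p) ≡ col (proj₁ q) → row (proj₁ p) < row (proj₁ q) → proj₂ p <
    proj₂ q

all-∈⁻ : {A : Set} (p : A → Bool) (xs : List A) → T (all p xs) → ∀ {x} → x ∈ xs → T (p x)
all-∈⁻ p xs h = All.lookup (all⁺ p xs h)

all-∈⁺ : {A : Set} (p : A → Bool) {xs : List A} → (∀ {x} → x ∈ xs → T (p x)) → T (all p xs)
all-∈⁺ p h = all⁻ p (All.tabulate h)

rowWeak⁻ : ∀ F → T (rowWeak F) → RowWeak F
rowWeak⁻ F h {p} {q} p∈ q∈ e lt = ≤ᵇ⇒≤ (proj₂ p) (proj₂ q) (if⁻ (all-∈⁻ _ F (all-∈⁻ _ F h p∈) q∈)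
  (Equivalence.from T-∧ (≡⇒≡ᵇ (row (proj₁ p)) (row (proj₁ q)) e , <⇒<ᵇ lt)))

rowWeak⁺ : ∀ F → RowWeak F → T (rowWeak F)
rowWeak⁺ F h = all-∈⁺ _ (λ {p} p∈ → all-∈⁺ _ (λ {q} q∈ → if⁺ (λ t → let t₁ , t₂ = Equivalence.to (T-∧ {row (proj₁ p) ≡ᵇ row (proj₁ q)}) t in
  ≤⇒≤ᵇ (h p∈ q∈ (≡ᵇ⇒≡ _ _ t₁) (<ᵇ⇒< _ _ t₂)))))

colStrict⁻ : ∀ F → T (colStrict F) → ColumnStrict F
colStrict⁻ F h {p} {q} p∈ q∈ e lt = <ᵇ⇒< (proj₂ p) (proj₂ q) (if⁻ (all-∈⁻ _ F (all-∈⁻ _ F h p∈) q∈)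
  (Equivalence.from T-∧ (≡⇒≡ᵇ (col (proj₁ p)) (col (proj₁ q)) e , <⇒<ᵇ lt)))

colStrict⁺ : ∀ F → ColumnStrict F → T (colStrict F)
colStrict⁺ F h = all-∈⁺ _ (λ {p} p∈ → all-∈⁺ _ (λ {q} q∈ → if⁺ (λ t → let t₁ , t₂ = Equivalence.to (T-∧ {col (proj₁ p) ≡ᵇ col (proj₁ q)}) t in
  <⇒<ᵇ (h p∈ q∈ (≡ᵇ⇒≡ _ _ t₁) (<ᵇ⇒< _ _ t₂)))))

Lattice : ℕ → Filling → Set
Lattice n F = ∀ {p} → p ∈ F → ∀ k → k < n →
  countB (marked (λ b → readBefore b (proj₁ p)) (suc k)) F ≤ countB (marked (λ b → readBefore b (proj₁ p)) k) F

lattice⁻ : ∀ n F → T (lattice n F) → Lattice n F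
lattice⁻ n F h p∈ k k<n = ≤ᵇ⇒≤ _ _ (all-∈⁻ _ (upTo n) (all-∈⁻ _ F h p∈) (∈-upTo⁺ k<n))

lattice⁺ : ∀ n F → Lattice n F → T (lattice n F)
lattice⁺ n F h = all-∈⁺ _ (λ p∈ → all-∈⁺ _ (λ {k} k∈ → ≤⇒≤ᵇ (h p∈ k (∈-upTo⁻ k∈))))

module _ {n R : ℕ} (μ : Seq) (bs : Matrix {n} R) where

  private
    X = ent bs
    F = cells μ 0 bs
    St : ℕ → ℕ → ℕ
    St i k = μ i + psum (X i) k

    St-mono : ∀ i {k l} → k ≤ l → St i k ≤ St i l
    St-mono i k≤l = +-monoʳ-≤ (μ i) (psum-mono (X i) k≤l)

    letter< : ∀ {i k l x} → St i k ≤ x → x < St i l → k < l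
    letter< {i} {k} {l} h₁ h₂ = ≰⇒> (λ l≤k → <⇒≱ h₂ (≤-trans (St-mono i l≤k) h₁))

    read : Box → Box → Bool
    read p b = readBefore b p

    read-above : ∀ {r c i x} → i < r → T (read (r , c) (i , x))
    read-above {r} {c} {i} {x} h = Equivalence.from (T-∨ {i <ᵇ r}) (inj₁ (<⇒<ᵇ h))

    read-row : ∀ {r c x} → c ≤ x → T (read (r , c) (r , x))
    read-row {r} {c} {x} h = Equivalence.from (T-∨ {r <ᵇ r}) (inj₂ (Equivalence.from T-∧ (≡⇒≡ᵇ r r refl , ≤⇒≤ᵇ h)))

    ¬read : ∀ {r c i x} → r ≤ i → (i ≡ r → x < c) → ¬ T (read (r , c) (i , x))
    ¬read {r} {c} {i} {x} h h′ t with Equivalence.to (T-∨ {i <ᵇ r}) t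
    ... | inj₁ t₁ = <⇒≱ (<ᵇ⇒< i r t₁) h
    ... | inj₂ t₂ with Equivalence.to (T-∧ {i ≡ᵇ r}) t₂
    ...   | t₃ , t₄ = <⇒≱ (h′ (≡ᵇ⇒≡ i r t₃)) (≤ᵇ⇒≤ c x t₄)

    count : ℕ → ℕ → ℕ → Seq
    count r c k i = countB (read (r , c)) (seg i (St i k) (X i k))

    count-above : ∀ r c k i → i < r → count r c k i ≡ X i k
    count-above r c k i i<r = trans
        (countB-all _ (All.tabulate (λ {b} b∈ → subst (λ j → T (read (r , c) (j , col b)))
        (sym (proj₁ (∈-seg⁻ i (St i k) (X i k) b∈))) (read-above {r} {c} {i} {col b} i<r))))
      (length-seg i (St i k) (X i k))

    count-below : ∀ r c k i → r < i → count r c k i ≡ 0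
    count-below r c k i r<i = countB-none _ (All.tabulate (λ {b} b∈ t → let e = proj₁ (∈-seg⁻ i (St i k) (X i k) b∈) in
      ¬read {r} {c} {row b} {col b} (<⇒≤ (subst (r <_) (sym e) r<i)) (λ e′ → ⊥-elim (<⇒≢ r<i (trans (sym e′) e))) t))

    count-before : ∀ r c k → c ≤ St r k → count r c k r ≡ X r k
    count-before r c k h = trans (countB-all _ (All.tabulate (λ {b} b∈ → let e , h₁ , _ = ∈-seg⁻ r (St r k) (X r k) b∈ in
      subst (λ j → T (read (r , c) (j , col b))) (sym e) (read-row {r} {c} {col b} (≤-trans h h₁)))))
          (length-seg r (St r k) (X r k))

    count-after : ∀ r c k → St r (suc k) ≤ c → count r c k r ≡ 0
    count-after r c k h = countB-none _ (All.tabulate (λ {b} b∈ → let e , _ , h₂ = ∈-seg⁻ r (St r k) (X r k) b∈ in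
      ¬read {r} {c} {row b} {col b} (≤-reflexive (sym e))
          (λ _ → ≤-trans h₂ (≤-trans (≤-reflexive (+-assoc (μ r) _ _)) h))))

    count-row≤ : ∀ r c k → count r c k r ≤ X r k
    count-row≤ r c k = ≤-trans (countB≤length _ (seg r (St r k) (X r k)))
        (≤-reflexive (length-seg r (St r k) (X r k)))

    total : ∀ r c k → r < R → countB (marked (read (r , c)) k) F ≡ psum (λ s → X s k) r + count r c k r
    total r c k r<R = trans (count-cells (read (r , c)) μ 0 bs k)
      (trans (psum-supp (λ i → count-below r c k i) R r<R)
          (cong (_+ count r c k r) (psum-cong-< r (λ i i<r → count-above r c k i i<r))))

  -- The prefix of the reading word ending at the leftmost k + 1 of row r contains all k + 1 of this
  -- row but none of its k. If the row has no k + 1, the row above gives the claim.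
  lattice⇒ : Lattice n F → ∀ r → r < R → ∀ k → psum (λ s → X s (suc k)) (suc r) ≤ psum (λ s → X s k) r
  lattice⇒ lat r r<R k with X r (suc k) in eq
  ... | zero = ≤-trans (≤-reflexive (+-identityʳ _)) (previous r r<R)
    where
    previous : ∀ r → r < R → psum (λ s → X s (suc k)) r ≤ psum (λ s → X s k) r
    previous zero    _   = z≤n
    previous (suc r) r<R = ≤-trans (lattice⇒ lat r (<⇒≤ r<R) k) (m≤m+n _ (X r k))
  ... | suc l = begin
    psum (λ s → X s (suc k)) r + suc l                 ≡⟨ cong (psum (λ s → X s (suc k)) r +_) eq ⟨
    psum (λ s → X s (suc k)) r + X r (suc k)           ≡⟨ cong (psum (λ s → X s (suc k)) r +_)
        (count-before r c (suc k) ≤-refl) ⟨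
    psum (λ s → X s (suc k)) r + count r c (suc k) r   ≡⟨ total r c (suc k) r<R ⟨
    countB (marked (read (r , c)) (suc k)) F           ≤⟨ lat p∈ k (<⇒≤ k<n) ⟩
    countB (marked (read (r , c)) k) F                 ≡⟨ total r c k r<R ⟩
    psum (λ s → X s k) r + count r c k r               ≡⟨ cong (psum (λ s → X s k) r +_) (count-after r c k ≤-refl) ⟩
    psum (λ s → X s k) r + 0                           ≡⟨ +-identityʳ _ ⟩
    psum (λ s → X s k) r                               ∎
    where
    open ≤-Reasoning
    c = St r (suc k)
    k<n : suc k < n
    k<n = ≰⇒> (λ n≤k → 0≢1+n (trans (sym (ent-supp bs r (suc k) n≤k)) eq))
    p∈ : ((r , c) , suc (suc k)) ∈ F
    p∈ = ∈-cells⁺ μ 0 bs r (suc k) r<R k<n ≤-refl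
      (+-monoʳ-< (μ r) (subst (λ x → psum (X r) (suc k) < psum (X r) (suc k) + x) (sym eq) (m<m+n _ z<s)))

  -- For prefixes ending in row r the worst case is that all k + 1 of the row are counted and none
  -- of its k.
  ⇒lattice : (∀ r → r < R → ∀ k → psum (λ s → X s (suc k)) (suc r) ≤ psum (λ s → X s k) r) → Lattice n F
  ⇒lattice h p∈ k _ with ∈-cells⁻ μ 0 bs p∈
  ... | r , _ , c , refl , r<R , _ = begin
    countB (marked (read (r , c)) (suc k)) F           ≡⟨ total r c (suc k) r<R ⟩
    psum (λ s → X s (suc k)) r + count r c (suc k) r   ≤⟨ +-monoʳ-≤ _ (count-row≤ r c (suc k)) ⟩
    psum (λ s → X s (suc k)) (suc r)                   ≤⟨ h r r<R k ⟩
    psum (λ s → X s k) r                               ≤⟨ m≤m+n _ _ ⟩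
    psum (λ s → X s k) r + count r c k r               ≡⟨ total r c k r<R ⟨
    countB (marked (read (r , c)) k) F                 ∎
    where open ≤-Reasoning

  cells-rowWeak : RowWeak F
  cells-rowWeak p∈ q∈ e lt with ∈-cells⁻ μ 0 bs p∈ | ∈-cells⁻ μ 0 bs q∈
  ... | i , k , x , refl , _ , _ , h₁ , _ | i′ , k′ , x′ , refl , _ , _ , _ , h₂′ with e
  ...   | refl = letter< {i} {k} {suc k′} h₁ (≤-trans (s≤s (<⇒≤ lt)) h₂′)

  columns⇒ : (∀ r → suc r < R → ColStrict (μ r) (μ (suc r)) (X r) (X (suc r))) → ColumnStrict F
  columns⇒ h p∈ q∈ e lt with ∈-cells⁻ μ 0 bs p∈ | ∈-cells⁻ μ 0 bs q∈
  ... | i , k , x , refl , _ , _ , h₁ , _ | i′ , k′ , x′ , refl , i′<R , _ , _ , h₂′ with e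
  ...   | refl = s≤s (letter< {i} {k} {k′} h₁ (≤-trans h₂′ (down i′ i′<R lt)))
    where
    -- The condition on multiplicities relates adjacent rows only; it is chained through the rows in
    -- between.
    down : ∀ j → j < R → i < j → St j (suc k′) ≤ St i k′
    down (suc j) j<R (s≤s i≤j) with m≤n⇒m<n∨m≡n i≤j
    ... | inj₁ i<j  = ≤-trans (h j j<R k′) (≤-trans (St-mono j (n≤1+n k′)) (down j (<⇒≤ j<R) i<j))
    ... | inj₂ refl = h i j<R k′

  -- If the inequality fails at k, let x be the last column of row r + 1 with a letter at most k.
  -- The box above exists because μ and ν are decreasing, and its letter is at least k, against
  -- strictness.
  ⇒columns : ∀ {ν} → IsSkew μ ν → (∀ r → r < R → St r n ≡ ν r) → ColumnStrict F → ∀ r → suc r < R → ColStrict (μ r)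
      (μ (suc r)) (X r) (X (suc r))
  ⇒columns {ν} skew rows cs r r<R k with St (suc r) (suc k) ≤? St r k
  ... | yes h = h
  ... | no  h = ⊥-elim (contra (St (suc r) (suc k)) refl (≰⇒> h))
    where
    open IsSkew skew
    contra : ∀ e → St (suc r) (suc k) ≡ e → ¬ (St r k < e)
    contra (suc x) eq (s≤s St≤x)
      with locate (μ (suc r)) (X (suc r)) (suc k) {x} (≤-trans (decr-μ r) (≤-trans (m≤m+n (μ r) _) St≤x))
          (≤-reflexive (sym eq))
         | locate (μ r) (X r) n {x} (≤-trans (m≤m+n (μ r) _) St≤x)
             (≤-trans (≤-reflexive (sym eq))
                 (≤-trans (+-monoʳ-≤ (μ (suc r)) (psum≤total (ent-supp bs (suc r)) (suc k)))
               (≤-trans (≤-reflexive (rows (suc r) r<R))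
                   (≤-trans (decr-ν r) (≤-reflexive (sym (rows r (<⇒≤ r<R))))))))
    ... | k′ , k′≤k , h₁ , h₂ | k″ , k″<n , h₃ , h₄ = <⇒≱ (≤-trans (s≤s⁻¹ k″<k′) (≤-trans (s≤s⁻¹ k′≤k) k≤k″)) ≤-refl
      where
      k′<n : k′ < n
      k′<n = ≰⇒> (λ n≤k′ → <⇒≱ h₂ (subst (_≤ x)
          (cong (μ (suc r) +_) (sym (trans (cong (psum (X (suc r)) k′ +_) (ent-supp bs (suc r) k′ n≤k′))
          (+-identityʳ _)))) h₁))
      k≤k″ : k ≤ k″
      k≤k″ = s≤s⁻¹ (letter< {r} {k} {suc k″} St≤x h₄)
      k″<k′ : suc k″ < suc k′
      k″<k′ = cs (∈-cells⁺ μ 0 bs r k″ (<⇒≤ r<R) k″<n h₃ h₄) (∈-cells⁺ μ 0 bs (suc r) k′ r<R k′<n h₁ h₂) refl ≤-refl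

  content : ∀ k → countB (λ q → proj₂ q ≡ᵇ suc k) F ≡ colsum bs k
  content k = trans (count-cells (λ _ → true) μ 0 bs k) (trans
    (psum-cong (λ i → trans (countB-all _ {seg i (St i k) (X i k)} (All.tabulate (λ _ → tt)))
        (length-seg i (St i k) (X i k))) R) (sym (colsum≡psum bs k)))

rowWeak-++ˡ : ∀ F {G} → RowWeak (F ++ G) → RowWeak F
rowWeak-++ˡ F h p∈ q∈ = h (∈-++⁺ˡ p∈) (∈-++⁺ˡ q∈)

rowWeak-++ʳ : ∀ F {G} → RowWeak (F ++ G) → RowWeak G
rowWeak-++ʳ F h p∈ q∈ = h (∈-++⁺ʳ F p∈) (∈-++⁺ʳ F q∈)

∈-zip-seg : ∀ r c (v : List ℕ) {x} → x ∈ v → ∃ λ y → c ≤ y × ((r , y) , x) ∈ zip (seg r c (length v)) v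
∈-zip-seg r c (x ∷ v) (here refl) = c , ≤-refl , here refl
∈-zip-seg r c (x ∷ v) (there h) with ∈-zip-seg r (suc c) v h
... | y , c<y , y∈ = y , <⇒≤ c<y , there y∈

rowWeak⇒sorted : ∀ r c v → RowWeak (zip (seg r c (length v)) v) → AllPairs _≤_ v
rowWeak⇒sorted r c []      h = []
rowWeak⇒sorted r c (x ∷ v) h = All.tabulate first ∷ rowWeak⇒sorted r (suc c) v (λ p∈ q∈ → h (there p∈) (there q∈))
  where
  first : ∀ {y} → y ∈ v → x ≤ y
  first y∈ with ∈-zip-seg r (suc c) v y∈
  ... | z , c<z , z∈ = h (here refl) (there z∈) refl c<z

length-boxes : ∀ lo hi r₀ R → length (boxes lo hi r₀ (suc R)) ≡ (hi 0 ∸ lo 0) + length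
    (boxes (lo ∘ suc) (hi ∘ suc) (suc r₀) R)
length-boxes lo hi r₀ R = trans (length-++ (seg r₀ (lo 0) (hi 0 ∸ lo 0)))
    (cong (_+ length (boxes (lo ∘ suc) (hi ∘ suc) (suc r₀) R)) (length-seg r₀ (lo 0) (hi 0 ∸ lo 0)))

length-take : {A : Set} (k : ℕ) (xs : List A) {l : ℕ} → length xs ≡ k + l → length (take k xs) ≡ k
length-take zero    xs       e = refl
length-take (suc k) (x ∷ xs) e = cong suc (length-take k xs (suc-injective e))

length-drop : {A : Set} (k : ℕ) (xs : List A) {l : ℕ} → length xs ≡ k + l → length (drop k xs) ≡ l
length-drop zero    xs       e = e
length-drop (suc k) (x ∷ xs) e = length-drop k xs (suc-injective e)

module _ {n : ℕ} where

  -- A weakly increasing row is determined by how often each letter occurs in it.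
  word-unword : ∀ (μ ν : Seq) r₀ R w → length w ≡ length (boxes μ ν r₀ R) → All (λ x → 0 < x × x ≤ n) w →
    RowWeak (zip (boxes μ ν r₀ R) w) →
    word (unword {n} (λ r → ν r ∸ μ r) R w) ≡ w × RowSums (λ r → ν r ∸ μ r) (unword {n} (λ r → ν r ∸ μ r) R w)
  word-unword μ ν r₀ zero    []  e range weak = refl , tt
  word-unword μ ν r₀ (suc R) w   e range weak =
    trans (cong₂ _++_ (trans (fillRow-cong 0 n at-counts) fill≡) (proj₁ ih)) (take++drop≡id d w) ,
    trans (psum-cong-< n at-counts) (trans (sym (length-fillRow 0 n _)) (trans (cong length fill≡) length-u)) , proj₂
        ih
    where
    d = ν 0 ∸ μ 0
    rest = boxes (μ ∘ suc) (ν ∘ suc) (suc r₀) R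
    u = take d w
    v = drop d w
    e′ : length w ≡ d + length rest
    e′ = trans e (length-boxes μ ν r₀ R)
    length-u : length u ≡ d
    length-u = length-take d w e′
    split : zip (boxes μ ν r₀ (suc R)) w ≡ zip (seg r₀ (μ 0) d) u ++ zip rest v
    split = trans (cong (zip (seg r₀ (μ 0) d ++ rest)) (sym (take++drop≡id d w)))
      (zip-++ (seg r₀ (μ 0) d) u (trans (length-seg r₀ (μ 0) d) (sym length-u)))
    weak′ : RowWeak (zip (seg r₀ (μ 0) d) u ++ zip rest v)
    weak′ = subst RowWeak split weak
    sorted : AllPairs _≤_ u
    sorted = rowWeak⇒sorted r₀ (μ 0) u
        (subst (λ l → RowWeak (zip (seg r₀ (μ 0) l) u)) (sym length-u) (rowWeak-++ˡ (zip (seg r₀ (μ 0) d) u) weak′))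
    fill≡ : fillRow 0 n (letters 0 u) ≡ u
    fill≡ = sorted⇒fillRow n u (take⁺ d range) sorted
    at-counts : ∀ i → i < n → at (mk n (letters 0 u)) i ≡ letters 0 u i
    at-counts = at-mk-< n (letters 0 u)
    ih = word-unword (μ ∘ suc) (ν ∘ suc) (suc r₀) R v (length-drop d w e′) (drop⁺ d range)
        (rowWeak-++ʳ (zip (seg r₀ (μ 0) d) u) weak′)

  rowSums⇒ : ∀ {R} d (bs : Matrix {n} R) → RowSums d bs → ∀ r → r < R → psum (ent bs r) n ≡ d r
  rowSums⇒ d (b ∷ bs) (e , es) zero    _         = e
  rowSums⇒ d (b ∷ bs) (e , es) (suc r) (s≤s r<R) = rowSums⇒ (d ∘ suc) bs es r r<R

  ⇒rowSums : ∀ {R} d (bs : Matrix {n} R) → (∀ r → r < R → psum (ent bs r) n ≡ d r) → RowSums d bs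
  ⇒rowSums d []       h = tt
  ⇒rowSums d (b ∷ bs) h = h 0 z<s , ⇒rowSums (d ∘ suc) bs (λ r r<R → h (suc r) (s≤s r<R))

  length-word : ∀ {R} (μ ν : Seq) r₀ (bs : Matrix {n} R) → RowSums (λ r → ν r ∸ μ r) bs → length (word bs) ≡ length
      (boxes μ ν r₀ R)
  length-word μ ν r₀ []       _        = refl
  length-word {suc R} μ ν r₀ (b ∷ bs) (e , es) = trans (length-++ (fillRow 0 n (at b)))
    (trans (cong₂ _+_ (trans (length-fillRow 0 n (at b)) e) (length-word (μ ∘ suc) (ν ∘ suc) (suc r₀) bs es))
        (sym (length-boxes μ ν r₀ R)))

  word-range : ∀ {R} (bs : Matrix {n} R) → All (λ x → 0 < x × x ≤ n) (word bs)
  word-range []       = []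
  word-range (b ∷ bs) = All-++⁺ (fillRow-range 0 n (at b)) (word-range bs)

part-supp : ∀ ρ → Supp (length ρ) (part ρ)
part-supp []      i       _         = refl
part-supp (x ∷ ρ) (suc i) (s≤s h) = part-supp ρ i h

-- A matrix records the letter multiplicities of the rows. Row weakness makes this lossless; the
-- other three tests of `isLR` become column strictness, the strip condition of each row, and the
-- column sums. The number of letters is the length of ρ, zeros included.
lrCoeff↔pictures : ∀ {μ ν} → IsSkew μ ν → ∀ R ρ → Fin (lrCoeff (boxes μ ν 0 R) ρ) ↔ Pictures {length ρ} R μ ν
    (λ _ → 0) (part ρ)
lrCoeff↔pictures {μ} {ν} skew R ρ = refinement-↔ (List-≡-dec _≟_) _≟ᵐ_ (unword d R) word to from
    (λ w w∈ → proj₁ (unworded w w∈)) (λ bs pic → unword-word d bs (rowSums bs pic))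
  ↔-∘ Fin-length↔∈ (List-≡-dec _≟_) (Unique-filter⁺ (T? ∘ isLRᵖ) (words-unique (length S) n))
  where
  open IsSkew skew
  n = length ρ
  S = boxes μ ν 0 R
  d : Seq
  d r = ν r ∸ μ r
  isLRᵖ : List ℕ → Bool
  isLRᵖ w = isLR ρ (zip S w)
  LR = filterᵇ isLRᵖ (words (length S) n)

  rowSums : ∀ (bs : Matrix {n} R) → IsPicture μ ν (λ _ → 0) (part ρ) bs → RowSums d bs
  rowSums bs (ch , _) = ⇒rowSums d bs
      (λ r r<R → trans (sym (m+n∸m≡n (μ r) _))
      (cong (_∸ μ r) (IsTableau.rowsum (chain⇒tableau μ ν (λ _ → 0) bs ch) r r<R)))

  unworded : ∀ w → w ∈ LR → word (unword {n} d R w) ≡ w × RowSums d (unword {n} d R w)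
  unworded w w∈ with ∈-filter⁻ (T? ∘ isLRᵖ) {xs = words (length S) n} w∈
  ... | w∈words , lr with ∈-words⁻ (length S) n w∈words
  ...   | e , range = word-unword μ ν 0 R w e range
      (rowWeak⁻ (zip S w) (proj₁ (Equivalence.to (T-∧ {rowWeak (zip S w)}) lr)))

  to : ∀ w → w ∈ LR → IsPicture μ ν (λ _ → 0) (part ρ) (unword d R w)
  to w w∈ = picture (unword d R w) (proj₂ (unworded w w∈))
    (subst (λ v → T (isLR ρ v)) (trans (cong (zip S) (sym (proj₁ (unworded w w∈))))
        (zip-cells μ ν 0 (unword d R w) (proj₂ (unworded w w∈))))
      (proj₂ (∈-filter⁻ (T? ∘ isLRᵖ) {xs = words (length S) n} w∈)))
    where
    picture : ∀ (bs : Matrix {n} R) → RowSums d bs → T (isLR ρ (cells μ 0 bs)) → IsPicture μ ν (λ _ → 0) (part ρ) bs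
    picture bs sums lr with Equivalence.to (T-∧ {rowWeak (cells μ 0 bs)}) lr
    ... | _ , lr₁ with Equivalence.to (T-∧ {colStrict (cells μ 0 bs)}) lr₁
    ...   | cs , lr₂ with Equivalence.to (T-∧ {lattice n (cells μ 0 bs)}) lr₂
    ...     | lat , con = subst (Chain μ ν (λ _ → 0)) (mkMatrix-ext bs (ent bs) (λ _ _ _ _ → refl))
                (tableau⇒chain R μ ν (λ _ → 0) (ent bs) (λ r _ → ent-supp bs r) (record
                  { rowsum   = rows
                  ; lattice′ = lattice⇒ μ bs (lattice⁻ n (cells μ 0 bs) lat)
                  ; columns  = ⇒columns μ bs skew rows (colStrict⁻ (cells μ 0 bs) cs) })) , contents
      where
      rows : ∀ r → r < R → μ r + psum (ent bs r) n ≡ ν r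
      rows r r<R = trans (cong (μ r +_) (rowSums⇒ d bs sums r r<R)) (m+[n∸m]≡n (μ≤ν r))
      contents : ∀ k → colsum bs k ≡ part ρ k
      contents k with k <? n
      ... | yes k<n = trans (sym (content μ bs k)) (≡ᵇ⇒≡ _ _ (all-∈⁻ _ (upTo n) con (∈-upTo⁺ k<n)))
      ... | no  k≮n = trans (colsum-supp bs k (≮⇒≥ k≮n)) (sym (part-supp ρ k (≮⇒≥ k≮n)))

  from : ∀ (bs : Matrix {n} R) → IsPicture μ ν (λ _ → 0) (part ρ) bs → word bs ∈ LR
  from bs pic = ∈-filter⁺ (T? ∘ isLRᵖ)
    (subst (λ l → word bs ∈ words l n) (length-word μ ν 0 bs (rowSums bs pic)) (∈-words⁺ (word bs) (word-range bs)))
    (subst (λ F → T (isLR ρ F)) (sym (zip-cells μ ν 0 bs (rowSums bs pic)))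
      (Equivalence.from T-∧ (rowWeak⁺ F (cells-rowWeak μ bs) , Equivalence.from T-∧
          (colStrict⁺ F (columns⇒ μ bs (IsTableau.columns tab)) ,
       Equivalence.from T-∧ (lattice⁺ n F (⇒lattice μ bs (IsTableau.lattice′ tab)) ,
         all-∈⁺ _ {upTo n} (λ {k} _ → ≡⇒≡ᵇ _ _ (trans (content μ bs k) (proj₂ pic k))))))))
    where
    F = cells μ 0 bs
    tab = chain⇒tableau μ ν (λ _ → 0) bs (proj₁ pic)

-- Northwest ribbons as lists of boxes

T-ext : ∀ {x y} → (T x → T y) → (T y → T x) → x ≡ y
T-ext {true}  {true}  f g = refl
T-ext {false} {false} f g = refl
T-ext {true}  {false} f g = ⊥-elim (f tt)
T-ext {false} {true}  f g = ⊥-elim (g tt)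

T-not⁻ : ∀ {x} → T (not x) → ¬ T x
T-not⁻ {false} _ ()

T-not⁺ : ∀ {x} → ¬ T x → T (not x)
T-not⁺ {true}  h = h tt
T-not⁺ {false} h = tt

∈B⁻ : ∀ {b} S → T (b ∈B S) → b ∈ S
∈B⁻ {r , c} S h = Any.map (λ { {r′ , c′} t → let t₁ , t₂ = Equivalence.to (T-∧ {r ≡ᵇ r′}) t in cong₂ _,_ (≡ᵇ⇒≡ r r′ t₁) (≡ᵇ⇒≡ c c′ t₂) }) (any⁻ _ S h)

∈B⁺ : ∀ {b} {S} → b ∈ S → T (b ∈B S)
∈B⁺ {r , c} h = any⁺ _ (Any.map (λ { refl → Equivalence.from T-∧ (≡⇒≡ᵇ r r refl , ≡⇒≡ᵇ c c refl) }) h)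

seg-split : ∀ r {c m e} → c ≤ m → m ≤ e → seg r c (e ∸ c) ≡ seg r c (m ∸ c) ++ seg r m (e ∸ m)
seg-split r {c} {m} {e} c≤m m≤e = trans (cong (seg r c) lengths)
    (trans (seg-++ r c (m ∸ c) (e ∸ m)) (cong (λ x → seg r c (m ∸ c) ++ seg r x (e ∸ m)) (m+[n∸m]≡n c≤m)))
  where
  lengths : e ∸ c ≡ (m ∸ c) + (e ∸ m)
  lengths = trans (cong (_∸ c) (sym (m+[n∸m]≡n m≤e))) (+-∸-comm (e ∸ m) c≤m)

∈-seg-∸⁻ : ∀ r {c e b} → c ≤ e → b ∈ seg r c (e ∸ c) → row b ≡ r × c ≤ col b × col b < e
∈-seg-∸⁻ r {c} {e} {b} c≤e b∈ with ∈-seg⁻ r c (e ∸ c) b∈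
... | h₁ , h₂ , h₃ = h₁ , h₂ , subst (col b <_) (m+[n∸m]≡n c≤e) h₃

∈-boxes⁺ : ∀ lo hi r₀ R i {x} → i < R → lo i ≤ x → x < hi i → (r₀ + i , x) ∈ boxes lo hi r₀ R
∈-boxes⁺ lo hi r₀ (suc R) zero {x} _ h₁ h₂ = ∈-++⁺ˡ
    (subst (λ r → (r , x) ∈ seg r₀ (lo 0) (hi 0 ∸ lo 0)) (sym (+-identityʳ r₀))
  (∈-seg⁺ r₀ (lo 0) _ h₁ (subst (x <_) (sym (m+[n∸m]≡n (≤-trans h₁ (<⇒≤ h₂)))) h₂)))
∈-boxes⁺ lo hi r₀ (suc R) (suc i) {x} (s≤s i<R) h₁ h₂ = ∈-++⁺ʳ (seg r₀ (lo 0) (hi 0 ∸ lo 0))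
  (subst (λ r → (r , x) ∈ boxes (lo ∘ suc) (hi ∘ suc) (suc r₀) R) (sym (+-suc r₀ i))
      (∈-boxes⁺ (lo ∘ suc) (hi ∘ suc) (suc r₀) R i i<R h₁ h₂))

∈-boxes⁻ : ∀ {lo hi} → (∀ i → lo i ≤ hi i) → ∀ r₀ R {b} → b ∈ boxes lo hi r₀ R → ∃ λ i → i < R × row b ≡ r₀ + i × lo i
    ≤ col b × col b < hi i
∈-boxes⁻ {lo} {hi} le r₀ (suc R) b∈ with ∈-++⁻ (seg r₀ (lo 0) (hi 0 ∸ lo 0)) b∈
... | inj₁ h with ∈-seg-∸⁻ r₀ (le 0) h
...   | h₁ , h₂ , h₃ = 0 , z<s , trans h₁ (sym (+-identityʳ r₀)) , h₂ , h₃
∈-boxes⁻ {lo} {hi} le r₀ (suc R) b∈ | inj₂ h with ∈-boxes⁻ (le ∘ suc) (suc r₀) R h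
... | i , i<R , h₁ , h₂ , h₃ = suc i , s≤s i<R , trans h₁ (sym (+-suc r₀ i)) , h₂ , h₃

filter-boxes-< : ∀ (p : Box → Bool) {lo mid hi : Seq} → (∀ i → lo i ≤ mid i) → (∀ i → mid i ≤ hi i) → ∀ r₀ R →
  (∀ i → i < R → ∀ x → lo i ≤ x → x < hi i → p (r₀ + i , x) ≡ (x <ᵇ mid i)) → filterᵇ p (boxes lo hi r₀ R) ≡ boxes lo
      mid r₀ R
filter-boxes-< p le le′ r₀ zero    h = refl
filter-boxes-< p {lo} {mid} {hi} le le′ r₀ (suc R) h = trans (filter-++ (T? ∘ p) (seg r₀ (lo 0) (hi 0 ∸ lo 0)) _)
    (cong₂ _++_ first
  (filter-boxes-< p (le ∘ suc) (le′ ∘ suc) (suc r₀) R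
      (λ i i<R x h₁ h₂ → trans (cong (λ r → p (r , x)) (sym (+-suc r₀ i))) (h (suc i) (s≤s i<R) x h₁ h₂))))
  where
  p-at : ∀ {b} → row b ≡ r₀ → lo 0 ≤ col b → col b < hi 0 → p b ≡ (col b <ᵇ mid 0)
  p-at {_ , x} refl h₁ h₂ = trans (cong (λ r → p (r , x)) (sym (+-identityʳ r₀))) (h 0 z<s x h₁ h₂)
  first : filterᵇ p (seg r₀ (lo 0) (hi 0 ∸ lo 0)) ≡ seg r₀ (lo 0) (mid 0 ∸ lo 0)
  first = trans (cong (filterᵇ p) (seg-split r₀ (le 0) (le′ 0)))
      (trans (filter-++ (T? ∘ p) (seg r₀ (lo 0) (mid 0 ∸ lo 0)) _) (trans (cong₂ _++_
    (filter-all (T? ∘ p) (All.tabulate (λ {b} b∈ → let e , h₁ , h₂ = ∈-seg-∸⁻ r₀ (le 0) b∈ in subst T (sym (p-at e h₁ (≤-trans h₂ (le′ 0)))) (<⇒<ᵇ h₂))))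
    (filter-none (T? ∘ p) (All.tabulate (λ {b} b∈ t → let e , h₁ , h₂ = ∈-seg-∸⁻ r₀ (le′ 0) b∈ in
      <⇒≱ (<ᵇ⇒< (col b) (mid 0) (subst T (p-at e (≤-trans (le 0) h₁) h₂) t)) h₁))))
    (++-identityʳ _)))

filter-boxes-≥ : ∀ (p : Box → Bool) {lo mid hi : Seq} → (∀ i → lo i ≤ mid i) → (∀ i → mid i ≤ hi i) → ∀ r₀ R →
  (∀ i → i < R → ∀ x → lo i ≤ x → x < hi i → p (r₀ + i , x) ≡ not (x <ᵇ mid i)) → filterᵇ p (boxes lo hi r₀ R) ≡ boxes
      mid hi r₀ R
filter-boxes-≥ p le le′ r₀ zero    h = refl
filter-boxes-≥ p {lo} {mid} {hi} le le′ r₀ (suc R) h = trans (filter-++ (T? ∘ p) (seg r₀ (lo 0) (hi 0 ∸ lo 0)) _)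
    (cong₂ _++_ first
  (filter-boxes-≥ p (le ∘ suc) (le′ ∘ suc) (suc r₀) R
      (λ i i<R x h₁ h₂ → trans (cong (λ r → p (r , x)) (sym (+-suc r₀ i))) (h (suc i) (s≤s i<R) x h₁ h₂))))
  where
  p-at : ∀ {b} → row b ≡ r₀ → lo 0 ≤ col b → col b < hi 0 → p b ≡ not (col b <ᵇ mid 0)
  p-at {_ , x} refl h₁ h₂ = trans (cong (λ r → p (r , x)) (sym (+-identityʳ r₀))) (h 0 z<s x h₁ h₂)
  first : filterᵇ p (seg r₀ (lo 0) (hi 0 ∸ lo 0)) ≡ seg r₀ (mid 0) (hi 0 ∸ mid 0)
  first = trans (cong (filterᵇ p) (seg-split r₀ (le 0) (le′ 0)))
      (trans (filter-++ (T? ∘ p) (seg r₀ (lo 0) (mid 0 ∸ lo 0)) _) (cong₂ _++_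
    (filter-none (T? ∘ p) (All.tabulate (λ {b} b∈ t → let e , h₁ , h₂ = ∈-seg-∸⁻ r₀ (le 0) b∈ in
      T-not⁻ (subst T (p-at e h₁ (≤-trans h₂ (le′ 0))) t) (<⇒<ᵇ h₂))))
    (filter-all (T? ∘ p) (All.tabulate (λ {b} b∈ → let e , h₁ , h₂ = ∈-seg-∸⁻ r₀ (le′ 0) b∈ in
      subst T (sym (p-at e (≤-trans (le 0) h₁) h₂)) (T-not⁺ (λ t → <⇒≱ (<ᵇ⇒< (col b) (mid 0) t) h₁)))))))

module _ {μ ν : Seq} (skew : IsSkew μ ν) (R : ℕ) where
  open IsSkew skew

  private
    S = boxes μ ν 0 R

    -- The diagonal predecessor of (i + 1 , x + 1) lies left of the end of row i, since ν is
    -- decreasing. So it is missing exactly if x < μ i, whence the bound `suc (μ i)` in `shrink`.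
    diag : ∀ i → i < R → ∀ x → μ i ≤ x → x < ν i → not (diagPredIn S (i , x)) ≡ (x <ᵇ shrink μ ν i)
    diag zero    _   x       h₁ h₂ = sym (Equivalence.to T-≡ (<⇒<ᵇ h₂))
    diag (suc i) i<R zero    h₁ h₂ = sym (Equivalence.to T-≡ (<⇒<ᵇ (⊓-glb (z<s {μ i}) h₂)))
    diag (suc i) i<R (suc x) h₁ h₂ = T-ext
      (λ t → <⇒<ᵇ (⊓-glb (s≤s (≰⇒> (λ μ≤x → T-not⁻ t
          (∈B⁺ (∈-boxes⁺ μ ν 0 R i (<⇒≤ i<R) μ≤x (<⇒≤ (≤-trans h₂ (decr-ν i)))))))) h₂))
      (λ t → T-not⁺ (λ t′ → outside (∈-boxes⁻ μ≤ν 0 R (∈B⁻ S t′))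
          (s≤s⁻¹ (m≤n⊓o⇒m≤n _ _ (<ᵇ⇒< (suc x) (shrink μ ν (suc i)) t)))))
      where
      outside : (∃ λ j → j < R × i ≡ 0 + j × μ j ≤ x × x < ν j) → ¬ (x < μ i)
      outside (_ , _ , refl , h , _) = ≤⇒≯ h

  nw₁-boxes : nw₁ S ≡ boxes μ (shrink μ ν) 0 R
  nw₁-boxes = filter-boxes-< (λ b → not (diagPredIn S b)) (μ≤shrink skew) (shrink≤ν skew) 0 R diag

  removeNW-boxes : filterᵇ (λ b → not (b ∈B nw₁ S)) S ≡ boxes (shrink μ ν) ν 0 R
  removeNW-boxes = filter-boxes-≥ (λ b → not (b ∈B nw₁ S)) (μ≤shrink skew) (shrink≤ν skew) 0 R
    (λ i i<R x h₁ h₂ → cong not (T-ext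
      (λ t → inside i x (∈-boxes⁻ (μ≤shrink skew) 0 R (subst ((i , x) ∈_) nw₁-boxes (∈B⁻ (nw₁ S) t))))
      (λ t → ∈B⁺ (subst ((i , x) ∈_) (sym nw₁-boxes)
          (∈-boxes⁺ μ (shrink μ ν) 0 R i i<R h₁ (<ᵇ⇒< x (shrink μ ν i) t))))))
    where
    inside : ∀ i x → (∃ λ j → j < R × i ≡ 0 + j × μ j ≤ x × x < shrink μ ν j) → T (x <ᵇ shrink μ ν i)
    inside i x (_ , _ , refl , _ , h) = <⇒<ᵇ h

skewBoxes≡boxes : ∀ λ′ μ → μ ⊆ₚ λ′ → skewBoxes λ′ μ ≡ boxes (part μ) (part λ′) 0 (length λ′)
skewBoxes≡boxes λ′ μ le = rows (length λ′) 0 (λ r → r) (λ _ → refl) (part μ) (part λ′) (λ _ → refl) (λ _ → refl)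
  where
  rowBoxes : ℕ → List Box
  rowBoxes r = map (λ c → r , c) (filterᵇ (λ c → part μ r ≤ᵇ c) (upTo (part λ′ r)))
  filter-row : ∀ r m c l → map (λ x → r , x) (filterᵇ (m ≤ᵇ_) (applyUpTo c l)) ≡ filterᵇ (λ b → m ≤ᵇ col b)
      (map (λ x → r , x) (applyUpTo c l))
  filter-row r m c zero    = refl
  filter-row r m c (suc l) with m ≤ᵇ c 0
  ... | true  = cong ((r , c 0) ∷_) (filter-row r m (c ∘ suc) l)
  ... | false = filter-row r m (c ∘ suc) l
  map-row : ∀ r c f l → (∀ i → f i ≡ c + i) → map (λ x → r , x) (applyUpTo f l) ≡ seg r c l
  map-row r c f zero    e = refl
  map-row r c f (suc l) e = cong₂ _∷_ (cong (r ,_) (trans (e 0) (+-identityʳ c)))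
      (map-row r (suc c) (f ∘ suc) l (λ i → trans (e (suc i)) (+-suc c i)))
  one-row : ∀ r → rowBoxes r ≡ seg r (part μ r) (part λ′ r ∸ part μ r)
  one-row r = trans (filter-row r (part μ r) (λ x → x) (part λ′ r))
      (trans (cong (filterᵇ _) (trans (map-row r 0 (λ x → x) (part λ′ r) (λ _ → refl)) (sym (++-identityʳ _))))
    (trans (filter-boxes-≥ (λ b → part μ r ≤ᵇ col b) {λ _ → 0} {λ _ → part μ r} {λ _ → part λ′ r} (λ _ → z≤n)
        (λ _ → le r) r 1
      (λ _ _ x _ _ → T-ext (λ t → T-not⁺ (λ t′ → <⇒≱ (<ᵇ⇒< x (part μ r) t′) (≤ᵇ⇒≤ (part μ r) x t)))
          (λ t → ≤⇒≤ᵇ {part μ r} {x} (≮⇒≥ (λ x< → T-not⁻ t (<⇒<ᵇ x<))))))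
      (++-identityʳ _)))
  rows : ∀ R r₀ (g : ℕ → ℕ) → (∀ i → g i ≡ r₀ + i) → ∀ lo hi → (∀ i → part μ (r₀ + i) ≡ lo i) →
      (∀ i → part λ′ (r₀ + i) ≡ hi i) → concatMap rowBoxes (applyUpTo g R) ≡ boxes lo hi r₀ R
  rows zero    r₀ g e lo hi e₁ e₂ = refl
  rows (suc R) r₀ g e lo hi e₁ e₂ = cong₂ _++_
    (trans (cong rowBoxes (trans (e 0) (+-identityʳ r₀)))
        (trans (one-row r₀) (cong₂ (λ x y → seg r₀ x (y ∸ x)) (trans (cong (part μ) (sym (+-identityʳ r₀))) (e₁ 0))
        (trans (cong (part λ′) (sym (+-identityʳ r₀))) (e₂ 0)))))
    (rows R (suc r₀) (g ∘ suc) (λ i → trans (e (suc i)) (+-suc r₀ i)) (lo ∘ suc) (hi ∘ suc)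
      (λ i → trans (cong (part μ) (sym (+-suc r₀ i))) (e₁ (suc i)))
          (λ i → trans (cong (part λ′) (sym (+-suc r₀ i))) (e₂ (suc i))))

-- Rows, columns and components of a weak ribbon

record IsRibbon (lo hi : Seq) : Set where
  field
    decr-lo : Decr lo
    lo≤hi   : ∀ r → lo r ≤ hi r
    -- Consecutive rows overlap in at most one column. By `gap` a row does not reach under the
    -- position of an empty row above it, so that an overlap of the bounds is a real contact.
    abut : ∀ r → hi (suc r) ≤ suc (lo r)
    gap     : ∀ r → hi r ≤ lo r → hi (suc r) ≤ lo r

  decr-hi : Decr hi
  decr-hi r with lo r <? hi r
  ... | yes h = ≤-trans (abut r) h
  ... | no  h = ≤-trans (gap r (≮⇒≥ h)) (lo≤hi r)

ribbon-tail : ∀ {lo hi} → IsRibbon lo hi → IsRibbon (lo ∘ suc) (hi ∘ suc)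
ribbon-tail rib = record { decr-lo = decr-lo ∘ suc ; lo≤hi = lo≤hi ∘ suc ; abut = abut ∘ suc ; gap = gap ∘ suc }
  where open IsRibbon rib

shrink-ribbon : ∀ {μ ν} → IsSkew μ ν → IsRibbon μ (shrink μ ν)
shrink-ribbon {μ} {ν} skew = record
  { decr-lo = decr-μ ; lo≤hi = μ≤shrink skew ; abut = λ r → m⊓n≤m (suc (μ r)) _
  ; gap = λ r h → ≤-trans (m⊓n≤n (suc (μ r)) _) (≤-trans (decr-ν r) (ν≤μ r h)) }
  where
  open IsSkew skew
  -- Below the top row `suc (μ r)` exceeds `μ (suc r)`, so a row of the ribbon is empty only if that
  -- row of ν/μ is.
  ν≤μ : ∀ r → shrink μ ν r ≤ μ r → ν r ≤ μ r
  ν≤μ zero    h = h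
  ν≤μ (suc r) h with ⊓-sel (suc (μ r)) (ν (suc r))
  ... | inj₁ e = ⊥-elim (<⇒≱ (s≤s (decr-μ r)) (subst (_≤ μ (suc r)) e h))
  ... | inj₂ e = subst (_≤ μ (suc r)) e h

-- 1 if the second of R rows exists and shares a column with the first, and 0 otherwise.
touch : Seq → Seq → ℕ → ℕ
touch lo hi zero    = 0
touch lo hi (suc R) = hi 1 ∸ lo 0

data Touch (lo hi : Seq) : ℕ → ℕ → Set where
  separate : ∀ {R} → (∀ i → i < R → hi (suc i) ≤ lo 0) → Touch lo hi R 0
  touching : ∀ {R} → hi 1 ≡ suc (lo 0) → Touch lo hi (suc R) 1

touch-view : ∀ {lo hi} → IsRibbon lo hi → ∀ R → Touch lo hi R (touch lo hi R)
touch-view rib zero = separate (λ _ ())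
touch-view {lo} {hi} rib (suc R) with m≤n⇒m<n∨m≡n (abut 0)
  where open IsRibbon rib
... | inj₁ (s≤s h) = subst (Touch lo hi (suc R)) (sym (m≤n⇒m∸n≡0 h)) (separate (λ i _ → ≤-trans (below i) h))
  where
  below : ∀ i → hi (suc i) ≤ hi 1
  below zero    = ≤-refl
  below (suc i) = ≤-trans (IsRibbon.decr-hi rib (suc i)) (below i)
... | inj₂ e = subst (Touch lo hi (suc R)) (sym (trans (cong (_∸ lo 0) e) (m+n∸n≡m 1 (lo 0)))) (touching e)

distinct : List ℕ → ℕ
distinct xs = length (deduplicate _≟_ xs)

distinct-∉ : ∀ {x xs} → ¬ (x ∈ xs) → distinct (x ∷ xs) ≡ suc (distinct xs)
distinct-∉ {x} {xs} x∉ = cong suc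
    (cong length (filter-all (¬? ∘ (x ≟_)) (All.tabulate (λ { y∈ refl → x∉ (∈-deduplicate⁻ _≟_ xs y∈) }))))

length-filter-≢ : ∀ {x xs} → Unique xs → x ∈ xs → suc (length (filter (¬? ∘ (x ≟_)) xs)) ≡ length xs
length-filter-≢ {x} {y ∷ xs} (y∉ ∷ u) x∈ with x ≟ y | x∈
... | yes refl | _ = cong suc (cong length
    (trans (filter-reject (¬? ∘ (x ≟_)) (λ x≢x → x≢x refl)) (filter-all (¬? ∘ (x ≟_)) y∉)))
... | no x≢y   | here e = ⊥-elim (x≢y e)
... | no x≢y   | there x∈′ = cong suc (trans (cong length (filter-accept (¬? ∘ (x ≟_)) x≢y)) (length-filter-≢ u x∈′))

distinct-∈ : ∀ {x xs} → x ∈ xs → distinct (x ∷ xs) ≡ distinct xs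
distinct-∈ {x} {xs} x∈ = length-filter-≢ (deduplicate-! _≟_ xs) (∈-deduplicate⁺ _≟_ x∈)

distinct-cols : ∀ r c l ys → (∀ {y} → y ∈ ys → y < c) → distinct (map col (seg r c l) ++ ys) ≡ l + distinct ys
distinct-cols r c zero    ys h = refl
distinct-cols r c (suc l) ys h = trans (distinct-∉ fresh) (cong suc (distinct-cols r (suc c) l ys (m≤n⇒m≤1+n ∘ h)))
  where
  fresh : ¬ (c ∈ map col (seg r (suc c) l) ++ ys)
  fresh c∈ with ∈-++⁻ (map col (seg r (suc c) l)) c∈
  ... | inj₂ c∈ys = <-irrefl refl (h c∈ys)
  ... | inj₁ c∈seg with ∈-map⁻ col c∈seg
  ...   | b , b∈ , e = <⇒≢ (proj₁ (proj₂ (∈-seg⁻ r (suc c) l b∈))) e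

distinct-rows : ∀ r c l ys → (∀ {y} → y ∈ ys → r < y) → distinct (map row (seg r c l) ++ ys) ≡ (1 ⊓ l) + distinct ys
distinct-rows r c zero          ys h = refl
distinct-rows r c (suc zero)    ys h = distinct-∉ (λ r∈ → <-irrefl refl (h r∈))
distinct-rows r c (suc (suc l)) ys h = trans (distinct-∈ {r} {map row (seg r (suc c) (suc l)) ++ ys} (here refl))
    (distinct-rows r (suc c) (suc l) ys h)

insertComp≡ : ∀ b cs → let P = partitionᵇ (any (sharesLine b)) cs in insertComp b cs ≡ (b ∷ concat (proj₁ P)) ∷ proj₂ P
insertComp≡ b cs with partitionᵇ (any (sharesLine b)) cs
... | _ , _ = refl

partition-∷-true : {A : Set} (p : A → Bool) (x : A) (xs : List A) → T (p x) →
  partitionᵇ p (x ∷ xs) ≡ (x ∷ proj₁ (partitionᵇ p xs) , proj₂ (partitionᵇ p xs))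
partition-∷-true p x xs t with p x
... | true = refl

partition-none : {A : Set} (p : A → Bool) {xs : List A} → All (¬_ ∘ T ∘ p) xs → partitionᵇ p xs ≡ ([] , xs)
partition-none p []       = refl
partition-none p {x ∷ xs} (¬t ∷ ts) with p x | partition-none p ts
... | true  | _ = ⊥-elim (¬t tt)
... | false | e rewrite e = refl

partition-All : {A : Set} {P : A → Set} (p : A → Bool) {xs : List A} → All P xs → All P (proj₁ (partitionᵇ p xs)) ×
    All P (proj₂ (partitionᵇ p xs))
partition-All p []       = [] , []
partition-All p {x ∷ xs} (px ∷ pxs) with p x | partition-All p pxs
... | true  | h₁ , h₂ = px ∷ h₁ , h₂
... | false | h₁ , h₂ = h₁ , px ∷ h₂

components-All : {P : Box → Set} (S : List Box) → All P S → All (All P) (components S)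
components-All []      []       = []
components-All (b ∷ S) (pb ∷ ps) = subst (All (All _)) (sym (insertComp≡ b (components S)))
  (let h₁ , h₂ = partition-All (any (sharesLine b)) (components-All S ps) in (pb ∷ concat⁺ h₁) ∷ h₂)

¬sharesLine : ∀ {r c C} → All (λ b → r < row b × col b < c) C → ¬ T (any (sharesLine (r , c)) C)
¬sharesLine {r} {c} {C} h t with find (any⁻ _ C t)
... | b , b∈ , s with Equivalence.to (T-∨ {r ≡ᵇ row b}) s | All.lookup h b∈
...   | inj₁ e | h₁ , _ = <⇒≢ h₁ (≡ᵇ⇒≡ r (row b) e)
...   | inj₂ e | _ , h₂ = <⇒≢ h₂ (sym (≡ᵇ⇒≡ c (col b) e))

sharesRow : ∀ r c c′ C → T (any (sharesLine (r , c)) ((r , c′) ∷ C))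
sharesRow r c c′ C = Equivalence.from (T-∨ {sharesLine (r , c) (r , c′)})
    (inj₁ (Equivalence.from (T-∨ {r ≡ᵇ r}) (inj₁ (≡⇒≡ᵇ r r refl))))

sharesCol : ∀ {r c b C} → b ∈ C → col b ≡ c → T (any (sharesLine (r , c)) C)
sharesCol {r} {c} {b} b∈ refl = any⁺ _
    (Any.map (λ { refl → Equivalence.from (T-∨ {r ≡ᵇ row b}) (inj₂ (≡⇒≡ᵇ c c refl)) }) b∈)

-- Boxes are inserted from the end of the list: the rightmost box of the row founds a component, and
-- the others join it one by one through the common row.
components-seg : ∀ r c l S → All (λ b → r < row b × col b < c) S →
  components (seg r c (suc l) ++ S) ≡ seg r c (suc l) ∷ components S
components-seg r c zero S h = trans (insertComp≡ (r , c) (components S))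
  (cong (λ P → ((r , c) ∷ concat (proj₁ P)) ∷ proj₂ P)
      (partition-none (any (sharesLine (r , c))) (All.map ¬sharesLine (components-All S h))))
components-seg r c (suc l) S h = begin
  insertComp (r , c) (components (seg r (suc c) (suc l) ++ S))
    ≡⟨ cong (insertComp (r , c)) (components-seg r (suc c) l S (All.map (λ { (h₁ , h₂) → h₁ , m≤n⇒m≤1+n h₂ }) h)) ⟩
  insertComp (r , c) (C ∷ components S)
    ≡⟨ insertComp≡ (r , c) (C ∷ components S) ⟩
  _ ≡⟨ cong (λ P → ((r , c) ∷ concat (proj₁ P)) ∷ proj₂ P)
      (trans (partition-∷-true (any (sharesLine (r , c))) C (components S)
      (sharesRow r c (suc c) (seg r (suc (suc c)) l)))
        (cong (λ P → (C ∷ proj₁ P) , proj₂ P)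
            (partition-none (any (sharesLine (r , c))) (All.map ¬sharesLine (components-All S h))))) ⟩
  ((r , c) ∷ C ++ []) ∷ components S
    ≡⟨ cong (λ x → ((r , c) ∷ x) ∷ components S) (++-identityʳ C) ⟩
  seg r c (suc (suc l)) ∷ components S ∎
  where
  open ≡-Reasoning
  C = seg r (suc c) (suc l)

-- The components of a ribbon whose first row occupies the columns from a to e - 1:
-- if that row is nonempty, its component comes first and the others lie to the left of a.
data Leading (a e : ℕ) : List (List Box) → Set where
  empty    : ∀ {cs} → e ≤ a → All (All (λ b → col b < a)) cs → Leading a e cs
  nonempty : ∀ {b C cs} → a < e → b ∈ C → suc (col b) ≡ e → All (λ b → col b < e) C → All (All (λ b → col b < a)) cs →
      Leading a e (C ∷ cs)

-- Adding the first row, with leftmost box (r , c), to the components cs of the rows below.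
module FirstRow (r c : ℕ) (l : ℕ) (S : List Box) (below : All (λ b → r < row b) S) where

  private
    cs  = components S
    comps = components (seg r c (suc l) ++ S)
    q : List Box → Bool
    q = any (sharesLine (r , c))

    rightmost : ∀ l → ∃ λ b → b ∈ seg r c (suc l) × suc (col b) ≡ c + suc l
    rightmost l = (r , c + l) , ∈-seg⁺ r c (suc l) (m≤m+n c l) (+-monoʳ-< c ≤-refl) , sym (+-suc c l)

    -- Only the leftmost box of the row can meet boxes below. The rest of the row forms a component
    -- of its own before that box joins it to `ts`.
    merged : ∀ l ts us → partitionᵇ q cs ≡ (ts , us) → All (λ b → col b ≤ c) S →
      ∃ λ rest → components (seg r c (suc l) ++ S) ≡ rest ∷ us × (∀ {b} → b ∈ seg r c (suc l) → b ∈ rest)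
    merged zero ts us e left = _ , trans (insertComp≡ (r , c) cs)
        (cong (λ P → ((r , c) ∷ concat (proj₁ P)) ∷ proj₂ P) e) , λ { (here refl) → here refl }
    merged (suc l′) ts us e left = _ , trans
        (cong (insertComp (r , c)) (components-seg r (suc c) l′ S
        (All.zipWith (λ { (h₁ , h₂) → h₁ , s≤s h₂ }) (below , left))))
                     (trans (insertComp≡ (r , c) (C ∷ cs)) (cong (λ P → ((r , c) ∷ concat (proj₁ P)) ∷ proj₂ P)
                       (trans (partition-∷-true q C cs (sharesRow r c (suc c) (seg r (suc (suc c)) l′)))
                           (cong (λ P → (C ∷ proj₁ P) , proj₂ P) e)))) ,
                   λ { (here refl) → here refl ; (there b∈) → there (∈-++⁺ˡ b∈) }
      where C = seg r (suc c) (suc l′)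

    lead : ∀ {ts us} → partitionᵇ q cs ≡ (ts , us) → All (λ b → col b ≤ c) S → All (All (λ b → col b < c)) us →
      length comps ≡ suc (length us) × Leading c (c + suc l) comps
    lead {ts} {us} e left left′ with merged l ts us e left
    ... | rest , e′ , sub = cong length e′ , subst (Leading c (c + suc l)) (sym e′)
      (nonempty (m<m+n c z<s) (sub (proj₁ (proj₂ (rightmost l)))) (proj₂ (proj₂ (rightmost l)))
        (All.head (subst (All (All (λ b → col b < c + suc l))) e′ (components-All (seg r c (suc l) ++ S) (All-++⁺
          (All.tabulate (λ b∈ → proj₂ (proj₂ (∈-seg⁻ r c (suc l) b∈))))
              (All.map (λ {b} h → ≤-<-trans h (m<m+n c z<s)) left)))))
        left′)

  lead-separate : All (λ b → col b < c) S → length comps ≡ suc (length cs) × Leading c (c + suc l) comps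
  lead-separate left = lead (partition-none q
      (All.map ¬sharesLine (components-All S (All.zipWith (λ p → p) (below , left)))))
    (All.map <⇒≤ left) (components-All S left)

  -- The first component below ends in column c, and all others lie left of a, which is at most c.
  -- So the new row merges with exactly the first one.
  lead-touching : All (λ b → col b ≤ c) S → ∀ {a} → a ≤ c → Leading a (suc c) cs → length comps ≡ length cs × Leading
      c (c + suc l) comps
  lead-touching left {a} a≤c L = go cs refl L
    where
    go : ∀ ds → cs ≡ ds → Leading a (suc c) ds → length comps ≡ length ds × Leading c (c + suc l) comps
    go ds eq (empty h _) = ⊥-elim (<⇒≱ h a≤c)
    go (C ∷ ds) eq (nonempty {b} _ b∈ e _ left′) = lead
        (trans (cong (partitionᵇ q) eq) (trans (partition-∷-true q C ds (sharesCol {r} b∈ (suc-injective e)))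
        (cong (λ P → (C ∷ proj₁ P) , proj₂ P)
            (partition-none q (All.zipWith ¬both
            (All.tail (subst (All (All (λ b → r < row b))) eq (components-All S below)) , left″)))))) left left″
      where
      left″ : All (All (λ b → col b < c)) ds
      left″ = All.map (All.map (λ h → ≤-trans h a≤c)) left′
      ¬both : ∀ {D} → All (λ b → r < row b) D × All (λ b → col b < c) D → ¬ T (q D)
      ¬both h = ¬sharesLine (All.zipWith (λ p → p) h)

module _ {lo hi : Seq} (rib : IsRibbon lo hi) (r₀ R : ℕ) where
  open IsRibbon rib

  private
    S = boxes (lo ∘ suc) (hi ∘ suc) (suc r₀) R

    lo≤ : ∀ i → lo i ≤ lo 0
    lo≤ zero    = ≤-refl
    lo≤ (suc i) = ≤-trans (decr-lo i) (lo≤ i)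

    tail-All : {P : Box → Set} → (∀ i b → i < R → row b ≡ suc r₀ + i → lo (suc i) ≤ col b → col b < hi (suc i) → P b)
        → All P S
    tail-All h = All.tabulate (λ {b} b∈ → let i , i<R , h₁ , h₂ , h₃ = ∈-boxes⁻ (lo≤hi ∘ suc) (suc r₀) R b∈ in h i b i<R h₁ h₂ h₃)

    below : All (λ b → r₀ < row b) S
    below = tail-All (λ i b _ e _ _ → subst (r₀ <_) (sym e) (s≤s (m≤m+n r₀ i)))

    left : All (λ b → col b ≤ lo 0) S
    left = tail-All (λ i b _ _ _ h → s≤s⁻¹ (≤-trans h (≤-trans (abut i) (s≤s (lo≤ i)))))

    left< : (∀ i → i < R → hi (suc i) ≤ lo 0) → All (λ b → col b < lo 0) S
    left< h = tail-All (λ i b i<R _ _ h′ → ≤-trans h′ (h i i<R))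

  numRows-step : numRows (boxes lo hi r₀ (suc R)) ≡ (1 ⊓ (hi 0 ∸ lo 0)) + numRows S
  numRows-step = trans (cong distinct (map-++ row (seg r₀ (lo 0) (hi 0 ∸ lo 0)) S))
      (distinct-rows r₀ (lo 0) (hi 0 ∸ lo 0) (map row S) in-rows)
    where
    in-rows : ∀ {y} → y ∈ map row S → r₀ < y
    in-rows y∈ with ∈-map⁻ row y∈
    ... | b , b∈ , refl = All.lookup below b∈

  -- If the first row touches the next, its leftmost column occurs below already; every other column
  -- of it is new.
  numCols-step : numCols (boxes lo hi r₀ (suc R)) + touch lo hi R ≡ (hi 0 ∸ lo 0) + numCols S
  numCols-step = trans (cong (λ xs → distinct xs + touch lo hi R) (map-++ col (seg r₀ (lo 0) (hi 0 ∸ lo 0)) S))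
      (go (hi 0 ∸ lo 0) refl (touch-view rib R))
    where
    ys = map col S
    in-cols : {P : ℕ → Set} → All (P ∘ col) S → ∀ {y} → y ∈ ys → P y
    in-cols h y∈ with ∈-map⁻ col y∈
    ... | b , b∈ , refl = All.lookup h b∈
    go : ∀ l {t} → hi 0 ∸ lo 0 ≡ l → Touch lo hi R t → distinct (map col (seg r₀ (lo 0) l) ++ ys) + t ≡ l + distinct
        ys
    go l       e (separate h) = trans (+-identityʳ _) (distinct-cols r₀ (lo 0) l ys (in-cols (left< h)))
    -- An empty row cannot touch the next one, by `gap`.
    go zero    e (touching h) = ⊥-elim (<⇒≱ (≤-reflexive (sym h)) (gap 0 (m∸n≡0⇒m≤n e)))
    go (suc l) e (touching {R′} h) = trans (+-comm _ 1)
        (cong suc (trans (distinct-∈ (∈-++⁺ʳ (map col (seg r₀ (suc (lo 0)) l)) (∈-map⁺ col first)))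
      (distinct-cols r₀ (suc (lo 0)) l ys (in-cols (All.map s≤s left)))))
      where
      first : (suc r₀ + 0 , lo 0) ∈ S
      first = ∈-boxes⁺ (lo ∘ suc) (hi ∘ suc) (suc r₀) R 0 z<s (decr-lo 0) (≤-reflexive (sym h))

  -- A nonempty row adds a component, unless it touches and merges with the leading one below. The
  -- correction `touch` is the same as for columns.
  components-step : (∀ R′ → R ≡ suc R′ → Leading (lo 1) (hi 1) (components S)) →
    numComponents (boxes lo hi r₀ (suc R)) + touch lo hi R ≡ (1 ⊓ (hi 0 ∸ lo 0)) + numComponents S
    × Leading (lo 0) (hi 0) (components (boxes lo hi r₀ (suc R)))
  components-step L = proj₁ result , subst (λ e → Leading (lo 0) e (components (boxes lo hi r₀ (suc R))))
      (m+[n∸m]≡n (lo≤hi 0)) (proj₂ result)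
    where
    go : ∀ l {t} → hi 0 ∸ lo 0 ≡ l → Touch lo hi R t →
      length (components (seg r₀ (lo 0) l ++ S)) + t ≡ (1 ⊓ l) + numComponents S × Leading (lo 0) (lo 0 + l)
          (components (seg r₀ (lo 0) l ++ S))
    go zero    e (separate h) = +-identityʳ _ , empty (≤-reflexive (+-identityʳ _)) (components-All S (left< h))
    go zero    e (touching h) = ⊥-elim (<⇒≱ (≤-reflexive (sym h)) (gap 0 (m∸n≡0⇒m≤n e)))
    go (suc l) e (separate h) = let n , h′ = FirstRow.lead-separate r₀ (lo 0) l S below (left< h) in trans (+-identityʳ _) n , h′
    go (suc l) e (touching {R′} h) = let n , h′ = FirstRow.lead-touching r₀ (lo 0) l S below left (decr-lo 0) (subst (λ x → Leading (lo 1) x (components S)) h (L R′ refl)) in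
      trans (+-comm _ 1) (cong suc n) , h′
    result = go (hi 0 ∸ lo 0) refl (touch-view rib R)

leading : ∀ {lo hi} → IsRibbon lo hi → ∀ r₀ R → Leading (lo 0) (hi 0) (components (boxes lo hi r₀ (suc R)))
leading rib r₀ zero    = proj₂ (components-step rib r₀ 0 (λ _ ()))
leading rib r₀ (suc R) = proj₂ (components-step rib r₀ (suc R) (λ { _ refl → leading (ribbon-tail rib) (suc r₀) R }))

numComponents-step : ∀ {lo hi} → IsRibbon lo hi → ∀ r₀ R → numComponents (boxes lo hi r₀ (suc R)) + touch lo hi R ≡
  (1 ⊓ (hi 0 ∸ lo 0)) + numComponents (boxes (lo ∘ suc) (hi ∘ suc) (suc r₀) R)
numComponents-step rib r₀ zero    = proj₁ (components-step rib r₀ 0 (λ _ ()))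
numComponents-step rib r₀ (suc R) = proj₁
    (components-step rib r₀ (suc R) (λ { _ refl → leading (ribbon-tail rib) (suc r₀) R }))

-- The boxes of a row with no box of the ribbon above them. Each occupied column has exactly one,
-- its topmost, so they count the columns.
fresh : Seq → Seq → Seq
fresh lo hi zero    = hi 0 ∸ lo 0
fresh lo hi (suc r) = (lo r ⊓ hi (suc r)) ∸ lo (suc r)

length-boxes≡ : ∀ lo hi r₀ R → length (boxes lo hi r₀ R) ≡ psum (λ r → hi r ∸ lo r) R
length-boxes≡ lo hi r₀ zero    = refl
length-boxes≡ lo hi r₀ (suc R) = trans (length-boxes lo hi r₀ R) (trans
  (cong ((hi 0 ∸ lo 0) +_) (length-boxes≡ (lo ∘ suc) (hi ∘ suc) (suc r₀) R)) (sym (psum-head (λ r → hi r ∸ lo r) R)))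

1⊓n+[n∸1]≡n : ∀ n → (1 ⊓ n) + (n ∸ 1) ≡ n
1⊓n+[n∸1]≡n zero    = refl
1⊓n+[n∸1]≡n (suc n) = refl

numRows-boxes : ∀ {lo hi} → IsRibbon lo hi → ∀ r₀ R → numRows (boxes lo hi r₀ R) + psum (λ r → (hi r ∸ lo r) ∸ 1) R ≡
    psum (λ r → hi r ∸ lo r) R
numRows-boxes rib r₀ zero    = refl
numRows-boxes {lo} {hi} rib r₀ (suc R) = begin
  numRows (boxes lo hi r₀ (suc R)) + psum (λ r → (hi r ∸ lo r) ∸ 1) (suc R)
    ≡⟨ cong₂ _+_ (numRows-step rib r₀ R) (psum-head (λ r → (hi r ∸ lo r) ∸ 1) R) ⟩
  (1 ⊓ d) + n + ((d ∸ 1) + s)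
    ≡⟨ lem (1 ⊓ d) n (d ∸ 1) s ⟩
  ((1 ⊓ d) + (d ∸ 1)) + (n + s)
    ≡⟨ cong₂ _+_ (1⊓n+[n∸1]≡n d) (numRows-boxes (ribbon-tail rib) (suc r₀) R) ⟩
  d + psum (λ r → hi (suc r) ∸ lo (suc r)) R
    ≡⟨ psum-head (λ r → hi r ∸ lo r) R ⟨
  psum (λ r → hi r ∸ lo r) (suc R) ∎
  where
  open ≡-Reasoning
  d = hi 0 ∸ lo 0
  n = numRows (boxes (lo ∘ suc) (hi ∘ suc) (suc r₀) R)
  s = psum (λ r → (hi (suc r) ∸ lo (suc r)) ∸ 1) R
  lem : ∀ x y z w → x + y + (z + w) ≡ (x + z) + (y + w)
  lem = solve-∀

-- A row with d boxes adds d columns and, if d is positive, one component, both reduced by `touch`.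
-- The difference therefore grows by d ∸ 1 per row: the arm length is the sum of `least`.
numCols-components : ∀ {lo hi} → IsRibbon lo hi → ∀ r₀ R → numCols (boxes lo hi r₀ R) ≡ numComponents
    (boxes lo hi r₀ R) + psum (λ r → (hi r ∸ lo r) ∸ 1) R
numCols-components rib r₀ zero    = refl
numCols-components {lo} {hi} rib r₀ (suc R) = +-cancelʳ-≡ t _ _ (begin
  numCols (boxes lo hi r₀ (suc R)) + t                          ≡⟨ numCols-step rib r₀ R ⟩
  d + numCols S                                                 ≡⟨ cong₂ _+_ (sym (1⊓n+[n∸1]≡n d))
      (numCols-components (ribbon-tail rib) (suc r₀) R) ⟩
  ((1 ⊓ d) + (d ∸ 1)) + (numComponents S + s)                   ≡⟨ lem (1 ⊓ d) (d ∸ 1) (numComponents S) s ⟩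
  ((1 ⊓ d) + numComponents S) + ((d ∸ 1) + s)                   ≡⟨ cong₂ _+_ (numComponents-step rib r₀ R)
      (psum-head (λ r → (hi r ∸ lo r) ∸ 1) R) ⟨
  (numComponents (boxes lo hi r₀ (suc R)) + t) + psum (λ r → (hi r ∸ lo r) ∸ 1) (suc R)
    ≡⟨ lem′ (numComponents (boxes lo hi r₀ (suc R))) t _ ⟩
  numComponents (boxes lo hi r₀ (suc R)) + psum (λ r → (hi r ∸ lo r) ∸ 1) (suc R) + t ∎)
  where
  open ≡-Reasoning
  t = touch lo hi R
  d = hi 0 ∸ lo 0
  S = boxes (lo ∘ suc) (hi ∘ suc) (suc r₀) R
  s = psum (λ r → (hi (suc r) ∸ lo (suc r)) ∸ 1) R
  lem : ∀ x y z w → (x + y) + (z + w) ≡ (x + z) + (y + w)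
  lem = solve-∀
  lem′ : ∀ x y z → (x + y) + z ≡ x + z + y
  lem′ = solve-∀

numCols-boxes : ∀ {lo hi} → IsRibbon lo hi → ∀ r₀ R → numCols (boxes lo hi r₀ R) ≡ psum (fresh lo hi) R
numCols-boxes rib r₀ zero = refl
numCols-boxes {lo} {hi} rib r₀ (suc R) = +-cancelʳ-≡ (touch lo hi R) _ _ (begin
  numCols (boxes lo hi r₀ (suc R)) + touch lo hi R             ≡⟨ numCols-step rib r₀ R ⟩
  (hi 0 ∸ lo 0) + numCols (boxes (lo ∘ suc) (hi ∘ suc) (suc r₀) R) ≡⟨ cong ((hi 0 ∸ lo 0) +_)
      (numCols-boxes (ribbon-tail rib) (suc r₀) R) ⟩
  (hi 0 ∸ lo 0) + psum (fresh (lo ∘ suc) (hi ∘ suc)) R         ≡⟨ cong ((hi 0 ∸ lo 0) +_) (first R) ⟩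
  (hi 0 ∸ lo 0) + (psum (fresh lo hi ∘ suc) R + touch lo hi R) ≡⟨ +-assoc (hi 0 ∸ lo 0) _ _ ⟨
  (hi 0 ∸ lo 0) + psum (fresh lo hi ∘ suc) R + touch lo hi R   ≡⟨ cong (_+ touch lo hi R) (psum-head (fresh lo hi) R)
      ⟨
  psum (fresh lo hi) (suc R) + touch lo hi R                   ∎)
  where
  open ≡-Reasoning
  open IsRibbon rib
  row-1 : hi 1 ∸ lo 1 ≡ fresh lo hi 1 + (hi 1 ∸ lo 0)
  row-1 with ≤-total (hi 1) (lo 0)
  ... | inj₁ h = sym (trans (cong₂ _+_ (cong (_∸ lo 1) (m≥n⇒m⊓n≡n h)) (m≤n⇒m∸n≡0 h)) (+-identityʳ _))
  ... | inj₂ h = trans (cong (_∸ lo 1) (sym (m+[n∸m]≡n h)))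
      (trans (+-∸-comm (hi 1 ∸ lo 0) (decr-lo 0)) (cong (λ x → (x ∸ lo 1) + (hi 1 ∸ lo 0)) (sym (m≤n⇒m⊓n≡m h))))
  -- When the rows from row 1 on stand alone, all of row 1 counts as fresh, including its overlap
  -- with row 0; the excess is `touch`.
  first : ∀ R → psum (fresh (lo ∘ suc) (hi ∘ suc)) R ≡ psum (fresh lo hi ∘ suc) R + touch lo hi R
  first zero    = refl
  first (suc R) = begin
    psum (fresh (lo ∘ suc) (hi ∘ suc)) (suc R)                 ≡⟨ psum-head (fresh (lo ∘ suc) (hi ∘ suc)) R ⟩
    (hi 1 ∸ lo 1) + s                                          ≡⟨ cong (_+ s) row-1 ⟩
    fresh lo hi 1 + (hi 1 ∸ lo 0) + s                          ≡⟨ lem (fresh lo hi 1) (hi 1 ∸ lo 0) s ⟩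
    fresh lo hi 1 + s + (hi 1 ∸ lo 0)                          ≡⟨ cong (_+ (hi 1 ∸ lo 0))
        (psum-head (fresh lo hi ∘ suc) R) ⟨
    psum (fresh lo hi ∘ suc) (suc R) + (hi 1 ∸ lo 0)           ∎
    where
    s = psum (fresh lo hi ∘ suc ∘ suc) R
    lem : ∀ x y z → x + y + z ≡ x + z + y
    lem = solve-∀

most≡fresh : ∀ μ ν r → most μ ν r ≡ fresh μ (shrink μ ν) r
most≡fresh μ ν zero    = refl
most≡fresh μ ν (suc r) = cong (_∸ μ (suc r))
    (trans (cong (_⊓ ν (suc r)) (sym (m≤n⇒m⊓n≡m (n≤1+n (μ r))))) (⊓-assoc (μ r) (suc (μ r)) (ν (suc r))))

module Ribbon {μ ν : Seq} (skew : IsSkew μ ν) (R : ℕ) where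
  private
    N = boxes μ (shrink μ ν) 0 R
    rib = shrink-ribbon skew

  length≡ : length N ≡ psum (len μ ν) R
  length≡ = length-boxes≡ μ (shrink μ ν) 0 R

  numCols≡ : numCols N ≡ psum (most μ ν) R
  numCols≡ = trans (numCols-boxes rib 0 R) (psum-cong (λ r → sym (most≡fresh μ ν r)) R)

  numComponents≡ : numComponents N ≡ psum (most μ ν) R ∸ psum (least μ ν) R
  numComponents≡ = trans (sym (m+n∸n≡m _ (psum (least μ ν) R)))
      (cong (_∸ psum (least μ ν) R) (trans (sym (numCols-components rib 0 R)) numCols≡))

  numRows≡ : numRows N ≡ psum (len μ ν) R ∸ psum (least μ ν) R
  numRows≡ = trans (sym (m+n∸n≡m _ (psum (least μ ν) R))) (cong (_∸ psum (least μ ν) R) (numRows-boxes rib 0 R))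

-- Equality of characters under repeated removal of ribbons

sameSkewChar⇒samePictures : ∀ {R R′ μ ν μ′ ν′} → IsSkew μ ν → IsSkew μ′ ν′ →
  SameSkewChar (boxes μ ν 0 R) (boxes μ′ ν′ 0 R′) → SamePictures R μ ν R′ μ′ ν′
sameSkewChar⇒samePictures {R} {R′} {μ} {ν} {μ′} {ν′} skew skew′ same n τ dτ sτ = subst
  (λ m → Pictures {m} R μ ν (λ _ → 0) τ ↔ Pictures {m} R′ μ′ ν′ (λ _ → 0) τ) (length-list n τ)
  (pictures-cong (λ _ → refl) (part-list n τ sτ) ↔-∘ (lrCoeff↔pictures skew′ R′ ρ ↔-∘
    (subst (λ k → Fin (lrCoeff (boxes μ ν 0 R) ρ) ↔ Fin k) (same ρ decr-ρ) (↔-id _) ↔-∘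
    (↔-sym (lrCoeff↔pictures skew R ρ) ↔-∘ pictures-cong (λ _ → refl) (λ i → sym (part-list n τ sτ i))))))
  where
  -- Trailing zeros are kept, so that ρ has length n and its coefficient counts matrices with
  -- exactly n letters.
  ρ = applyUpTo τ n
  length-list : ∀ n (τ : Seq) → length (applyUpTo τ n) ≡ n
  length-list zero    τ = refl
  length-list (suc n) τ = cong suc (length-list n (τ ∘ suc))
  part-list : ∀ n (τ : Seq) → Supp n τ → ∀ i → part (applyUpTo τ n) i ≡ τ i
  part-list zero    τ s i       = sym (s i z≤n)
  part-list (suc n) τ s zero    = refl
  part-list (suc n) τ s (suc i) = part-list n (τ ∘ suc) (λ j h → s (suc j) (s≤s h)) i
  decr-ρ : IsPartition ρ
  decr-ρ i = subst₂ _≤_ (sym (part-list n τ sτ (suc i))) (sym (part-list n τ sτ i)) (dτ i)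

samePictures⇒sameSkewChar : ∀ {R R′ μ ν μ′ ν′} → IsSkew μ ν → IsSkew μ′ ν′ →
  SamePictures R μ ν R′ μ′ ν′ → SameSkewChar (boxes μ ν 0 R) (boxes μ′ ν′ 0 R′)
samePictures⇒sameSkewChar {R} {R′} skew skew′ same ρ dρ = ↔⇒≡
  (↔-sym (lrCoeff↔pictures skew′ R′ ρ) ↔-∘ (same (length ρ) (part ρ) dρ (part-supp ρ) ↔-∘ lrCoeff↔pictures skew R ρ))

-- The inner shape after i removals; ν stays the outer shape throughout.
peel : ℕ → Seq → Seq → Seq
peel zero    μ ν = μ
peel (suc i) μ ν = shrink (peel i μ ν) ν

module _ {μ ν : Seq} (skew : IsSkew μ ν) (R : ℕ) where

  peel-skew : ∀ i → IsSkew (peel i μ ν) ν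
  peel-skew zero    = skew
  peel-skew (suc i) = shrink-skew (peel-skew i)

  removeNW≡ : ∀ i → removeNW i (boxes μ ν 0 R) ≡ boxes (peel i μ ν) ν 0 R
  removeNW≡ zero    = refl
  removeNW≡ (suc i) = trans (cong (λ S → filterᵇ (λ b → not (b ∈B nw₁ S)) S) (removeNW≡ i))
      (removeNW-boxes (peel-skew i) R)

  nw≡ : ∀ i → nw (suc i) (boxes μ ν 0 R) ≡ boxes (peel i μ ν) (peel (suc i) μ ν) 0 R
  nw≡ i = trans (cong nw₁ (removeNW≡ i)) (nw₁-boxes (peel-skew i) R)

theorem6p1 : (λA μA λB μB : List ℕ)
    → IsPartition λA → IsPartition μA → μA ⊆ₚ λA
    → IsPartition λB → IsPartition μB → μB ⊆ₚ λB
    → SameSkewChar (skewBoxes λA μA) (skewBoxes λB μB)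
    → (∀ i → length (nw (suc i) (skewBoxes λA μA)) ≡ length (nw (suc i) (skewBoxes λB μB)))
    × (∀ i → numComponents (nw (suc i) (skewBoxes λA μA)) ≡ numComponents (nw (suc i) (skewBoxes λB μB)))
    × (∀ i → (armLength (nw (suc i) (skewBoxes λA μA)) ≡ armLength (nw (suc i) (skewBoxes λB μB)))
    × (legLength (nw (suc i) (skewBoxes λA μA)) ≡ legLength (nw (suc i) (skewBoxes λB μB))))
    × (∀ i → SameSkewChar (removeNW i (skewBoxes λA μA)) (removeNW i (skewBoxes λB μB)))
theorem6p1 λA μA λB μB dλA dμA leA dλB dμB leB same
  rewrite skewBoxes≡boxes λA μA leA | skewBoxes≡boxes λB μB leB =
  (λ i → via length i (trans (RA.length≡ i) (trans (sizes i) (sym (RB.length≡ i))))) ,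
  (λ i → via numComponents i (comps i)) ,
  (λ i → via armLength i (cong₂ _∸_ (cols i) (comps i)) , via legLength i (cong₂ _∸_ (rows i) (comps i))) ,
  (λ i → subst₂ SameSkewChar (sym (removeNW≡ skewA RA i)) (sym (removeNW≡ skewB RB i))
    (samePictures⇒sameSkewChar (peel-skew skewA RA i) (peel-skew skewB RB i) (pictures i)))
  where
  RA = length λA
  RB = length λB
  skewA : IsSkew (part μA) (part λA)
  skewA = record { decr-μ = dμA ; decr-ν = dλA ; μ≤ν = leA }
  skewB : IsSkew (part μB) (part λB)
  skewB = record { decr-μ = dμB ; decr-ν = dλB ; μ≤ν = leB }
  A B : ℕ → Seq
  A i = peel i (part μA) (part λA)
  B i = peel i (part μB) (part λB)
  skA : ∀ i → IsSkew (A i) (part λA)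
  skA = peel-skew skewA RA
  skB : ∀ i → IsSkew (B i) (part λB)
  skB = peel-skew skewB RB
  module RA i = Ribbon (skA i) RA
  module RB i = Ribbon (skB i) RB
  -- The iteration runs on pictures; characters are converted at the start and, for part (4), back
  -- at the end.
  pictures : ∀ i → SamePictures RA (A i) (part λA) RB (B i) (part λB)
  pictures zero    = sameSkewChar⇒samePictures skewA skewB same
  pictures (suc i) = same-shrink (skA i) (skB i) (pictures i)
  sizes = λ i → size-≡ (skA i) (skB i) (pictures i)
  leasts = λ i → least-≡ (skA i) (skB i) (pictures i)
  mosts = λ i → most-≡ (skA i) (skB i) (pictures i)
  NA NB : ℕ → List Box
  NA i = boxes (A i) (A (suc i)) 0 RA
  NB i = boxes (B i) (B (suc i)) 0 RB
  via : (f : List Box → ℕ) → ∀ i → f (NA i) ≡ f (NB i) → f (nw (suc i) (boxes (part μA) (part λA) 0 RA)) ≡ f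
      (nw (suc i) (boxes (part μB) (part λB) 0 RB))
  via f i e = trans (cong f (nw≡ skewA RA i)) (trans e (cong f (sym (nw≡ skewB RB i))))
  comps : ∀ i → numComponents (NA i) ≡ numComponents (NB i)
  comps i = trans (RA.numComponents≡ i) (trans (cong₂ _∸_ (mosts i) (leasts i)) (sym (RB.numComponents≡ i)))
  cols : ∀ i → numCols (NA i) ≡ numCols (NB i)
  cols i = trans (RA.numCols≡ i) (trans (mosts i) (sym (RB.numCols≡ i)))
  rows : ∀ i → numRows (NA i) ≡ numRows (NB i)
  rows i = trans (RA.numRows≡ i) (trans (cong₂ _∸_ (sizes i) (leasts i)) (sym (RB.numRows≡ i)))
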